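{- Let $c$, $s$ and $k$ be fixed integers satisfying $c,k\ge 2$ and $1\le s\le c-1$. Let $t=\lceil sk/c\rceil$ and let $\lambda\in[c]$ be the integer with $\lambda\equiv sk \pmod{c}$. Then \[\lim_{n\to\infty} f_{c,s}(n,k)\bigg/\binom{n}{t}=\frac{1}{\binom{k}{t}-m(k,t,\lambda;s+1,c-s+1)}.\]
   Context: For a positive integer $m$, $[m]=\{1,\dots,m\}$, and $\binom{X}{k}$ is the family of $k$-subsets of $X$. A hypergraph $\mathcal{F}\subseteq 2^{[n]}$ is $(c,s)$-frameproof if for every $c+1$ edges $A_0,A_1,\dots,A_c\in\mathcal{F}$ with $A_0\neq A_j$ for each $j\in[c]$ (where $A_1,\dots,A_c$ need not be distinct), there is some $i\in A_0$ with $|\{j\in[c]: i\in A_j\}|<s$. $f_{c,s}(n,k)$ denotes the maximum size of a $(c,s)$-frameproof hypergraph $\mathcal{F}\subseteq\binom{[n]}{k}$. A sequence $A_1,\dots,A_\lambda$ of subsets of $[n]$ (repetitions allowed) is $k_1$-disjoint if $\bigcap_{i\in B}A_i=\emptyset$ for every $B\in\binom{[\lambda]}{k_1}$ (vacuous if $k_1>\lambda$); it is $k_2$-covering if $\bigcup_{i\in B}A_i=[n]$ for every $B\in\binom{[\lambda]}{k_2}$ (vacuous if $k_2>\lambda$); it is $(k_1,k_2)$-disjoint if it is both $k_1$-disjoint and $k_2$-covering. The generalized matching number $m(n,t,\lambda;k_1,k_2)$ is the maximum size of a family $\mathcal{F}\subseteq\binom{[n]}{t}$ such that there are no $A_1,\dots,A_\lambda\in\mathcal{F}$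 (not necessarily distinct) forming a $(k_1,k_2)$-disjoint sequence. -}

module Defs where

open import Data.Nat using (ℕ; zero; suc; _≤_; _<_)
open import Data.Integer using (+_)
open import Data.Rational using (ℚ; 0ℚ; _/_; _-_) renaming (_<_ to _<ℚ_; ∣_∣ to absℚ)
open import Data.Fin using (Fin)
open import Data.Fin.Subset using (Subset; _∈_; ∣_∣)
open import Data.Fin.Subset.Properties using (_∈?_)
open import Data.List using (List; length; filter; allFin)
open import Data.List.Relation.Unary.All using (All)
open import Data.List.Relation.Unary.Unique.Propositional using (Unique)
import Data.List.Membership.Propositional as L
open import Data.Product using (Σ; ∃; _×_)
open import Relation.Binary.PropositionalEquality using (_≡_; _≢_)
open import Relation.Nullary using (¬_)

IsUniform : (n k : ℕ) → List (Subset n) → Set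
IsUniform n k F = Unique F × All (λ A → ∣ A ∣ ≡ k) F

mult : {n c : ℕ} → Fin n → (Fin c → Subset n) → ℕ
mult {c = c} i A = length (filter (λ j → i ∈? A j) (allFin c))

Frameproof : (c s : ℕ) {n : ℕ} → List (Subset n) → Set
Frameproof c s {n} F =
  ∀ (A₀ : Subset n) → A₀ L.∈ F →
  ∀ (A : Fin c → Subset n) → (∀ j → A j L.∈ F) → (∀ j → A₀ ≢ A j) →
  ∃ λ (i : Fin n) → i ∈ A₀ × mult i A < s

IsMaxSize : (n k : ℕ) → (List (Subset n) → Set) → ℕ → Set
IsMaxSize n k P v =
  (∃ λ F → IsUniform n k F × P F × length F ≡ v) ×
  (∀ F → IsUniform n k F → P F → length F ≤ v)

IsFrameproofMax : (c s n k v : ℕ) → Set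
IsFrameproofMax c s n k v = IsMaxSize n k (Frameproof c s) v

Disjoint : {n lam : ℕ} → ℕ → (Fin lam → Subset n) → Set
Disjoint {n} {lam} k₁ A =
  ∀ (B : Subset lam) → ∣ B ∣ ≡ k₁ → ∀ (x : Fin n) → ¬ (∀ i → i ∈ B → x ∈ A i)

Covering : {n lam : ℕ} → ℕ → (Fin lam → Subset n) → Set
Covering {n} {lam} k₂ A =
  ∀ (B : Subset lam) → ∣ B ∣ ≡ k₂ → ∀ (x : Fin n) → ∃ λ i → i ∈ B × x ∈ A i

DisjointCovering : {n lam : ℕ} → ℕ → ℕ → (Fin lam → Subset n) → Set
DisjointCovering k₁ k₂ A = Disjoint k₁ A × Covering k₂ A

NoDisjointSeq : (lam k₁ k₂ : ℕ) {n : ℕ} → List (Subset n) → Set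
NoDisjointSeq lam k₁ k₂ {n} F =
  ∀ (A : Fin lam → Subset n) → (∀ i → A i L.∈ F) → ¬ DisjointCovering k₁ k₂ A

IsMatchingNumber : (n t lam k₁ k₂ v : ℕ) → Set
IsMatchingNumber n t lam k₁ k₂ v = IsMaxSize n t (NoDisjointSeq lam k₁ k₂) v

-- a / b as a rational (set to 0 when b = 0; only relevant for finitely many n)
_÷_ : ℕ → ℕ → ℚ
a ÷ zero = 0ℚ
a ÷ suc b = (+ a) / suc b

Converges : (ℕ → ℚ) → ℚ → Set
Converges u L = ∀ (ε : ℚ) → 0ℚ <ℚ ε → ∃ λ N → ∀ n → N ≤ n → absℚ (u n - L) <ℚ ε

{-# OPTIONS --safe #-}
module Submission where

-- Upper bound.  Call a subset of an edge A own if no other edge contains it, so that each set is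
-- own for at most one edge.  If A has no own (t-1)-subset, then its non-own t-subsets contain no
-- (s+1,c-s+1)-disjoint sequence of length λ: such a sequence could be completed, by c-λ sets of
-- size at most t-1, to c non-own sets covering every point of A exactly s times, and c edges
-- through these sets would violate frameproofness.  So all but C(n,t-1) edges have at least
-- a = C(k,t) - m own t-subsets.
--
-- Lower bound.  Let 𝓜 be an extremal family for m.  It suffices to place k-sets, each with a copy
-- of 𝓜 on it, so that two of them share at most t points, any shared t-set lying in both copies,
-- while the a t-sets outside the copies fill almost all of C(n,t).  Such packings are obtained by
-- amplification.  A packing on N points lifts to N q points: each of the q^t polynomials of degree
-- below t over ℤ/q is a section [N] → [N] × ℤ/q, each transversal t-set lies in exactly one
-- section, and every section carries a copy of the packing, permuted arbitrarily.  Above each old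
-- block K there are q^t further candidates, the graphs on K of the monic polynomials of degree t;
-- the t-subsets of such a graph lie in pairwise different sections, so for random permutations it
-- fits into the free space with probability bounded below.  Hence the density grows by a constant
-- factor as long as a positive fraction of the t-sets is free.

open import Defs
open import Data.Bool.Base using (Bool; true; false)
import Data.Bool.Properties as Bool
import Data.Sum.Properties
open import Data.Empty using (⊥; ⊥-elim)
open import Data.Unit.Base using (tt)
open import Data.Product using (∃; _×_; _,_; proj₁; proj₂; uncurry)
open import Data.Sum.Base using (_⊎_; inj₁; inj₂)
open import Data.Nat using (ℕ; zero; suc; _+_; _*_; _∸_; _^_; _≤_; _<_; z≤n; s≤s; NonZero; >-nonZero; >-nonZero⁻¹; _!)
open import Data.Nat.Properties
open import Data.Nat.Combinatorics using (_C_; nCn≡1; nCk≡nC[n∸k]; nCk+nC[k+1]≡[n+1]C[k+1]; nCk≡n!/k![n-k]!; k![n∸k]!∣n!)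
open import Data.Nat.DivMod using (m≡m%n+[m/n]*n; m%n<n; m/n*n≡m)
open import Data.Fin as Fin using (Fin; zero; suc; toℕ; combine; remQuot; quotient; remainder; finToFun; funToFin; punchIn; punchOut)
import Data.Fin.Properties as Fin
open import Data.Fin.Permutation using (Permutation′; _⟨$⟩ʳ_; _⟨$⟩ˡ_; inverseˡ; inverseʳ; insert-punchIn) renaming (insert to insertₚ; id to idₚ)
open import Data.Fin.Subset using (Subset; _∈_; _∉_; _⊆_; ∣_∣; ∁; ⊤; _∪_)
open import Data.Fin.Subset.Properties
open import Data.Vec.Base as Vec using (Vec; []; _∷_; lookup; tabulate; _[_]≔_; here; there)
import Data.Vec.Properties as Vec
open import Data.List.Base as List using (List; []; _∷_; length; map; filter; allFin; _++_; concatMap; cartesianProduct)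
import Data.List.Properties as List
import Data.List.Membership.Propositional as L
import Data.List.Membership.Propositional.Properties as L
open import Data.List.Relation.Unary.Any as Any using (here; there)
open import Data.List.Relation.Unary.All as All using (All; []; _∷_)
import Data.List.Relation.Unary.All.Properties as All
open import Data.List.Relation.Unary.AllPairs.Core using ([]; _∷_)
open import Data.List.Relation.Unary.Unique.Propositional using (Unique)
import Data.List.Relation.Unary.Unique.Propositional.Properties as Unique
open import Data.Integer.Base as ℤ using (ℤ)
import Data.Integer.Properties as ℤ
import Data.Integer.Divisibility.Signed as ℤ
open import Data.Nat.Divisibility using (_∣_)
open import Data.Nat.Coprimality using (Coprime; coprime-divisor)
open import Relation.Binary.PropositionalEquality
open import Relation.Binary.Definitions using (DecidableEquality; tri<; tri≈; tri>)
open import Relation.Nullary using (¬_; Dec; yes; no; contradiction; does)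
open import Relation.Nullary.Decidable using (¬?; _×-dec_; _→-dec_; dec-true; dec-false; decidable-stable)
open import Relation.Unary using (Decidable)
open import Function.Base using (_∘_; id; case_of_)
import Data.Nat.Divisibility as Nat
import Data.Nat.Base as ℕ
import Data.Integer.DivMod as ℤ
open import Data.Integer.Tactic.RingSolver using () renaming (solve-∀ to ℤ-solve-∀)
open import Data.Nat.Tactic.RingSolver using () renaming (solve-∀ to ℕ-solve-∀)
import Data.Rational as ℚ
import Data.Rational.Properties as ℚ
open import Algebra.Properties.Group ℚ.+-0-group using () renaming (⁻¹-involutive to ℚ-neg-involutive)
open import Data.Rational.Base using (mkℚ)
open import Data.Rational.Unnormalised.Base using (mkℚᵘ)
import Data.Rational.Unnormalised.Base as ℚᵘ
import Data.Rational.Unnormalised.Properties as ℚᵘ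

-- The number λ enters by counting. Since sk = λ + (t-1)c, whenever c sets of size at most t cover
-- each of k points exactly s times, at least λ of them have size t, and any λ of these form an
-- (s+1,c-s+1)-disjoint sequence. This one fact makes the packing frameproof and shows m < C(k,t);
-- its converse, the completion of such a sequence, drives the upper bound.
--
-- The crossings are monic of degree t because such a polynomial agrees with any polynomial of
-- degree below t in at most t points. Different t-subsets of one crossing therefore consult
-- different permutations, and their events are independent.
--
-- The moduli are 1 + jN!. Differences of points are units modulo these numbers, so polynomials have
-- as few roots as over a field; and the moduli form an arithmetic progression, whose bounded gaps
-- let a single packing serve every large n.
--
-- All estimates are cross-multiplied inequalities in ℕ, where a parameter `E` stands for the ratio
-- E/(1+E).

private
  variable
    A B : Set
    c k l m n p q s t : ℕ
    x y z : A
    xs ys : List A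

-- Indicators, finite sums and counting in lists

𝟙 : Bool → ℕ
𝟙 true  = 1
𝟙 false = 0

𝟙-no : ∀ {P : Set} (d : Dec P) → ¬ P → 𝟙 (does d) ≡ 0
𝟙-no d p = cong 𝟙 (dec-false d p)

𝟙-case : ∀ {P : Set} (d : Dec P) (Q : ℕ → Set) → (P → Q 1) → (¬ P → Q 0) → Q (𝟙 (does d))
𝟙-case (yes p) Q f g = f p
𝟙-case (no ¬p) Q f g = g ¬p

𝟙≤1 : ∀ b → 𝟙 b ≤ 1
𝟙≤1 true  = ≤-refl
𝟙≤1 false = z≤n

∑ : List A → (A → ℕ) → ℕ
∑ []       f = 0
∑ (x ∷ xs) f = f x + ∑ xs f

∑-cong : ∀ (xs : List A) {f g : A → ℕ} → (∀ x → x L.∈ xs → f x ≡ g x) → ∑ xs f ≡ ∑ xs g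
∑-cong []       h = refl
∑-cong (x ∷ xs) h = cong₂ _+_ (h x (here refl)) (∑-cong xs (λ y → h y ∘ there))

∑-mono : ∀ (xs : List A) {f g : A → ℕ} → (∀ x → x L.∈ xs → f x ≤ g x) → ∑ xs f ≤ ∑ xs g
∑-mono []       h = z≤n
∑-mono (x ∷ xs) h = +-mono-≤ (h x (here refl)) (∑-mono xs (λ y → h y ∘ there))

+-interchange : ∀ a b c d → (a + b) + (c + d) ≡ (a + c) + (b + d)
+-interchange a b c d = begin
  (a + b) + (c + d)  ≡⟨ +-assoc a b (c + d) ⟩
  a + (b + (c + d))  ≡⟨ cong (a +_) (+-assoc b c d) ⟨
  a + ((b + c) + d)  ≡⟨ cong (λ z → a + (z + d)) (+-comm b c) ⟩
  a + ((c + b) + d)  ≡⟨ cong (a +_) (+-assoc c b d) ⟩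
  a + (c + (b + d))  ≡⟨ +-assoc a c (b + d) ⟨
  (a + c) + (b + d)  ∎
  where open ≡-Reasoning

∑-+ : ∀ (xs : List A) (f g : A → ℕ) → ∑ xs (λ x → f x + g x) ≡ ∑ xs f + ∑ xs g
∑-+ []       f g = refl
∑-+ (x ∷ xs) f g = trans (cong (_ +_) (∑-+ xs f g)) (+-interchange (f x) (g x) _ _)

∑-*ˡ : ∀ (xs : List A) c (f : A → ℕ) → ∑ xs (λ x → c * f x) ≡ c * ∑ xs f
∑-*ˡ []       c f = sym (*-zeroʳ c)
∑-*ˡ (x ∷ xs) c f = trans (cong (_ +_) (∑-*ˡ xs c f)) (sym (*-distribˡ-+ c (f x) _))

∑-*ʳ : ∀ (xs : List A) c (f : A → ℕ) → ∑ xs (λ x → f x * c) ≡ ∑ xs f * c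
∑-*ʳ xs c f = trans (∑-cong xs (λ x _ → *-comm (f x) c)) (trans (∑-*ˡ xs c f) (*-comm c _))

∑-const : ∀ (xs : List A) c → ∑ xs (λ _ → c) ≡ length xs * c
∑-const []       c = refl
∑-const (x ∷ xs) c = cong (c +_) (∑-const xs c)

∑-zero : ∀ (xs : List A) → ∑ xs (λ _ → 0) ≡ 0
∑-zero xs = trans (∑-const xs 0) (*-zeroʳ (length xs))

∑-swap : ∀ (xs : List A) (ys : List B) (f : A → B → ℕ) →
         ∑ xs (λ x → ∑ ys (f x)) ≡ ∑ ys (λ y → ∑ xs (λ x → f x y))
∑-swap []       ys f = sym (∑-zero ys)
∑-swap (x ∷ xs) ys f = trans (cong (_ +_) (∑-swap xs ys f)) (sym (∑-+ ys (f x) _))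

∑-++ : ∀ (xs ys : List A) (f : A → ℕ) → ∑ (xs ++ ys) f ≡ ∑ xs f + ∑ ys f
∑-++ []       ys f = refl
∑-++ (x ∷ xs) ys f = trans (cong (f x +_) (∑-++ xs ys f)) (sym (+-assoc (f x) _ _))

∑-map : ∀ (g : A → B) xs (f : B → ℕ) → ∑ (map g xs) f ≡ ∑ xs (f ∘ g)
∑-map g []       f = refl
∑-map g (x ∷ xs) f = cong (f (g x) +_) (∑-map g xs f)

∑-concatMap : ∀ (g : A → List B) xs (f : B → ℕ) → ∑ (concatMap g xs) f ≡ ∑ xs (λ x → ∑ (g x) f)
∑-concatMap g []       f = refl
∑-concatMap g (x ∷ xs) f = trans (∑-++ (g x) _ f) (cong (_ +_) (∑-concatMap g xs f))

∑-one : ∀ (xs : List A) → ∑ xs (λ _ → 1) ≡ length xs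
∑-one xs = trans (∑-const xs 1) (*-identityʳ _)

∑-max : ∀ (xs : List A) (f : A → ℕ) c → (∀ x → x L.∈ xs → f x ≤ c) → ∑ xs f ≤ length xs * c
∑-max xs f c h = ≤-trans (∑-mono xs h) (≤-reflexive (∑-const xs c))

length-filter : ∀ {P : A → Set} (P? : Decidable P) (xs : List A) →
                length (filter P? xs) ≡ ∑ xs (λ x → 𝟙 (does (P? x)))
length-filter P? []       = refl
length-filter P? (x ∷ xs) with does (P? x)
... | true  = cong suc (length-filter P? xs)
... | false = length-filter P? xs

length-filter-¬ : ∀ {P : A → Set} (P? : Decidable P) (xs : List A) →
                  length (filter P? xs) + length (filter (¬? ∘ P?) xs) ≡ length xs
length-filter-¬ P? []       = refl
length-filter-¬ P? (x ∷ xs) with does (P? x)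
... | true  = cong suc (length-filter-¬ P? xs)
... | false = trans (+-suc _ _) (cong suc (length-filter-¬ P? xs))

length-cartesianProductWith : ∀ {C : Set} (f : A → B → C) xs ys →
                              length (List.cartesianProductWith f xs ys) ≡ length xs * length ys
length-cartesianProductWith f []       ys = refl
length-cartesianProductWith f (x ∷ xs) ys = trans (List.length-++ (map (f x) ys))
  (cong₂ _+_ (List.length-map (f x) ys) (length-cartesianProductWith f xs ys))

delete : ∀ {xs : List A} → x L.∈ xs → List A
delete {xs = _ ∷ xs} (here _)  = xs
delete {xs = y ∷ xs} (there p) = y ∷ delete p

length-delete : ∀ {xs : List A} (p : x L.∈ xs) → length xs ≡ suc (length (delete p))
length-delete (here _)  = refl
length-delete (there p) = cong suc (length-delete p)

∈-delete : ∀ {xs : List A} (p : x L.∈ xs) → y L.∈ xs → y ≢ x → y L.∈ delete p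
∈-delete (here refl) (here refl) ne = contradiction refl ne
∈-delete (here refl) (there q)   ne = q
∈-delete (there p)   (here refl) ne = here refl
∈-delete (there p)   (there q)   ne = there (∈-delete p q ne)

-- Each value is struck out of `ys` once it has been taken; injectivity on `xs` keeps the later
-- values in what is left.
length-injection : ∀ {xs : List A} {ys : List B} (f : A → B) → Unique xs →
                   (∀ {x} → x L.∈ xs → f x L.∈ ys) →
                   (∀ {x y} → x L.∈ xs → y L.∈ xs → f x ≡ f y → x ≡ y) →
                   length xs ≤ length ys
length-injection {xs = []}     f _       f∈ inj = z≤n
length-injection {xs = x ∷ xs} {ys} f (p ∷ u) f∈ inj = begin
  suc (length xs)                       ≤⟨ s≤s (length-injection f u rest (λ a b → inj (there a) (there b))) ⟩
  suc (length (delete (f∈ (here refl)))) ≡⟨ length-delete (f∈ (here refl)) ⟨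
  length ys                             ∎
  where
  open ≤-Reasoning
  rest : ∀ {y} → y L.∈ xs → f y L.∈ delete (f∈ (here refl))
  rest y∈ = ∈-delete (f∈ (here refl)) (f∈ (there y∈))
              (λ e → All.lookup p y∈ (sym (inj (there y∈) (here refl) e)))

length-⊆ : ∀ {xs ys : List A} → Unique xs → (∀ {x} → x L.∈ xs → x L.∈ ys) → length xs ≤ length ys
length-⊆ u sub = length-injection (λ x → x) u sub (λ _ _ e → e)

-- If some `y` were missing from `xs`, then `y ∷ xs` would be a list without repetitions inside `ys`
-- and longer than `ys`.
full-⊆ : DecidableEquality A → ∀ {xs ys : List A} → Unique xs → Unique ys →
         (∀ {x} → x L.∈ xs → x L.∈ ys) → length ys ≤ length xs → ∀ {y} → y L.∈ ys → y L.∈ xs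
full-⊆ _≟_ {xs} {ys} ux uy sub le {y} y∈ with Any.any? (y ≟_) xs
... | yes p = p
... | no ¬p = contradiction le (<⇒≱ (length-⊆ {xs = y ∷ xs} (All.tabulate (λ {z} z∈ e → ¬p (subst (L._∈ xs) (sym e) z∈)) ∷ ux)
                λ { (here refl) → y∈ ; (there q) → sub q }))

∑-𝟙-unique : ∀ {P : A → Set} (P? : Decidable P) {xs : List A} → Unique xs →
             (∀ {x y} → x L.∈ xs → y L.∈ xs → P x → P y → x ≡ y) → ∑ xs (λ x → 𝟙 (does (P? x))) ≤ 1
∑-𝟙-unique P? {[]}     u       h = z≤n
∑-𝟙-unique P? {x ∷ xs} (p ∷ u) h with P? x
... | no _   = ∑-𝟙-unique P? u (λ a b → h (there a) (there b))
... | yes px = ≤-reflexive (cong suc (trans (∑-cong xs none) (∑-zero xs)))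
  where
  none : ∀ y → y L.∈ xs → 𝟙 (does (P? y)) ≡ 0
  none y y∈ = 𝟙-no (P? y) (λ py → All.lookup p y∈ (h (here refl) (there y∈) px py))

lookup-∈ : ∀ (xs : List A) i → List.lookup xs i L.∈ xs
lookup-∈ (x ∷ xs) zero    = here refl
lookup-∈ (x ∷ xs) (suc i) = there (lookup-∈ xs i)

lookup-injective : ∀ {xs : List A} → Unique xs → ∀ {i j} → List.lookup xs i ≡ List.lookup xs j → i ≡ j
lookup-injective (p ∷ u) {zero}  {zero}  e = refl
lookup-injective {xs = _ ∷ xs} (p ∷ u) {zero}  {suc j} e = contradiction e (All.lookup p (lookup-∈ xs j))
lookup-injective {xs = _ ∷ xs} (p ∷ u) {suc i} {zero}  e = contradiction (sym e) (All.lookup p (lookup-∈ xs i))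
lookup-injective (p ∷ u) {suc i} {suc j} e = cong suc (lookup-injective u e)

∈-lookup : ∀ {xs : List A} → x L.∈ xs → ∃ λ i → List.lookup xs i ≡ x
∈-lookup (here refl) = zero , refl
∈-lookup (there p)   = let i , e = ∈-lookup p in suc i , e

length-allFin : ∀ n → length (allFin n) ≡ n
length-allFin n = List.length-tabulate id

-- Finite sets and images

_≟ˢ_ : DecidableEquality (Subset n)
_≟ˢ_ = Vec.≡-dec Bool._≟_

∈⇒lookup : ∀ {x : Fin n} {S : Subset n} → x ∈ S → lookup S x ≡ true
∈⇒lookup = Vec.[]=⇒lookup

lookup⇒∈ : ∀ {x : Fin n} {S : Subset n} → lookup S x ≡ true → x ∈ S
lookup⇒∈ {x = x} {S} = Vec.lookup⇒[]= x S

does-∈? : ∀ (x : Fin n) S → does (x ∈? S) ≡ lookup S x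
does-∈? x S with lookup S x in eq
... | true  = dec-true (x ∈? S) (lookup⇒∈ eq)
... | false = dec-false (x ∈? S) (λ x∈ → case trans (sym (∈⇒lookup x∈)) eq of λ ())

⟪_⟫ : {P : Fin n → Set} → Decidable P → Subset n
⟪ P? ⟫ = tabulate (does ∘ P?)

module _ {P : Fin n → Set} (P? : Decidable P) where
  ∈-⟪⟫⁺ : ∀ {x} → P x → x ∈ ⟪ P? ⟫
  ∈-⟪⟫⁺ {x} p = lookup⇒∈ (trans (Vec.lookup∘tabulate _ x) (dec-true (P? x) p))

  ∈-⟪⟫⁻ : ∀ {x} → x ∈ ⟪ P? ⟫ → P x
  ∈-⟪⟫⁻ {x} x∈ with P? x in eq
  ... | yes p = p
  ... | no ¬p = case trans (sym (∈⇒lookup x∈)) (trans (Vec.lookup∘tabulate (does ∘ P?) x) (cong does eq)) of λ ()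

length-filter-tabulate : ∀ {P : A → Set} (P? : Decidable P) n (f : Fin n → A) →
                         length (filter P? (List.tabulate f)) ≡ ∣ tabulate (does ∘ P? ∘ f) ∣
length-filter-tabulate P? zero    f = refl
length-filter-tabulate P? (suc n) f with does (P? (f zero))
... | true  = cong suc (length-filter-tabulate P? n (f ∘ suc))
... | false = length-filter-tabulate P? n (f ∘ suc)

∣⟪⟫∣ : ∀ {P : Fin n → Set} (P? : Decidable P) → length (filter P? (allFin n)) ≡ ∣ ⟪ P? ⟫ ∣
∣⟪⟫∣ {n} P? = length-filter-tabulate P? n id

elements : Subset n → List (Fin n)
elements {n} S = filter (_∈? S) (allFin n)

∈-elements⁺ : ∀ {x : Fin n} {S} → x ∈ S → x L.∈ elements S
∈-elements⁺ {x = x} {S} x∈ = L.∈-filter⁺ (_∈? S) (L.∈-allFin x) x∈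

∈-elements⁻ : ∀ {x : Fin n} {S} → x L.∈ elements S → x ∈ S
∈-elements⁻ {n} {S = S} x∈ = proj₂ (L.∈-filter⁻ (_∈? S) {xs = allFin n} x∈)

elements-unique : ∀ (S : Subset n) → Unique (elements S)
elements-unique {n} S = Unique.filter⁺ (_∈? S) (Unique.allFin⁺ n)

length-elements : ∀ (S : Subset n) → length (elements S) ≡ ∣ S ∣
length-elements S = trans (∣⟪⟫∣ (_∈? S)) (cong ∣_∣ (trans (Vec.tabulate-cong (λ x → does-∈? x S)) (Vec.tabulate∘lookup S)))

∣∣-∑ : ∀ (S : Subset n) → ∣ S ∣ ≡ ∑ (allFin n) (λ x → 𝟙 (does (x ∈? S)))
∣∣-∑ {n} S = trans (sym (length-elements S)) (length-filter (_∈? S) (allFin n))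

∣∣-injection : ∀ {S : Subset m} {T : Subset n} (f : Fin m → Fin n) → (∀ {x} → x ∈ S → f x ∈ T) →
               (∀ {x y} → x ∈ S → y ∈ S → f x ≡ f y → x ≡ y) → ∣ S ∣ ≤ ∣ T ∣
∣∣-injection {S = S} {T} f f∈ inj = subst₂ _≤_ (length-elements S) (length-elements T)
  (length-injection f (elements-unique S) (∈-elements⁺ ∘ f∈ ∘ ∈-elements⁻)
    (λ a b → inj (∈-elements⁻ a) (∈-elements⁻ b)))

⊆-∣∣-≡ : ∀ {S T : Subset n} → S ⊆ T → ∣ T ∣ ≤ ∣ S ∣ → S ≡ T
⊆-∣∣-≡ {S = []}    {[]}    sub le = refl
⊆-∣∣-≡ {S = true ∷ S}  {false ∷ T} sub le = case sub here of λ ()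
⊆-∣∣-≡ {S = true ∷ S}  {true ∷ T}  sub le = cong (true ∷_) (⊆-∣∣-≡ (drop-∷-⊆ sub) (≤-pred le))
⊆-∣∣-≡ {S = false ∷ S} {false ∷ T} sub le = cong (false ∷_) (⊆-∣∣-≡ (drop-∷-⊆ sub) le)
⊆-∣∣-≡ {S = false ∷ S} {true ∷ T}  sub le = contradiction (p⊆q⇒∣p∣≤∣q∣ (drop-∷-⊆ sub)) (<⇒≱ le)

abstract
  enumerate : ∀ (S : Subset n) → ∣ S ∣ ≡ m → ∃ λ (f : Fin m → Fin n) →
              (∀ i → f i ∈ S) × (∀ {i j} → f i ≡ f j → i ≡ j) × (∀ {x} → x ∈ S → ∃ λ i → f i ≡ x)
  enumerate S refl rewrite sym (length-elements S) =
    List.lookup (elements S) , (λ i → ∈-elements⁻ (lookup-∈ _ i)) , lookup-injective (elements-unique S) ,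
    (λ x∈ → ∈-lookup (∈-elements⁺ x∈))

abstract
  shrink : ∀ (S : Subset n) m → m ≤ ∣ S ∣ → ∃ λ W → W ⊆ S × ∣ W ∣ ≡ m
  shrink []          m       z≤n     = [] , id , refl
  shrink (true ∷ S)  zero    _       = let W , W⊆ , e = shrink S 0 z≤n in false ∷ W , out⊆ W⊆ , e
  shrink (true ∷ S)  (suc m) (s≤s p) = let W , W⊆ , e = shrink S m p in true ∷ W , s⊆s W⊆ , cong suc e
  shrink (false ∷ S) m       p       = let W , W⊆ , e = shrink S m p in false ∷ W , s⊆s W⊆ , e

abstract
  grow : ∀ (S : Subset n) m → ∣ S ∣ ≤ m → m ≤ n → ∃ λ W → S ⊆ W × ∣ W ∣ ≡ m
  grow {n} S m p q =
    let W , W⊆ , e = shrink (∁ S) (n ∸ m) (≤-trans (∸-monoʳ-≤ n p) (≤-reflexive (sym (∣∁p∣≡n∸∣p∣ S))))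
    in ∁ W , (λ x∈S → x∉p⇒x∈∁p (λ x∈W → x∈∁p⇒x∉p (W⊆ x∈W) x∈S)) ,
       trans (∣∁p∣≡n∸∣p∣ W) (trans (cong (n ∸_) e) (m∸[m∸n]≡n q))

abstract
  image : (Fin m → Fin n) → Subset m → Subset n
  image f S = ⟪ (λ y → Fin.any? (λ x → (x ∈? S) ×-dec (f x Fin.≟ y))) ⟫

  ∈-image⁺ : ∀ (f : Fin m → Fin n) {S x} → x ∈ S → f x ∈ image f S
  ∈-image⁺ f {S} x∈ = ∈-⟪⟫⁺ (λ y → Fin.any? (λ x → (x ∈? S) ×-dec (f x Fin.≟ y))) (_ , x∈ , refl)

  ∈-image⁻ : ∀ (f : Fin m → Fin n) {S y} → y ∈ image f S → ∃ λ x → x ∈ S × f x ≡ y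
  ∈-image⁻ f {S} = ∈-⟪⟫⁻ (λ y → Fin.any? (λ x → (x ∈? S) ×-dec (f x Fin.≟ y)))

module _ (f : Fin m → Fin n) {S : Subset m} where
  ∣image∣ : (∀ {x y} → f x ≡ f y → x ≡ y) → ∣ image f S ∣ ≡ ∣ S ∣
  ∣image∣ inj = ≤-antisym
    (subst₂ _≤_ (length-elements (image f S)) (trans (List.length-map f (elements S)) (length-elements S))
       (length-⊆ (elements-unique (image f S)) λ y∈ → case ∈-image⁻ f (∈-elements⁻ y∈) of
          λ { (x , x∈ , refl) → L.∈-map⁺ f (∈-elements⁺ x∈) }))
    (∣∣-injection f (∈-image⁺ f) (λ _ _ → inj))

  image-⊆ : ∀ {T} → (∀ {x} → x ∈ S → f x ∈ T) → image f S ⊆ T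
  image-⊆ h y∈ = case ∈-image⁻ f y∈ of λ { (x , x∈ , refl) → h x∈ }

image-injective : ∀ (f : Fin m → Fin n) → (∀ {x y} → f x ≡ f y → x ≡ y) →
                  ∀ {S T} → image f S ≡ image f T → S ≡ T
image-injective f inj e = ⊆-antisym (sub e) (sub (sym e))
  where
  sub : ∀ {S T} → image f S ≡ image f T → S ⊆ T
  sub e x∈ with y , y∈ , e′ ← ∈-image⁻ f (subst (_ ∈_) e (∈-image⁺ f x∈)) = subst (_∈ _) (inj e′) y∈

image-∘ : ∀ (f : Fin m → Fin n) (g : Fin l → Fin m) S → image (f ∘ g) S ≡ image f (image g S)
image-∘ f g S = ⊆-antisym (image-⊆ (f ∘ g) (∈-image⁺ f ∘ ∈-image⁺ g))
  (image-⊆ f λ y∈ → case ∈-image⁻ g y∈ of λ { (x , x∈ , refl) → ∈-image⁺ (f ∘ g) x∈ })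

-- Enumeration of the t-subsets

nC0≡1 : ∀ n → n C 0 ≡ 1
nC0≡1 n = trans (nCk≡nC[n∸k] {n = n} z≤n) (nCn≡1 n)

subsets : ∀ n → ℕ → List (Subset n)
subsets zero    zero    = [] ∷ []
subsets zero    (suc t) = []
subsets (suc n) zero    = map (false ∷_) (subsets n zero)
subsets (suc n) (suc t) = map (true ∷_) (subsets n t) ++ map (false ∷_) (subsets n (suc t))

length-subsets : ∀ n t → length (subsets n t) ≡ n C t
length-subsets zero    zero    = refl
length-subsets zero    (suc t) = refl
length-subsets (suc n) zero    = trans (List.length-map _ (subsets n 0)) (trans (length-subsets n 0) (trans (nC0≡1 n) (sym (nC0≡1 (suc n)))))
length-subsets (suc n) (suc t) = begin
  length (map (true ∷_) (subsets n t) ++ map (false ∷_) (subsets n (suc t)))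
    ≡⟨ List.length-++ (map (true ∷_) (subsets n t)) ⟩
  length (map (true ∷_) (subsets n t)) + length (map (false ∷_) (subsets n (suc t)))
    ≡⟨ cong₂ _+_ (List.length-map _ (subsets n t)) (List.length-map _ (subsets n (suc t))) ⟩
  length (subsets n t) + length (subsets n (suc t))
    ≡⟨ cong₂ _+_ (length-subsets n t) (length-subsets n (suc t)) ⟩
  n C t + n C suc t  ≡⟨ nCk+nC[k+1]≡[n+1]C[k+1] n t ⟩
  suc n C suc t      ∎
  where open ≡-Reasoning

∈-subsets⁺ : ∀ {t} (S : Subset n) → ∣ S ∣ ≡ t → S L.∈ subsets n t
∈-subsets⁺ []          refl = here refl
∈-subsets⁺ (true ∷ S)  refl = L.∈-++⁺ˡ (L.∈-map⁺ (true ∷_) (∈-subsets⁺ S refl))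
∈-subsets⁺ {t = zero}  (false ∷ S) e = L.∈-map⁺ (false ∷_) (∈-subsets⁺ S e)
∈-subsets⁺ {t = suc t} (false ∷ S) e = L.∈-++⁺ʳ _ (L.∈-map⁺ (false ∷_) (∈-subsets⁺ S e))

∈-subsets⁻ : ∀ n t {S} → S L.∈ subsets n t → ∣ S ∣ ≡ t
∈-subsets⁻ zero    zero    (here refl) = refl
∈-subsets⁻ (suc n) zero    S∈ with _ , S∈′ , refl ← L.∈-map⁻ (false ∷_) S∈ = ∈-subsets⁻ n zero S∈′
∈-subsets⁻ (suc n) (suc t) S∈ with L.∈-++⁻ (map (true ∷_) (subsets n t)) S∈
... | inj₁ p with _ , S∈′ , refl ← L.∈-map⁻ (true ∷_) p = cong suc (∈-subsets⁻ n t S∈′)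
... | inj₂ p with _ , S∈′ , refl ← L.∈-map⁻ (false ∷_) p = ∈-subsets⁻ n (suc t) S∈′

subsets-unique : ∀ n t → Unique (subsets n t)
subsets-unique zero    zero    = [] ∷ []
subsets-unique zero    (suc t) = []
subsets-unique (suc n) zero    = Unique.map⁺ Vec.∷-injectiveʳ (subsets-unique n zero)
subsets-unique (suc n) (suc t) = Unique.++⁺ (Unique.map⁺ Vec.∷-injectiveʳ (subsets-unique n t))
  (Unique.map⁺ Vec.∷-injectiveʳ (subsets-unique n (suc t)))
  λ (p , q) → case L.∈-map⁻ (true ∷_) p of λ { (_ , _ , refl) → case L.∈-map⁻ (false ∷_) q of λ { (_ , _ , ()) } }

-- Incidence patterns of points and sets

col : (Fin c → Subset k) → Fin k → Subset c
col T x = ⟪ (λ j → x ∈? T j) ⟫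

∈-col⁺ : ∀ (T : Fin c → Subset k) {x j} → x ∈ T j → j ∈ col T x
∈-col⁺ T {x} = ∈-⟪⟫⁺ (λ j → x ∈? T j)

∈-col⁻ : ∀ (T : Fin c → Subset k) {x j} → j ∈ col T x → x ∈ T j
∈-col⁻ T {x} = ∈-⟪⟫⁻ (λ j → x ∈? T j)

-- `col` turns an incidence matrix given by its rows into the same matrix given by its columns, so
-- it inverts itself; the second name marks the way back.
transpose : (Fin k → Subset c) → Fin c → Subset k
transpose = col

col-transpose : ∀ (W : Fin k → Subset c) x → col (transpose W) x ≡ W x
col-transpose W x = ⊆-antisym (∈-col⁻ W ∘ ∈-col⁻ (transpose W)) (∈-col⁺ (transpose W) ∘ ∈-col⁺ W)

∣⟪⟫∣-∑ : ∀ {P : Fin n → Set} (P? : Decidable P) → ∣ ⟪ P? ⟫ ∣ ≡ ∑ (allFin n) (λ x → 𝟙 (does (P? x)))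
∣⟪⟫∣-∑ {n} P? = trans (sym (∣⟪⟫∣ P?)) (length-filter P? (allFin n))

double-count : ∀ (T : Fin c → Subset k) → ∑ (allFin c) (λ j → ∣ T j ∣) ≡ ∑ (allFin k) (λ x → ∣ col T x ∣)
double-count {c} {k} T = begin
  ∑ (allFin c) (λ j → ∣ T j ∣)                                         ≡⟨ ∑-cong (allFin c) (λ j _ → ∣∣-∑ (T j)) ⟩
  ∑ (allFin c) (λ j → ∑ (allFin k) (λ x → 𝟙 (does (x ∈? T j))))        ≡⟨ ∑-swap (allFin c) (allFin k) _ ⟩
  ∑ (allFin k) (λ x → ∑ (allFin c) (λ j → 𝟙 (does (x ∈? T j))))        ≡⟨ ∑-cong (allFin k) (λ x _ → ∣⟪⟫∣-∑ (λ j → x ∈? T j)) ⟨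
  ∑ (allFin k) (λ x → ∣ col T x ∣)                                     ∎
  where open ≡-Reasoning

∑-allFin-const : ∀ n a → ∑ (allFin n) (λ _ → a) ≡ n * a
∑-allFin-const n a = trans (∑-const (allFin n) a) (cong (_* a) (length-allFin n))

∑-allFin-suc : ∀ n (f : Fin (suc n) → ℕ) → ∑ (allFin (suc n)) f ≡ f zero + ∑ (allFin n) (f ∘ suc)
∑-allFin-suc n f = cong (f zero +_) (trans (cong (λ xs → ∑ xs f) (sym (List.map-tabulate id suc))) (∑-map suc (allFin n) f))

∑-mono-< : ∀ {A : Set} (xs : List A) {f g : A → ℕ} {x} → (∀ x → f x ≤ g x) → x L.∈ xs → f x < g x → ∑ xs f < ∑ xs g
∑-mono-< (x ∷ xs) le (here refl) lt = +-mono-<-≤ lt (∑-mono xs (λ y _ → le y))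
∑-mono-< (x ∷ xs) le (there p)   lt = +-mono-≤-< (le x) (∑-mono-< xs le p lt)

-- Counting incidences in both ways, the sizes add up to `s * k`, that is `l + q * c`. Every set
-- contributes at most `q`, and one more if its size is `suc q`, so at least `l` sets must give that
-- extra one.
many-large : ∀ (T : Fin c → Subset k) → (∀ x → ∣ col T x ∣ ≡ s) → (∀ j → ∣ T j ∣ ≤ suc q) →
             s * k ≡ l + q * c → l ≤ ∣ ⟪ (λ j → ∣ T j ∣ ≟ suc q) ⟫ ∣
many-large {c} {k} {s} {q} {l} T exact small e = +-cancelʳ-≤ (q * c) l _ (begin
  l + q * c                                               ≡⟨ e ⟨
  s * k                                                   ≡⟨ *-comm s k ⟩
  k * s                                                   ≡⟨ ∑-allFin-const k s ⟨
  ∑ (allFin k) (λ _ → s)                                  ≡⟨ ∑-cong (allFin k) (λ x _ → exact x) ⟨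
  ∑ (allFin k) (λ x → ∣ col T x ∣)                        ≡⟨ double-count T ⟨
  ∑ (allFin c) (λ j → ∣ T j ∣)                            ≤⟨ ∑-mono (allFin c) (λ j _ → bound j) ⟩
  ∑ (allFin c) (λ j → 𝟙 (does (large? j)) + q)            ≡⟨ ∑-+ (allFin c) _ _ ⟩
  ∑ (allFin c) (λ j → 𝟙 (does (large? j))) + ∑ (allFin c) (λ _ → q)
    ≡⟨ cong₂ _+_ (sym (∣⟪⟫∣-∑ large?)) (trans (∑-allFin-const c q) (*-comm c q)) ⟩
  ∣ ⟪ large? ⟫ ∣ + q * c ∎)
  where
  open ≤-Reasoning
  large? : ∀ j → Dec (∣ T j ∣ ≡ suc q)
  large? j = ∣ T j ∣ ≟ suc q
  bound : ∀ j → ∣ T j ∣ ≤ 𝟙 (does (large? j)) + q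
  bound j = 𝟙-case (large? j) (λ i → ∣ T j ∣ ≤ i + q) ≤-reflexive (λ ne → ≤-pred (≤∧≢⇒< (small j) ne))

-- A point lies in exactly `s` of the `c` sets and misses exactly `c ∸ s`. Hence no `s + 1` of them
-- share it, and among any `c ∸ s + 1` one contains it; both persist for a selection of distinct
-- indices.
exact⇒disjointCovering : ∀ (T : Fin c → Subset k) → (∀ x → ∣ col T x ∣ ≡ s) →
                         (g : Fin l → Fin c) → (∀ {i j} → g i ≡ g j → i ≡ j) →
                         DisjointCovering (s + 1) (c ∸ s + 1) (T ∘ g)
exact⇒disjointCovering {c} {k} {s} T exact g g-inj = disjoint , covering
  where
  disjoint : Disjoint (s + 1) (T ∘ g)
  disjoint B e x h = <⇒≱ (≤-reflexive (trans (cong suc (exact x)) (trans (+-comm 1 s) (sym e))))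
    (∣∣-injection g (λ {i} i∈ → ∈-col⁺ T (h i i∈)) (λ _ _ → g-inj))
  covering : Covering (c ∸ s + 1) (T ∘ g)
  covering B e x with Fin.any? (λ i → (i ∈? B) ×-dec (x ∈? T (g i)))
  ... | yes p = p
  ... | no ¬p = contradiction
    (∣∣-injection {T = ∁ (col T x)} g (λ {i} i∈ → x∉p⇒x∈∁p (λ gi∈ → ¬p (i , i∈ , ∈-col⁻ T gi∈))) (λ _ _ → g-inj))
    (<⇒≱ (≤-reflexive (trans (cong suc (trans (∣∁p∣≡n∸∣p∣ (col T x)) (cong (c ∸_) (exact x)))) (trans (+-comm 1 _) (sym e)))))

abstract
  exact⇒subsequence : ∀ (T : Fin c → Subset k) → (∀ x → ∣ col T x ∣ ≡ s) → (∀ j → ∣ T j ∣ ≤ suc q) →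
                      s * k ≡ l + q * c →
                      ∃ λ (g : Fin l → Fin c) → (∀ i → ∣ T (g i) ∣ ≡ suc q) × DisjointCovering (s + 1) (c ∸ s + 1) (T ∘ g)
  exact⇒subsequence {c} {q = q} {l} T exact small e =
    g , (λ i → ∈-⟪⟫⁻ large? (enum∈ (Fin.inject≤ i le))) ,
    exact⇒disjointCovering T exact g (λ e′ → Fin.inject≤-injective le le _ _ (enum-inj e′))
    where
    large? : ∀ j → Dec (∣ T j ∣ ≡ suc q)
    large? j = ∣ T j ∣ ≟ suc q
    le : l ≤ ∣ ⟪ large? ⟫ ∣
    le = many-large T exact small e
    en : ∃ λ (f : Fin ∣ ⟪ large? ⟫ ∣ → Fin c) → (∀ i → f i ∈ ⟪ large? ⟫) × (∀ {i j} → f i ≡ f j → i ≡ j) × (∀ {x} → x ∈ ⟪ large? ⟫ → ∃ λ i → f i ≡ x)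
    en = enumerate ⟪ large? ⟫ refl
    enum∈ : ∀ i → proj₁ en i ∈ ⟪ large? ⟫
    enum∈ = proj₁ (proj₂ en)
    enum-inj : ∀ {i j} → proj₁ en i ≡ proj₁ en j → i ≡ j
    enum-inj = proj₁ (proj₂ (proj₂ en))
    g : Fin l → Fin c
    g i = proj₁ en (Fin.inject≤ i le)

nested : ∀ (L : Subset p) m → m ≤ p → ∃ λ W → ∣ W ∣ ≡ m × (W ⊆ L ⊎ L ⊆ W)
nested L m m≤p with ≤-total m ∣ L ∣
... | inj₁ le = let W , W⊆ , e = shrink L m le in W , e , inj₁ W⊆
... | inj₂ le = let W , ⊆W , e = grow L m le m≤p in W , e , inj₂ ⊆W

row : (Fin k → Subset p) → Fin p → ℕ
row {k} W j = ∑ (allFin k) (λ x → 𝟙 (does (j ∈? W x)))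

-- The matrix is filled greedily, point by point: the rows receiving the next point are chosen, by
-- `nested`, comparable with the set of rows whose sum is `u`. If they lie inside that set, all row
-- sums stay in [u, u+1]; if they contain it, all row sums move into [u+1, u+2].
balanced : ∀ k (r : Fin k → ℕ) → (∀ x → r x ≤ p) → ∃ λ (W : Fin k → Subset p) →
           (∀ x → ∣ W x ∣ ≡ r x) × ∃ λ u → ∀ j → u ≤ row W j × row W j ≤ suc u
balanced zero r r≤ = (λ ()) , (λ ()) , 0 , λ j → z≤n , z≤n
balanced {p} (suc k) r r≤ = W , W-size , step W₀⊆⊎
  where
  ih = balanced k (r ∘ suc) (r≤ ∘ suc)
  W′ = proj₁ ih
  u  = proj₁ (proj₂ (proj₂ ih))
  bounds = proj₂ (proj₂ (proj₂ ih))
  lowest? : ∀ j → Dec (row W′ j ≡ u)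
  lowest? j = row W′ j ≟ u
  choice = nested ⟪ lowest? ⟫ (r zero) (r≤ zero)
  W₀ = proj₁ choice
  W₀⊆⊎ = proj₂ (proj₂ choice)
  W : Fin (suc k) → Subset p
  W zero    = W₀
  W (suc x) = W′ x
  W-size : ∀ x → ∣ W x ∣ ≡ r x
  W-size zero    = proj₁ (proj₂ choice)
  W-size (suc x) = proj₁ (proj₂ ih) x
  row-W : ∀ j → row W j ≡ 𝟙 (does (j ∈? W₀)) + row W′ j
  row-W j = ∑-allFin-suc k (λ x → 𝟙 (does (j ∈? W x)))
  step : W₀ ⊆ ⟪ lowest? ⟫ ⊎ ⟪ lowest? ⟫ ⊆ W₀ → ∃ λ u → ∀ j → u ≤ row W j × row W j ≤ suc u
  step (inj₁ sub) = u , λ j → ≤-trans (proj₁ (bounds j)) (≤-trans (m≤n+m _ _) (≤-reflexive (sym (row-W j)))) ,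
                              ≤-trans (≤-reflexive (row-W j)) (up j)
    where
    up : ∀ j → 𝟙 (does (j ∈? W₀)) + row W′ j ≤ suc u
    up j with j ∈? W₀
    ... | yes j∈ = s≤s (≤-reflexive (∈-⟪⟫⁻ lowest? (sub j∈)))
    ... | no _   = proj₂ (bounds j)
  step (inj₂ sup) = suc u , λ j → ≤-trans (down j) (≤-reflexive (sym (row-W j))) ,
                                  ≤-trans (≤-reflexive (row-W j)) (+-mono-≤ (𝟙≤1 (does (j ∈? W₀))) (proj₂ (bounds j)))
    where
    down : ∀ j → suc u ≤ 𝟙 (does (j ∈? W₀)) + row W′ j
    down j with j ∈? W₀
    ... | yes _  = s≤s (proj₁ (bounds j))
    ... | no j∉ = ≤∧≢⇒< (proj₁ (bounds j)) (λ e → j∉ (sup (∈-⟪⟫⁺ lowest? (sym e))))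

abstract
  -- Row sums of a balanced matrix differ by at most one. If one of them exceeded `b`, all would be
  -- at least `b`, and the total would exceed `p * b`.
  distribute : ∀ p k (r : Fin k → ℕ) b → (∀ x → r x ≤ p) → ∑ (allFin k) r ≤ p * b →
               ∃ λ (T : Fin p → Subset k) → (∀ x → ∣ col T x ∣ ≡ r x) × (∀ j → ∣ T j ∣ ≤ b)
  distribute p k r b r≤ total with balanced k r r≤
  ... | W , W-size , u , bounds =
    transpose W , (λ x → trans (cong ∣_∣ (col-transpose W x)) (W-size x)) , λ j → subst (_≤ b) (sym (size j)) (small j)
    where
    size : ∀ j → ∣ transpose W j ∣ ≡ row W j
    size j = ∣⟪⟫∣-∑ (λ x → j ∈? W x)
    total-row : ∑ (allFin p) (row W) ≤ p * b
    total-row = ≤-trans (≤-reflexive (begin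
      ∑ (allFin p) (row W)                               ≡⟨ ∑-cong (allFin p) (λ j _ → size j) ⟨
      ∑ (allFin p) (λ j → ∣ transpose W j ∣)             ≡⟨ double-count (transpose W) ⟩
      ∑ (allFin k) (λ x → ∣ col (transpose W) x ∣)       ≡⟨ ∑-cong (allFin k) (λ x _ → trans (cong ∣_∣ (col-transpose W x)) (W-size x)) ⟩
      ∑ (allFin k) r                                     ∎)) total
      where open ≡-Reasoning
    small : ∀ j → row W j ≤ b
    small j with row W j ≤? b
    ... | yes le = le
    ... | no ≰b  = contradiction total-row (<⇒≱ (subst (_< ∑ (allFin p) (row W)) (∑-allFin-const p b)
                     (∑-mono-< (allFin p) (λ i → ≤-trans (≤-pred (≤-trans (≰⇒> ≰b) (proj₂ (bounds j)))) (proj₁ (bounds i)))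
                       (L.∈-allFin j) (≰⇒> ≰b))))

abstract
  -- Because of such a sequence the family of all t-subsets is not admissible for the matching
  -- number; this is what makes the denominator of the limit positive.
  disjointCovering-exists : s ≤ c → s * k ≡ l + q * c → s * k ≤ c * suc q →
    ∃ λ (A : Fin l → Subset k) → (∀ i → ∣ A i ∣ ≡ suc q) × DisjointCovering (s + 1) (c ∸ s + 1) A
  disjointCovering-exists {s} {c} {k} s≤c e le
    with T , exact , small ← distribute c k (λ _ → s) _ (λ _ → s≤c)
                               (≤-trans (≤-reflexive (trans (∑-allFin-const k s) (*-comm k s))) le)
    with g , large , dc ← exact⇒subsequence T exact small e
    = T ∘ g , large , dc

module _ {A : Fin l → Subset k} where
  disjoint⇒col≤ : Disjoint (s + 1) A → ∀ x → ∣ col A x ∣ ≤ s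
  disjoint⇒col≤ {s} disj x with ∣ col A x ∣ ≤? s
  ... | yes le = le
  ... | no ≰s with B , B⊆ , e ← shrink (col A x) (s + 1) (subst (_≤ ∣ col A x ∣) (+-comm 1 s) (≰⇒> ≰s))
      = contradiction (λ i i∈ → ∈-col⁻ A (B⊆ i∈)) (disj B e x)

  covering⇒col≥ : Covering (m + 1) A → ∀ x → l ≤ m + ∣ col A x ∣
  covering⇒col≥ {m} cov x with l ≤? m + ∣ col A x ∣
  ... | yes le = le
  ... | no ≰m
      with B , B⊆ , e ← shrink (∁ (col A x)) (m + 1)
             (subst₂ _≤_ (+-comm 1 m) (sym (∣∁p∣≡n∸∣p∣ (col A x))) (m+n≤o⇒m≤o∸n (suc m) (≰⇒> ≰m)))
      with i , i∈ , x∈ ← cov B e x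
      = contradiction (∈-col⁺ A x∈) (x∈∁p⇒x∉p (B⊆ i∈))

abstract
  -- Disjointness makes the deficit `s ∸ ∣ col A x ∣` of each point a true difference, and covering
  -- bounds it by `c ∸ l`. The deficits add up to sk - l(q+1) = (c-l)q, so `distribute` can spread
  -- them over `c ∸ l` sets of size at most `q`.
  complete : s ≤ c → l ≤ c → s * k ≡ l + q * c → (A : Fin l → Subset k) → (∀ i → ∣ A i ∣ ≡ suc q) →
             DisjointCovering (s + 1) (c ∸ s + 1) A →
             ∃ λ (B : Fin (c ∸ l) → Subset k) → (∀ j → ∣ B j ∣ ≤ q) × (∀ x → ∣ col A x ∣ + ∣ col B x ∣ ≡ s)
  complete {s} {c} {l} {k} {q} s≤c l≤c e A large (disj , cov) =
    let B , exact , small = distribute (c ∸ l) k r q r≤ (≤-reflexive total)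
    in B , small , λ x → trans (cong (∣ col A x ∣ +_) (exact x)) (m+[n∸m]≡n (d≤s x))
    where
    d≤s : ∀ x → ∣ col A x ∣ ≤ s
    d≤s = disjoint⇒col≤ disj
    r : Fin k → ℕ
    r x = s ∸ ∣ col A x ∣
    r≤ : ∀ x → r x ≤ c ∸ l
    r≤ x = m+n≤o⇒m≤o∸n (r x) (begin
      r x + l                           ≤⟨ +-monoʳ-≤ (r x) (covering⇒col≥ cov x) ⟩
      r x + (c ∸ s + ∣ col A x ∣)       ≡⟨ cong (r x +_) (+-comm (c ∸ s) _) ⟩
      r x + (∣ col A x ∣ + (c ∸ s))     ≡⟨ +-assoc (r x) _ _ ⟨
      r x + ∣ col A x ∣ + (c ∸ s)       ≡⟨ cong (_+ (c ∸ s)) (m∸n+n≡m (d≤s x)) ⟩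
      s + (c ∸ s)                       ≡⟨ m+[n∸m]≡n s≤c ⟩
      c                                 ∎)
      where open ≤-Reasoning
    total : ∑ (allFin k) r ≡ (c ∸ l) * q
    total = +-cancelʳ-≡ (l * suc q) _ _ (begin
      ∑ (allFin k) r + l * suc q                                     ≡⟨ cong (∑ (allFin k) r +_) (∑-allFin-const l (suc q)) ⟨
      ∑ (allFin k) r + ∑ (allFin l) (λ _ → suc q)                    ≡⟨ cong (∑ (allFin k) r +_) (∑-cong (allFin l) (λ i _ → large i)) ⟨
      ∑ (allFin k) r + ∑ (allFin l) (λ i → ∣ A i ∣)                  ≡⟨ cong (∑ (allFin k) r +_) (double-count A) ⟩
      ∑ (allFin k) r + ∑ (allFin k) (λ x → ∣ col A x ∣)              ≡⟨ ∑-+ (allFin k) r _ ⟨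
      ∑ (allFin k) (λ x → r x + ∣ col A x ∣)                         ≡⟨ ∑-cong (allFin k) (λ x _ → m∸n+n≡m (d≤s x)) ⟩
      ∑ (allFin k) (λ x → s)                                         ≡⟨ ∑-allFin-const k s ⟩
      k * s                                                          ≡⟨ *-comm k s ⟩
      s * k                                                          ≡⟨ e ⟩
      l + q * c                                                      ≡⟨ cong (λ z → l + q * z) (m∸n+n≡m l≤c) ⟨
      l + q * (c ∸ l + l)                                            ≡⟨ cong (l +_) (trans (*-distribˡ-+ q (c ∸ l) l) (cong₂ _+_ (*-comm q (c ∸ l)) (*-comm q l))) ⟩
      l + ((c ∸ l) * q + l * q)                                      ≡⟨ +-comm l _ ⟩
      (c ∸ l) * q + l * q + l                                        ≡⟨ +-assoc ((c ∸ l) * q) _ _ ⟩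
      (c ∸ l) * q + (l * q + l)                                      ≡⟨ cong ((c ∸ l) * q +_) (trans (+-comm (l * q) l) (sym (*-suc l q))) ⟩
      (c ∸ l) * q + l * suc q                                        ∎)
      where open ≡-Reasoning

abstract
  exact-subpattern : ∀ (B : Fin c → Subset k) → (∀ x → s ≤ ∣ col B x ∣) →
                     ∃ λ (T : Fin c → Subset k) → (∀ j → T j ⊆ B j) × (∀ x → ∣ col T x ∣ ≡ s)
  exact-subpattern {c} {k} {s} B h = transpose W ,
    (λ j {x} x∈ → ∈-col⁻ B {x} {j} (proj₁ (proj₂ (shrunk x)) (∈-col⁻ W {j} {x} x∈))) ,
    (λ x → trans (cong ∣_∣ (col-transpose W x)) (proj₂ (proj₂ (shrunk x))))
    where
    shrunk : ∀ x → ∃ λ W → W ⊆ col B x × ∣ W ∣ ≡ s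
    shrunk x = shrink (col B x) s (h x)
    W : Fin k → Subset c
    W x = proj₁ (shrunk x)

-- Reed–Solomon codes over ℤ/q

-- Coefficients are listed from the constant term up.
eval : Vec ℤ n → ℤ → ℤ
eval []       x = ℤ.0ℤ
eval (c ∷ cs) x = c ℤ.+ x ℤ.* eval cs x

-- Synthetic division by x − a.
quot : Vec ℤ (suc n) → ℤ → Vec ℤ n
quot (c ∷ [])     a = []
quot (c ∷ d ∷ ds) a = eval (d ∷ ds) a ∷ quot (d ∷ ds) a

eval-quot : ∀ (cs : Vec ℤ (suc n)) a x →
            eval cs x ℤ.- eval cs a ≡ (x ℤ.- a) ℤ.* eval (quot cs a) x
eval-quot (c ∷ [])     a x = alg c a x
  where
  alg : ∀ c a x → (c ℤ.+ x ℤ.* ℤ.0ℤ) ℤ.- (c ℤ.+ a ℤ.* ℤ.0ℤ) ≡ (x ℤ.- a) ℤ.* ℤ.0ℤ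
  alg = ℤ-solve-∀
eval-quot (c ∷ d ∷ ds) a x = begin
  (c ℤ.+ x ℤ.* P) ℤ.- (c ℤ.+ a ℤ.* Q)                  ≡⟨ alg₁ c a x P Q ⟩
  x ℤ.* (P ℤ.- Q) ℤ.+ (x ℤ.- a) ℤ.* Q                  ≡⟨ cong (λ z → x ℤ.* z ℤ.+ (x ℤ.- a) ℤ.* Q) (eval-quot (d ∷ ds) a x) ⟩
  x ℤ.* ((x ℤ.- a) ℤ.* R) ℤ.+ (x ℤ.- a) ℤ.* Q          ≡⟨ alg₂ a x Q R ⟩
  (x ℤ.- a) ℤ.* (Q ℤ.+ x ℤ.* R)                        ∎
  where
  open ≡-Reasoning
  P = eval (d ∷ ds) x
  Q = eval (d ∷ ds) a
  R = eval (quot (d ∷ ds) a) x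
  alg₁ : ∀ c a x P Q → (c ℤ.+ x ℤ.* P) ℤ.- (c ℤ.+ a ℤ.* Q) ≡ x ℤ.* (P ℤ.- Q) ℤ.+ (x ℤ.- a) ℤ.* Q
  alg₁ = ℤ-solve-∀
  alg₂ : ∀ a x Q R → x ℤ.* ((x ℤ.- a) ℤ.* R) ℤ.+ (x ℤ.- a) ℤ.* Q ≡ (x ℤ.- a) ℤ.* (Q ℤ.+ x ℤ.* R)
  alg₂ = ℤ-solve-∀

eval-∷ʳ : ∀ (cs : Vec ℤ n) c x → eval (cs Vec.∷ʳ c) x ≡ eval cs x ℤ.+ x ℤ.^ n ℤ.* c
eval-∷ʳ []       c x = alg c x
  where
  alg : ∀ c x → c ℤ.+ x ℤ.* ℤ.0ℤ ≡ ℤ.0ℤ ℤ.+ ℤ.1ℤ ℤ.* c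
  alg = ℤ-solve-∀
eval-∷ʳ {suc n} (d ∷ cs) c x = trans (cong (λ z → d ℤ.+ x ℤ.* z) (eval-∷ʳ cs c x)) (alg d x (eval cs x) (x ℤ.^ n) c)
  where
  alg : ∀ d x e y c → d ℤ.+ x ℤ.* (e ℤ.+ y ℤ.* c) ≡ (d ℤ.+ x ℤ.* e) ℤ.+ (x ℤ.* y) ℤ.* c
  alg = ℤ-solve-∀

eval-- : ∀ (cs ds : Vec ℤ n) x → eval (Vec.zipWith ℤ._-_ cs ds) x ≡ eval cs x ℤ.- eval ds x
eval-- []       []       x = refl
eval-- (c ∷ cs) (d ∷ ds) x = trans (cong (λ z → (c ℤ.- d) ℤ.+ x ℤ.* z) (eval-- cs ds x)) (alg c d x _ _)
  where
  alg : ∀ c d x e f → (c ℤ.- d) ℤ.+ x ℤ.* (e ℤ.- f) ≡ (c ℤ.+ x ℤ.* e) ℤ.- (d ℤ.+ x ℤ.* f)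
  alg = ℤ-solve-∀

∣-cancel-+ʳ : ∀ {q a b} → q ℤ.∣ a ℤ.+ b → q ℤ.∣ b → q ℤ.∣ a
∣-cancel-+ʳ {q} {a} {b} p r = subst (q ℤ.∣_) (alg a b) (ℤ.∣m∣n⇒∣m-n p r)
  where
  alg : ∀ a b → (a ℤ.+ b) ℤ.- b ≡ a
  alg = ℤ-solve-∀

∣-eval : ∀ {q} (cs : Vec ℤ n) x → (∀ i → q ℤ.∣ lookup cs i) → q ℤ.∣ eval cs x
∣-eval {q = q} [] x h = ℤ.divides ℤ.0ℤ refl
∣-eval (c ∷ cs) x h = ℤ.∣m∣n⇒∣m+n (h zero) (ℤ.∣n⇒∣m*n x (∣-eval cs x (h ∘ suc)))

-- The coefficients of the quotient are the Horner tails at `a`. Going down from the leading one,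
-- each coefficient of `r` differs from such a tail by `a` times a value already known to be
-- divisible.
∣-quot : ∀ {q} c (r : Vec ℤ n) a → (∀ i → q ℤ.∣ lookup (quot (c ∷ r) a) i) → ∀ i → q ℤ.∣ lookup r i
∣-quot c (d ∷ ds) a h zero    = ∣-cancel-+ʳ (h zero) (ℤ.∣n⇒∣m*n a (∣-eval ds a (∣-quot d ds a (h ∘ suc))))
∣-quot c (d ∷ ds) a h (suc i) = ∣-quot d ds a (h ∘ suc) i

∣-last : ∀ {q} (cs : Vec ℤ n) c → (∀ i → q ℤ.∣ lookup (cs Vec.∷ʳ c) i) → q ℤ.∣ c
∣-last []       c h = h zero
∣-last (d ∷ cs) c h = ∣-last cs c (h ∘ suc)

-- The usual bound on the number of roots, obtained by dividing out the linear factor at the first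
-- point. As `q` may be composite, the differences of the points are assumed to be cancellable
-- modulo `q`.
vanishing : ∀ {q} (cs : Vec ℤ n) (x : Fin n → ℤ) →
            (∀ {i j} → i ≢ j → ∀ z → q ℤ.∣ (x i ℤ.- x j) ℤ.* z → q ℤ.∣ z) →
            (∀ i → q ℤ.∣ eval cs (x i)) → ∀ i → q ℤ.∣ lookup cs i
vanishing {n = suc n} {q} (c ∷ r) x sep h = λ where
    zero    → ∣-cancel-+ʳ (h zero) (ℤ.∣n⇒∣m*n (x zero) (∣-eval r (x zero) tail))
    (suc i) → tail i
  where
  tail : ∀ i → q ℤ.∣ lookup r i
  tail = ∣-quot c r (x zero) (vanishing (quot (c ∷ r) (x zero)) (x ∘ suc)
    (λ ne → sep (ne ∘ Fin.suc-injective))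
    (λ i → sep {suc i} {zero} (λ ()) _ (subst (q ℤ.∣_) (eval-quot (c ∷ r) (x zero) (x (suc i))) (ℤ.∣m∣n⇒∣m-n (h (suc i)) (h zero)))))

funToFin-cong : ∀ {f g : Fin m → Fin n} → (∀ i → f i ≡ g i) → funToFin f ≡ funToFin g
funToFin-cong {zero}  h = refl
funToFin-cong {suc m} h = cong₂ combine (h zero) (funToFin-cong (h ∘ suc))

finToFun-injective : ∀ {p p′ : Fin (n ^ m)} → (∀ i → finToFun {n} {m} p i ≡ finToFun p′ i) → p ≡ p′
finToFun-injective {n} {m} {p} {p′} h =
  trans (sym (Fin.funToFin-finToFin {m} {n} p)) (trans (funToFin-cong h) (Fin.funToFin-finToFin {m} {n} p′))

injective⇒surjective : ∀ (f : Fin n → Fin n) → (∀ {i j} → f i ≡ f j → i ≡ j) → ∀ y → ∃ λ x → f x ≡ y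
injective⇒surjective {suc n} f inj y with Fin.any? (λ x → f x Fin.≟ y)
... | yes p = p
... | no ¬p = contradiction (Fin.injective⇒≤ {f = λ x → punchOut (y≢ x)}
                              (λ {i} {j} e → inj (Fin.punchOut-injective (y≢ i) (y≢ j) e))) (<⇒≱ (n<1+n n))
  where
  y≢ : ∀ x → y ≢ f x
  y≢ x e = ¬p (x , sym e)

-- The sections are the polynomials of degree below t, the crossings the monic ones of degree t;
-- proj p S is the section that agrees with the crossing p on S.
record Code (N t q : ℕ) : Set where
  field
    sec crs    : Fin (q ^ t) → Fin N → Fin q
    sec-unique : ∀ {p p′} S → ∣ S ∣ ≡ t → (∀ {v} → v ∈ S → sec p v ≡ sec p′ v) → p ≡ p′
    crs-unique : ∀ {p p′} S → ∣ S ∣ ≡ t → (∀ {v} → v ∈ S → crs p v ≡ crs p′ v) → p ≡ p′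
    sec≢crs    : ∀ {p p′} S → ∣ S ∣ ≡ suc t → ¬ (∀ {v} → v ∈ S → sec p v ≡ crs p′ v)
    proj       : Fin (q ^ t) → Subset N → Fin (q ^ t)
    proj-spec  : ∀ p {S} → ∣ S ∣ ≡ t → ∀ {v} → v ∈ S → sec (proj p S) v ≡ crs p v

module _ (N t q : ℕ) .{{_ : NonZero q}} (1<q : 1 < q) (coprime : ∀ d → 1 ≤ d → d < N → Coprime q d) where

  private
    pt : Fin N → ℤ
    pt v = ℤ.+ toℕ v

    residue : ℤ → Fin q
    residue z = Fin.fromℕ< (ℤ.n%ℕd<d z q)

    residue-≡ : ∀ {y z} → residue y ≡ residue z → ℤ.+ q ℤ.∣ y ℤ.- z
    residue-≡ {y} {z} e = ℤ.divides (y ℤ./ℕ q ℤ.- z ℤ./ℕ q) (begin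
      y ℤ.- z
        ≡⟨ cong₂ ℤ._-_ (ℤ.a≡a%ℕn+[a/ℕn]*n y q) (ℤ.a≡a%ℕn+[a/ℕn]*n z q) ⟩
      (ℤ.+ (y ℤ.%ℕ q) ℤ.+ (y ℤ./ℕ q) ℤ.* ℤ.+ q) ℤ.- (ℤ.+ (z ℤ.%ℕ q) ℤ.+ (z ℤ./ℕ q) ℤ.* ℤ.+ q)
        ≡⟨ cong (λ w → (ℤ.+ w ℤ.+ (y ℤ./ℕ q) ℤ.* ℤ.+ q) ℤ.- (ℤ.+ (z ℤ.%ℕ q) ℤ.+ (z ℤ./ℕ q) ℤ.* ℤ.+ q))
             (trans (sym (Fin.toℕ-fromℕ< (ℤ.n%ℕd<d y q))) (trans (cong toℕ e) (Fin.toℕ-fromℕ< (ℤ.n%ℕd<d z q)))) ⟩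
      (ℤ.+ (z ℤ.%ℕ q) ℤ.+ (y ℤ./ℕ q) ℤ.* ℤ.+ q) ℤ.- (ℤ.+ (z ℤ.%ℕ q) ℤ.+ (z ℤ./ℕ q) ℤ.* ℤ.+ q)
        ≡⟨ alg (ℤ.+ (z ℤ.%ℕ q)) (y ℤ./ℕ q) (z ℤ./ℕ q) (ℤ.+ q) ⟩
      (y ℤ./ℕ q ℤ.- z ℤ./ℕ q) ℤ.* ℤ.+ q ∎)
      where
      open ≡-Reasoning
      alg : ∀ r a b q → (r ℤ.+ a ℤ.* q) ℤ.- (r ℤ.+ b ℤ.* q) ≡ (a ℤ.- b) ℤ.* q
      alg = ℤ-solve-∀

    distance : ∀ {u v : Fin N} → u ≢ v → Coprime q ℤ.∣ pt u ℤ.- pt v ∣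
    distance {u} {v} ne rewrite ℤ.m-n≡m⊖n (toℕ u) (toℕ v) with <-cmp (toℕ u) (toℕ v)
    ... | tri< lt _ _ rewrite ℤ.∣⊖∣-< lt = coprime _ (m<n⇒0<n∸m lt) (≤-<-trans (m∸n≤m (toℕ v) (toℕ u)) (Fin.toℕ<n v))
    ... | tri≈ _ e _ = contradiction (Fin.toℕ-injective e) ne
    ... | tri> _ _ gt rewrite ℤ.∣m⊖n∣≡∣n⊖m∣ (toℕ u) (toℕ v) | ℤ.∣⊖∣-< gt = coprime _ (m<n⇒0<n∸m gt) (≤-<-trans (m∸n≤m (toℕ u) (toℕ v)) (Fin.toℕ<n u))

    separated : ∀ {u v : Fin N} → u ≢ v → ∀ z → ℤ.+ q ℤ.∣ (pt u ℤ.- pt v) ℤ.* z → ℤ.+ q ℤ.∣ z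
    separated {u} {v} ne z d = ℤ.∣ᵤ⇒∣ (coprime-divisor (distance ne)
      (subst (q ∣_) (ℤ.abs-* (pt u ℤ.- pt v) z) (ℤ.∣⇒∣ᵤ d)))

    coefs-vanish : ∀ {n} (cs : Vec ℤ n) (S : Subset N) → ∣ S ∣ ≡ n →
                   (∀ {v} → v ∈ S → ℤ.+ q ℤ.∣ eval cs (pt v)) → ∀ i → ℤ.+ q ℤ.∣ lookup cs i
    coefs-vanish cs S e h with f , f∈ , f-inj , _ ← enumerate S e =
      vanishing cs (pt ∘ f) (λ ne → separated (ne ∘ f-inj)) (λ i → h (f∈ i))

    coefs : Fin (q ^ t) → Vec ℤ t
    coefs p = tabulate (λ i → ℤ.+ toℕ (finToFun {q} {t} p i))

    congruent⇒≡ : ∀ {i j : Fin q} → ℤ.+ q ℤ.∣ ℤ.+ toℕ i ℤ.- ℤ.+ toℕ j → i ≡ j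
    congruent⇒≡ {i} {j} d = Fin.toℕ-injective (case <-cmp (toℕ i) (toℕ j) of λ where
        (tri≈ _ e _)  → e
        (tri< lt _ _) → contradiction (Nat.∣⇒≤ {{>-nonZero (m<n⇒0<n∸m lt)}} (subst (q ∣_) (ℤ.∣⊖∣-< lt) d′))
                          (<⇒≱ (≤-<-trans (m∸n≤m (toℕ j) (toℕ i)) (Fin.toℕ<n j)))
        (tri> _ _ gt) → contradiction (Nat.∣⇒≤ {{>-nonZero (m<n⇒0<n∸m gt)}} (subst (q ∣_) (trans (ℤ.∣m⊖n∣≡∣n⊖m∣ (toℕ i) (toℕ j)) (ℤ.∣⊖∣-< gt)) d′))
                          (<⇒≱ (≤-<-trans (m∸n≤m (toℕ i) (toℕ j)) (Fin.toℕ<n i))))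
      where
      d′ : q ∣ ℤ.∣ toℕ i ℤ.⊖ toℕ j ∣
      d′ = subst (q ∣_) (cong ℤ.∣_∣ (ℤ.m-n≡m⊖n (toℕ i) (toℕ j))) (ℤ.∣⇒∣ᵤ d)

    coefs-≡ : ∀ {p p′} → (∀ i → ℤ.+ q ℤ.∣ lookup (Vec.zipWith ℤ._-_ (coefs p) (coefs p′)) i) → p ≡ p′
    coefs-≡ {p} {p′} h = finToFun-injective {q} {t} λ i → congruent⇒≡ (subst (ℤ.+ q ℤ.∣_)
      (trans (Vec.lookup-zipWith ℤ._-_ i (coefs p) (coefs p′)) (cong₂ ℤ._-_ (Vec.lookup∘tabulate _ i) (Vec.lookup∘tabulate _ i))) (h i))

  code : Code N t q
  code = record { sec = sec ; crs = crs ; sec-unique = sec-unique ; crs-unique = crs-unique ; sec≢crs = sec≢crs ; proj = proj ; proj-spec = proj-spec }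
    where
    ev : Fin (q ^ t) → Fin N → ℤ
    ev p v = eval (coefs p) (pt v)

    sec crs : Fin (q ^ t) → Fin N → Fin q
    sec p v = residue (ev p v)
    crs p v = residue (ev p v ℤ.+ pt v ℤ.^ t)

    sec-unique : ∀ {p p′} S → ∣ S ∣ ≡ t → (∀ {v} → v ∈ S → sec p v ≡ sec p′ v) → p ≡ p′
    sec-unique {p} {p′} S e h = coefs-≡ (coefs-vanish (Vec.zipWith ℤ._-_ (coefs p) (coefs p′)) S e λ {v} v∈ →
      subst (ℤ.+ q ℤ.∣_) (sym (eval-- (coefs p) (coefs p′) (pt v))) (residue-≡ {ev p v} {ev p′ v} (h v∈)))

    crs-unique : ∀ {p p′} S → ∣ S ∣ ≡ t → (∀ {v} → v ∈ S → crs p v ≡ crs p′ v) → p ≡ p′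
    crs-unique {p} {p′} S e h = coefs-≡ (coefs-vanish (Vec.zipWith ℤ._-_ (coefs p) (coefs p′)) S e λ {v} v∈ →
      subst (ℤ.+ q ℤ.∣_) (trans (alg (ev p v) (ev p′ v) (pt v ℤ.^ t)) (sym (eval-- (coefs p) (coefs p′) (pt v))))
        (residue-≡ {ev p v ℤ.+ pt v ℤ.^ t} {ev p′ v ℤ.+ pt v ℤ.^ t} (h v∈)))
      where
      alg : ∀ a b c → (a ℤ.+ c) ℤ.- (b ℤ.+ c) ≡ a ℤ.- b
      alg = ℤ-solve-∀

    -- A crossing minus a section is monic of degree `t`; if it had `t + 1` roots, its leading
    -- coefficient 1 would be divisible by `q`.
    sec≢crs : ∀ {p p′} S → ∣ S ∣ ≡ suc t → ¬ (∀ {v} → v ∈ S → sec p v ≡ crs p′ v)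
    sec≢crs {p} {p′} S e h = <⇒≱ 1<q (Nat.∣⇒≤ (ℤ.∣⇒∣ᵤ (∣-last (Vec.zipWith ℤ._-_ (coefs p′) (coefs p)) ℤ.1ℤ
      (coefs-vanish (Vec.zipWith ℤ._-_ (coefs p′) (coefs p) Vec.∷ʳ ℤ.1ℤ) S e λ {v} v∈ → subst (ℤ.+ q ℤ.∣_)
        (trans (alg (ev p′ v) (ev p v) (pt v ℤ.^ t))
           (sym (trans (eval-∷ʳ (Vec.zipWith ℤ._-_ (coefs p′) (coefs p)) ℤ.1ℤ (pt v)) (cong (ℤ._+ pt v ℤ.^ t ℤ.* ℤ.1ℤ) (eval-- (coefs p′) (coefs p) (pt v))))))
        (residue-≡ {ev p′ v ℤ.+ pt v ℤ.^ t} {ev p v} (sym (h v∈)))))))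
      where
      alg : ∀ a b c → (a ℤ.+ c) ℤ.- b ≡ (a ℤ.- b) ℤ.+ c ℤ.* ℤ.1ℤ
      alg = ℤ-solve-∀

    -- Interpolation by counting: by `sec-unique` the `q ^ t` sections restrict to different
    -- functions on `S`, and there are only `q ^ t` functions from `S` to `Fin q`.
    interpolant : ∀ p S → ∣ S ∣ ≡ t → ∃ λ p′ → ∀ {v} → v ∈ S → sec p′ v ≡ crs p v
    interpolant p S e
      with f , f∈ , f-inj , f-surj ← enumerate S e
      with p′ , e′ ← injective⇒surjective (λ p′ → funToFin (sec p′ ∘ f))
             (λ {i} {j} eq → sec-unique S e λ v∈ → case f-surj v∈ of λ { (l , refl) →
                trans (sym (Fin.finToFun-funToFin (sec i ∘ f) l)) (trans (cong (λ z → finToFun {q} {t} z l) eq) (Fin.finToFun-funToFin (sec j ∘ f) l)) })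
             (funToFin (crs p ∘ f))
      = p′ , λ v∈ → case f-surj v∈ of λ { (l , refl) →
          trans (sym (Fin.finToFun-funToFin (sec p′ ∘ f) l)) (trans (cong (λ z → finToFun {q} {t} z l) e′) (Fin.finToFun-funToFin (crs p ∘ f) l)) }

    proj : Fin (q ^ t) → Subset N → Fin (q ^ t)
    proj p S with ∣ S ∣ ≟ t
    ... | yes e = proj₁ (interpolant p S e)
    -- An arbitrary value: `proj-spec` speaks of sets of size `t`.
    ... | no _  = p

    proj-spec : ∀ p {S} → ∣ S ∣ ≡ t → ∀ {v} → v ∈ S → sec (proj p S) v ≡ crs p v
    proj-spec p {S} e with ∣ S ∣ ≟ t
    ... | yes e′ = proj₂ (interpolant p S e′)
    ... | no ne  = contradiction e ne

∣n! : ∀ {d n} → 1 ≤ d → d ≤ n → d ∣ n !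
∣n! {suc d} _ le = Nat.∣-trans (Nat.m∣m*n (d !)) (Nat.m≤n⇒m!∣n! le)

-- A common divisor of the modulus and `d` divides `N !`, hence divides 1. The parameter `j` is left
-- free so that the number of points can later be brought close to any large n.
coprime-1+j*N! : ∀ N j d → 1 ≤ d → d < N → Coprime (1 + j * N !) d
coprime-1+j*N! N j d 1≤d d<N {e} (e∣q , e∣d) = Nat.∣1⇒≡1 (Nat.∣m+n∣m⇒∣n
  (subst (e ∣_) (+-comm 1 (j * N !)) e∣q)
  (Nat.∣n⇒∣m*n j (Nat.∣-trans e∣d (∣n! 1≤d (<⇒≤ d<N)))))

-- Uniformly random permutations

-- `insertₚ zero i` sends 0 to `i` and lets a smaller permutation handle the rest, so a sum over
-- permutations splits according to the image of 0.
perms : ∀ n → List (Permutation′ n)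
perms zero    = idₚ ∷ []
perms (suc n) = concatMap (λ i → map (insertₚ zero i) (perms n)) (allFin (suc n))

∑-perms-suc : ∀ n (f : Permutation′ (suc n) → ℕ) →
              ∑ (perms (suc n)) f ≡ ∑ (allFin (suc n)) (λ i → ∑ (perms n) (f ∘ insertₚ zero i))
∑-perms-suc n f = trans (∑-concatMap (λ i → map (insertₚ zero i) (perms n)) (allFin (suc n)) f) (∑-cong (allFin (suc n)) (λ i _ → ∑-map (insertₚ zero i) (perms n) f))

length-perms : ∀ n → length (perms n) ≡ n !
length-perms zero    = refl
length-perms (suc n) = begin
  length (perms (suc n))                                    ≡⟨ ∑-one (perms (suc n)) ⟨
  ∑ (perms (suc n)) (λ _ → 1)                               ≡⟨ ∑-perms-suc n _ ⟩
  ∑ (allFin (suc n)) (λ _ → ∑ (perms n) (λ _ → 1))          ≡⟨ ∑-cong (allFin (suc n)) (λ _ _ → trans (∑-one (perms n)) (length-perms n)) ⟩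
  ∑ (allFin (suc n)) (λ _ → n !)                            ≡⟨ ∑-allFin-const (suc n) (n !) ⟩
  suc n * n !                                               ∎
  where open ≡-Reasoning

preimage : Permutation′ n → Subset n → Subset n
preimage σ T = tabulate (λ j → lookup T (σ ⟨$⟩ʳ j))

∈-preimage⁺ : ∀ (σ : Permutation′ n) {T x} → σ ⟨$⟩ʳ x ∈ T → x ∈ preimage σ T
∈-preimage⁺ σ {T} {x} x∈ = lookup⇒∈ (trans (Vec.lookup∘tabulate _ x) (∈⇒lookup x∈))

∈-preimage⁻ : ∀ (σ : Permutation′ n) {T x} → x ∈ preimage σ T → σ ⟨$⟩ʳ x ∈ T
∈-preimage⁻ σ {T} {x} x∈ = lookup⇒∈ (trans (sym (Vec.lookup∘tabulate (λ j → lookup T (σ ⟨$⟩ʳ j)) x)) (∈⇒lookup x∈))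

lookup-removeAt : ∀ (T : Subset (suc n)) i j → lookup (Vec.removeAt T i) j ≡ lookup T (punchIn i j)
lookup-removeAt (a ∷ T)     zero    j       = refl
lookup-removeAt (a ∷ b ∷ T) (suc i) zero    = refl
lookup-removeAt (a ∷ b ∷ T) (suc i) (suc j) = lookup-removeAt (b ∷ T) i j

∣removeAt∣ : ∀ (T : Subset (suc n)) i → ∣ T ∣ ≡ 𝟙 (lookup T i) + ∣ Vec.removeAt T i ∣
∣removeAt∣ (true  ∷ T)     zero    = refl
∣removeAt∣ (false ∷ T)     zero    = refl
∣removeAt∣ (true  ∷ b ∷ T) (suc i) = trans (cong suc (∣removeAt∣ (b ∷ T) i)) (sym (+-suc (𝟙 (lookup (b ∷ T) i)) _))
∣removeAt∣ (false ∷ b ∷ T) (suc i) = ∣removeAt∣ (b ∷ T) i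

preimage-insert : ∀ i (π : Permutation′ n) (T : Subset (suc n)) →
                  preimage (insertₚ zero i π) T ≡ lookup T i ∷ preimage π (Vec.removeAt T i)
preimage-insert i π T = cong (lookup T i ∷_) (Vec.tabulate-cong λ j →
  trans (cong (lookup T) (insert-punchIn zero i π j)) (sym (lookup-removeAt T i (π ⟨$⟩ʳ j))))

𝟙-∷ : ∀ a b (P S : Subset n) → 𝟙 (does ((a ∷ P) ≟ˢ (b ∷ S))) ≡ 𝟙 (does (a Bool.≟ b)) * 𝟙 (does (P ≟ˢ S))
𝟙-∷ true  true  P S = sym (+-identityʳ _)
𝟙-∷ true  false P S = refl
𝟙-∷ false true  P S = refl
𝟙-∷ false false P S = sym (+-identityʳ _)

∑-lookup : ∀ (S : Subset n) → ∑ (allFin n) (λ i → 𝟙 (does (lookup S i Bool.≟ true))) ≡ ∣ S ∣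
∑-lookup {n} S = trans (∑-cong (allFin n) (λ i _ → cong 𝟙 (trans (does-≟-true (lookup S i)) (sym (does-∈? i S))))) (sym (∣∣-∑ S))
  where
  does-≟-true : ∀ b → does (b Bool.≟ true) ≡ b
  does-≟-true true  = refl
  does-≟-true false = refl

∑-lookup-∁ : ∀ (S : Subset n) → ∑ (allFin n) (λ i → 𝟙 (does (lookup S i Bool.≟ false))) ≡ n ∸ ∣ S ∣
∑-lookup-∁ {n} S = trans (∑-cong (allFin n) (λ i _ → cong 𝟙 (trans (flip-≟ (lookup S i)) (cong (λ b → does (b Bool.≟ true)) (sym (Vec.lookup-map i _ S))))))
                         (trans (∑-lookup (∁ S)) (∣∁p∣≡n∸∣p∣ S))
  where
  flip-≟ : ∀ b → does (b Bool.≟ false) ≡ does (Data.Bool.Base.not b Bool.≟ true)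
  flip-≟ true  = refl
  flip-≟ false = refl

-- Whether 0 belongs to `S` decides whether its image must be taken inside `T` (t choices) or
-- outside (n + 1 - t choices); that image is then removed from `T` and the recursion continues with
-- one point less.
perms-transitive : ∀ n t (S T : Subset n) → ∣ S ∣ ≡ t → ∣ T ∣ ≡ t →
                   ∑ (perms n) (λ σ → 𝟙 (does (preimage σ T ≟ˢ S))) ≡ t ! * (n ∸ t) !
perms-transitive zero    zero [] [] refl refl = refl
perms-transitive (suc n) t (b ∷ S) T eS eT = trans split (rest b t eS eT)
  where
  open ≡-Reasoning
  inner : Fin (suc n) → ℕ
  inner i = ∑ (perms n) (λ π → 𝟙 (does (preimage π (Vec.removeAt T i) ≟ˢ S)))
  split : ∑ (perms (suc n)) (λ σ → 𝟙 (does (preimage σ T ≟ˢ (b ∷ S)))) ≡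
          ∑ (allFin (suc n)) (λ i → 𝟙 (does (lookup T i Bool.≟ b)) * inner i)
  split = trans (∑-perms-suc n _) (∑-cong (allFin (suc n)) λ i _ → begin
    ∑ (perms n) (λ π → 𝟙 (does (preimage (insertₚ zero i π) T ≟ˢ (b ∷ S))))
      ≡⟨ ∑-cong (perms n) (λ π _ → trans (cong (λ z → 𝟙 (does (z ≟ˢ (b ∷ S)))) (preimage-insert i π T)) (𝟙-∷ (lookup T i) b (preimage π (Vec.removeAt T i)) S)) ⟩
    ∑ (perms n) (λ π → 𝟙 (does (lookup T i Bool.≟ b)) * 𝟙 (does (preimage π (Vec.removeAt T i) ≟ˢ S)))
      ≡⟨ ∑-*ˡ (perms n) (𝟙 (does (lookup T i Bool.≟ b))) _ ⟩
    𝟙 (does (lookup T i Bool.≟ b)) * inner i ∎)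
  weighted : ∀ b K → (∀ i → lookup T i ≡ b → inner i ≡ K) →
             ∑ (allFin (suc n)) (λ i → 𝟙 (does (lookup T i Bool.≟ b)) * inner i) ≡ ∑ (allFin (suc n)) (λ i → 𝟙 (does (lookup T i Bool.≟ b))) * K
  weighted b K h = trans (∑-cong (allFin (suc n)) (λ i _ → case-≟ i)) (∑-*ʳ (allFin (suc n)) K (λ i → 𝟙 (does (lookup T i Bool.≟ b))))
    where
    case-≟ : ∀ i → 𝟙 (does (lookup T i Bool.≟ b)) * inner i ≡ 𝟙 (does (lookup T i Bool.≟ b)) * K
    case-≟ i with lookup T i Bool.≟ b
    ... | yes e = cong (1 *_) (h i e)
    ... | no _  = refl
  removed : ∀ i b → lookup T i ≡ b → ∣ T ∣ ≡ 𝟙 b + ∣ Vec.removeAt T i ∣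
  removed i b refl = ∣removeAt∣ T i
  rest : ∀ b t → ∣ b ∷ S ∣ ≡ t → ∣ T ∣ ≡ t →
         ∑ (allFin (suc n)) (λ i → 𝟙 (does (lookup T i Bool.≟ b)) * inner i) ≡ t ! * (suc n ∸ t) !
  rest true (suc t) eS eT = begin
    _                                        ≡⟨ weighted true K (λ i e → perms-transitive n t S (Vec.removeAt T i) (suc-injective eS) (suc-injective (trans (sym (removed i true e)) eT))) ⟩
    _                                        ≡⟨ cong (_* K) (trans (∑-lookup T) eT) ⟩
    suc t * (t ! * (n ∸ t) !)                ≡⟨ *-assoc (suc t) (t !) _ ⟨
    suc t ! * (n ∸ t) !                      ∎
    where K = t ! * (n ∸ t) !
  rest false t eS eT = begin
    _                                        ≡⟨ weighted false K (λ i e → perms-transitive n t S (Vec.removeAt T i) eS (trans (sym (removed i false e)) eT)) ⟩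
    _                                        ≡⟨ cong (_* K) (trans (∑-lookup-∁ T) (trans (cong (suc n ∸_) eT) suc-∸)) ⟩
    suc (n ∸ t) * (t ! * (n ∸ t) !)          ≡⟨ x*yz (suc (n ∸ t)) (t !) ((n ∸ t) !) ⟩
    t ! * suc (n ∸ t) !                      ≡⟨ cong (λ z → t ! * z !) suc-∸ ⟨
    t ! * (suc n ∸ t) !                      ∎
    where
    K = t ! * (n ∸ t) !
    suc-∸ : suc n ∸ t ≡ suc (n ∸ t)
    suc-∸ = +-∸-assoc 1 (subst (_≤ n) eS (∣p∣≤n S))
    x*yz : ∀ x y z → x * (y * z) ≡ y * (x * z)
    x*yz = ℕ-solve-∀

nCk*k!*[n∸k]!≡n! : ∀ {n k} → k ≤ n → (n C k) * (k ! * (n ∸ k) !) ≡ n !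
nCk*k!*[n∸k]!≡n! {n} {k} k≤n = trans (cong (_* (k ! * (n ∸ k) !)) (nCk≡n!/k![n-k]! k≤n)) (m/n*n≡m {{k !* (n ∸ k) !≢0}} (k![n∸k]!∣n! k≤n))

infix 4 _∈ˢ?_
_∈ˢ?_ : ∀ (S : Subset n) (xs : List (Subset n)) → Dec (S L.∈ xs)
S ∈ˢ? xs = Any.any? (S ≟ˢ_) xs

-- By `perms-transitive` the preimage of `T` under a uniform permutation is a uniform t-set, so it
-- falls into `L` with probability `length L` over `n C t`, which is at least 1/D.
perms-hit : ∀ {n t} D {L : List (Subset n)} → Unique L → (∀ {S} → S L.∈ L → ∣ S ∣ ≡ t) → n C t ≤ D * length L →
            ∀ T → ∣ T ∣ ≡ t → length (perms n) ≤ D * ∑ (perms n) (λ σ → 𝟙 (does (preimage σ T ∈ˢ? L)))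
perms-hit {n} {t} D {L} uniq size le T eT = begin
  length (perms n)                           ≡⟨ length-perms n ⟩
  n !                                        ≡⟨ nCk*k!*[n∸k]!≡n! (subst (_≤ n) eT (∣p∣≤n T)) ⟨
  (n C t) * K                                ≤⟨ *-monoˡ-≤ K le ⟩
  D * length L * K                           ≡⟨ *-assoc D (length L) K ⟩
  D * (length L * K)                         ≡⟨ cong (D *_) (∑-const L K) ⟨
  D * ∑ L (λ _ → K)                          ≡⟨ cong (D *_) (∑-cong L (λ S S∈ → perms-transitive n t S T (size S∈) eT)) ⟨
  D * ∑ L (λ S → ∑ (perms n) (λ σ → 𝟙 (does (preimage σ T ≟ˢ S))))
                                             ≡⟨ cong (D *_) (∑-swap L (perms n) _) ⟩
  D * ∑ (perms n) (λ σ → ∑ L (λ S → 𝟙 (does (preimage σ T ≟ˢ S))))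
                                             ≤⟨ *-monoʳ-≤ D (∑-mono (perms n) (λ σ _ → hit (preimage σ T))) ⟩
  D * ∑ (perms n) (λ σ → 𝟙 (does (preimage σ T ∈ˢ? L))) ∎
  where
  open ≤-Reasoning
  K = t ! * (n ∸ t) !
  hit : ∀ P → ∑ L (λ S → 𝟙 (does (P ≟ˢ S))) ≤ 𝟙 (does (P ∈ˢ? L))
  hit P = 𝟙-case (P ∈ˢ? L) (∑ L (λ S → 𝟙 (does (P ≟ˢ S))) ≤_)
    (λ _ → ∑-𝟙-unique (P ≟ˢ_) uniq (λ _ _ e e′ → trans (sym e) e′))
    (λ ∉ → ≤-reflexive (trans (∑-cong L (λ S S∈ → 𝟙-no (P ≟ˢ S) (λ { refl → ∉ S∈ }))) (∑-zero L)))

-- Averaging over independent choices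

∏ : ∀ {A : Set} → List A → (A → ℕ) → ℕ
∏ []       f = 1
∏ (x ∷ xs) f = f x * ∏ xs f

∏-cong : ∀ {A : Set} (xs : List A) {f g : A → ℕ} → (∀ x → x L.∈ xs → f x ≡ g x) → ∏ xs f ≡ ∏ xs g
∏-cong []       h = refl
∏-cong (x ∷ xs) h = cong₂ _*_ (h x (here refl)) (∏-cong xs (λ y → h y ∘ there))

∏-𝟙≤ : ∀ {A : Set} {P : A → Set} (P? : Decidable P) xs → ∏ xs (λ x → 𝟙 (does (P? x))) ≤ 𝟙 (does (All.all? P? xs))
∏-𝟙≤ P? []       = ≤-refl
∏-𝟙≤ P? (x ∷ xs) with does (P? x)
... | true  = ≤-trans (≤-reflexive (+-identityʳ _)) (∏-𝟙≤ P? xs)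
... | false = z≤n

∑-pigeonhole : ∀ {A : Set} (xs : List A) (x₀ : A) (f : A → ℕ) → ∃ λ x → ∑ xs f ≤ length xs * f x
∑-pigeonhole []       x₀ f = x₀ , z≤n
∑-pigeonhole (x ∷ xs) x₀ f with y , le ← ∑-pigeonhole xs x₀ f with ≤-total (f x) (f y)
... | inj₁ fx≤fy = y , +-mono-≤ fx≤fy le
... | inj₂ fy≤fx = x , +-monoʳ-≤ (f x) (≤-trans le (*-monoʳ-≤ (length xs) fy≤fx))

module _ {Ω : Set} (Os : List Ω) where

  -- The expectation over `n` independent uniform elements of `Os`, without its normalising factor
  -- `length Os ^ n`.
  E : ∀ n → (Vec Ω n → ℕ) → ℕ
  E zero    f = f []
  E (suc n) f = ∑ Os (λ ω → E n (λ Φ → f (ω ∷ Φ)))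

  E-cong : ∀ n {f g} → (∀ Φ → f Φ ≡ g Φ) → E n f ≡ E n g
  E-cong zero    h = h []
  E-cong (suc n) h = ∑-cong Os (λ ω _ → E-cong n (λ Φ → h (ω ∷ Φ)))

  E-mono : ∀ n {f g} → (∀ Φ → f Φ ≤ g Φ) → E n f ≤ E n g
  E-mono zero    h = h []
  E-mono (suc n) h = ∑-mono Os (λ ω _ → E-mono n (λ Φ → h (ω ∷ Φ)))

  E-∑ : ∀ n {X : Set} (xs : List X) (f : X → Vec Ω n → ℕ) → E n (λ Φ → ∑ xs (λ x → f x Φ)) ≡ ∑ xs (λ x → E n (f x))
  E-∑ zero    xs f = refl
  E-∑ (suc n) xs f = trans (∑-cong Os (λ ω _ → E-∑ n xs (λ x Φ → f x (ω ∷ Φ)))) (∑-swap Os xs _)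

  E-*ˡ : ∀ n c f → E n (λ Φ → c * f Φ) ≡ c * E n f
  E-*ˡ zero    c f = refl
  E-*ˡ (suc n) c f = trans (∑-cong Os (λ ω _ → E-*ˡ n c _)) (∑-*ˡ Os c _)

  E-one : ∀ n → E n (λ _ → 1) ≡ length Os ^ n
  E-one zero    = refl
  E-one (suc n) = trans (∑-const Os _) (cong (length Os *_) (E-one n))

  abstract
    E-pigeonhole : ∀ n (ω₀ : Ω) f → ∃ λ Φ → E n f ≤ length Os ^ n * f Φ
    E-pigeonhole zero    ω₀ f = [] , ≤-reflexive (sym (+-identityʳ _))
    E-pigeonhole (suc n) ω₀ f
      with ω , le ← ∑-pigeonhole Os ω₀ (λ ω → E n (λ Φ → f (ω ∷ Φ)))
      with Φ , le′ ← E-pigeonhole n ω₀ (λ Φ → f (ω ∷ Φ))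
      = ω ∷ Φ , ≤-trans le (≤-trans (*-monoʳ-≤ (length Os) le′) (≤-reflexive (sym (*-assoc (length Os) _ _))))

  -- As `F` does not depend on coordinate `i`, the expectation of the product factors. The extra
  -- `length Os` on the left is there because both factors on the right sum over that coordinate.
  E-indep : ∀ n (i : Fin n) (g : Ω → ℕ) (F : Vec Ω n → ℕ) → (∀ Φ ω → F (Φ [ i ]≔ ω) ≡ F Φ) →
            length Os * E n (λ Φ → g (lookup Φ i) * F Φ) ≡ ∑ Os g * E n F
  E-indep (suc n) zero g F inv = begin
    length Os * ∑ Os (λ ω → E n (λ Φ → g ω * F (ω ∷ Φ)))     ≡⟨ cong (length Os *_) (∑-cong Os (λ ω _ → E-*ˡ n (g ω) _)) ⟩
    length Os * ∑ Os (λ ω → g ω * e ω)                       ≡⟨ ∑-const Os _ ⟨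
    ∑ Os (λ ω′ → ∑ Os (λ ω → g ω * e ω))                     ≡⟨ ∑-cong Os (λ ω′ _ → ∑-cong Os (λ ω _ → cong (g ω *_) (E-cong n (λ Φ → inv (ω′ ∷ Φ) ω)))) ⟩
    ∑ Os (λ ω′ → ∑ Os (λ ω → g ω * e ω′))                    ≡⟨ ∑-cong Os (λ ω′ _ → ∑-*ʳ Os (e ω′) g) ⟩
    ∑ Os (λ ω′ → ∑ Os g * e ω′)                              ≡⟨ ∑-*ˡ Os (∑ Os g) e ⟩
    ∑ Os g * ∑ Os e                                          ∎
    where
    open ≡-Reasoning
    e : Ω → ℕ
    e ω = E n (λ Φ → F (ω ∷ Φ))
  E-indep (suc n) (suc i) g F inv = begin
    length Os * ∑ Os (λ ω → E n (λ Φ → g (lookup Φ i) * F (ω ∷ Φ)))       ≡⟨ ∑-*ˡ Os (length Os) _ ⟨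
    ∑ Os (λ ω → length Os * E n (λ Φ → g (lookup Φ i) * F (ω ∷ Φ)))       ≡⟨ ∑-cong Os (λ ω _ → E-indep n i g _ (λ Φ → inv (ω ∷ Φ))) ⟩
    ∑ Os (λ ω → ∑ Os g * E n (λ Φ → F (ω ∷ Φ)))                           ≡⟨ ∑-*ˡ Os (∑ Os g) _ ⟩
    ∑ Os g * ∑ Os (λ ω → E n (λ Φ → F (ω ∷ Φ)))                           ∎
    where open ≡-Reasoning

  module _ .{{_ : NonZero (length Os)}} (D n : ℕ) where

    E-∏ : ∀ {C : Set} (cs : List C) → Unique cs → (idx : C → Fin n) → (∀ {c d} → c L.∈ cs → d L.∈ cs → idx c ≡ idx d → c ≡ d) →
          (g : C → Ω → ℕ) → (∀ c → c L.∈ cs → length Os ≤ D * ∑ Os (g c)) →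
          length Os ^ n ≤ D ^ length cs * E n (λ Φ → ∏ cs (λ c → g c (lookup Φ (idx c))))
    E-∏ []       _       idx inj g h = ≤-reflexive (sym (trans (+-identityʳ _) (E-one n)))
    E-∏ (c ∷ cs) (p ∷ u) idx inj g h = *-cancelˡ-≤ (length Os) (begin
      w * w ^ n                                     ≤⟨ *-mono-≤ (h c (here refl)) (E-∏ cs u idx (λ a b → inj (there a) (there b)) g (λ d → h d ∘ there)) ⟩
      (D * ∑ Os (g c)) * (D ^ length cs * E n F)    ≡⟨ rearrange₁ D (∑ Os (g c)) (D ^ length cs) (E n F) ⟩
      (D * D ^ length cs) * (∑ Os (g c) * E n F)    ≡⟨ cong ((D * D ^ length cs) *_) (E-indep n (idx c) (g c) F invariant) ⟨
      (D * D ^ length cs) * (w * E n (λ Φ → g c (lookup Φ (idx c)) * F Φ)) ≡⟨ rearrange₂ (D * D ^ length cs) w _ ⟩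
      w * (D * D ^ length cs * E n (λ Φ → g c (lookup Φ (idx c)) * F Φ)) ∎)
      where
      open ≤-Reasoning
      w = length Os
      F : Vec Ω n → ℕ
      F Φ = ∏ cs (λ d → g d (lookup Φ (idx d)))
      invariant : ∀ Φ ω → F (Φ [ idx c ]≔ ω) ≡ F Φ
      invariant Φ ω = ∏-cong cs λ d d∈ → cong (g d) (Vec.lookup∘update′
        (λ e → All.lookup p d∈ (sym (inj (there d∈) (here refl) e))) Φ ω)
      rearrange₁ : ∀ a b c d → (a * b) * (c * d) ≡ (a * c) * (b * d)
      rearrange₁ = ℕ-solve-∀
      rearrange₂ : ∀ a b c → a * (b * c) ≡ b * (a * c)
      rearrange₂ = ℕ-solve-∀

    -- For one `x` the events read distinct coordinates, so they all hold with probability at least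
    -- D^(-length cs). Different `x` may share coordinates: the expected number of good `x` follows
    -- by linearity, and some `Φ` attains it.
    averaging : (ω₀ : Ω) → ∀ {X C : Set} (xs : List X) (cs : List C) → Unique cs → (idx : X → C → Fin n) →
                (∀ x {c d} → c L.∈ cs → d L.∈ cs → idx x c ≡ idx x d → c ≡ d) →
                {P : X → C → Ω → Set} (P? : ∀ x c ω → Dec (P x c ω)) →
                (∀ x c → c L.∈ cs → length Os ≤ D * ∑ Os (λ ω → 𝟙 (does (P? x c ω)))) →
                ∃ λ (Φ : Vec Ω n) →
                length xs ≤ D ^ length cs * length (filter (λ x → All.all? (λ c → P? x c (lookup Φ (idx x c))) cs) xs)
    averaging ω₀ xs cs u idx inj P? h
      with Φ , le ← E-pigeonhole n ω₀ (λ Φ → ∑ xs (λ x → 𝟙 (does (All.all? (λ c → P? x c (lookup Φ (idx x c))) cs))))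
      = Φ , *-cancelˡ-≤ (w ^ n) {{m^n≢0 w n}} (begin
      w ^ n * length xs                                 ≡⟨ *-comm (w ^ n) _ ⟩
      length xs * w ^ n                                 ≡⟨ ∑-const xs (w ^ n) ⟨
      ∑ xs (λ _ → w ^ n)                                ≤⟨ ∑-mono xs (λ x _ → ≤-trans (E-∏ cs u (idx x) (inj x) (λ c ω → 𝟙 (does (P? x c ω))) (h x))
                                                             (*-monoʳ-≤ (D ^ length cs) (E-mono n (λ Φ → ∏-𝟙≤ (λ c → P? x c (lookup Φ (idx x c))) cs)))) ⟩
      ∑ xs (λ x → D ^ length cs * E n (good x))                 ≡⟨ ∑-*ˡ xs (D ^ length cs) _ ⟩
      D ^ length cs * ∑ xs (λ x → E n (good x))                 ≡⟨ cong (D ^ length cs *_) (E-∑ n xs good) ⟨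
      D ^ length cs * E n (λ Φ → ∑ xs (λ x → good x Φ))         ≤⟨ *-monoʳ-≤ (D ^ length cs) le ⟩
      D ^ length cs * (w ^ n * ∑ xs (λ x → good x Φ))           ≡⟨ rearrange (D ^ length cs) (w ^ n) _ ⟩
      w ^ n * (D ^ length cs * ∑ xs (λ x → good x Φ))           ≡⟨ cong (λ z → w ^ n * (D ^ length cs * z)) (length-filter (λ x → All.all? (λ c → P? x c (lookup Φ (idx x c))) cs) xs) ⟨
      w ^ n * (D ^ length cs * length (filter (λ x → All.all? (λ c → P? x c (lookup Φ (idx x c))) cs) xs)) ∎)
      where
      open ≤-Reasoning
      w = length Os
      good = λ x Φ → 𝟙 (does (All.all? (λ c → P? x c (lookup Φ (idx x c))) cs))
      rearrange : ∀ a b c → a * (b * c) ≡ b * (a * c)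
      rearrange = ℕ-solve-∀

-- Images under permutations and under graphs of functions

image-cong-∈ : ∀ {f g : Fin m → Fin n} {S} → (∀ {x} → x ∈ S → f x ≡ g x) → image f S ≡ image g S
image-cong-∈ {f = f} {g} {S} h = ⊆-antisym
  (image-⊆ f (λ {x} x∈ → subst (_∈ image g S) (sym (h x∈)) (∈-image⁺ g x∈)))
  (image-⊆ g (λ {x} x∈ → subst (_∈ image f S) (h x∈) (∈-image⁺ f x∈)))

⟨$⟩ʳ-injective : ∀ (σ : Permutation′ n) {x y} → σ ⟨$⟩ʳ x ≡ σ ⟨$⟩ʳ y → x ≡ y
⟨$⟩ʳ-injective σ e = trans (sym (inverseˡ σ)) (trans (cong (σ ⟨$⟩ˡ_) e) (inverseˡ σ))

image-preimage : ∀ (σ : Permutation′ n) S → image (σ ⟨$⟩ʳ_) (preimage σ S) ≡ S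
image-preimage σ S = ⊆-antisym (image-⊆ (σ ⟨$⟩ʳ_) (∈-preimage⁻ σ))
  (λ {x} x∈ → subst (_∈ image (σ ⟨$⟩ʳ_) (preimage σ S)) (inverseʳ σ)
     (∈-image⁺ (σ ⟨$⟩ʳ_) (∈-preimage⁺ σ (subst (_∈ S) (sym (inverseʳ σ)) x∈))))

graph : ∀ {N q} → (Fin N → Fin q) → Fin N → Fin (N * q)
graph h v = combine v (h v)

graph-≡ : ∀ {N q} {h h′ : Fin N → Fin q} {v v′} → graph h v ≡ graph h′ v′ → v ≡ v′ × h v ≡ h′ v
graph-≡ {h = h} {h′} {v} {v′} e with refl , e′ ← Fin.combine-injective v (h v) v′ (h′ v′) e = refl , e′

image-graph-≡ : ∀ {N q} {h h′ : Fin N → Fin q} {S S′} → image (graph h) S ≡ image (graph h′) S′ →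
                S ≡ S′ × (∀ {v} → v ∈ S → h v ≡ h′ v)
image-graph-≡ {h = h} {h′} {S} {S′} e =
  ⊆-antisym (λ v∈ → proj₁ (half e v∈)) (λ v∈ → proj₁ (half (sym e) v∈)) , (λ v∈ → proj₂ (half e v∈))
  where
  half : ∀ {h h′ S S′} → image (graph h) S ≡ image (graph h′) S′ → ∀ {v} → v ∈ S → v ∈ S′ × h v ≡ h′ v
  half {h} {h′} e {v} v∈
    with v′ , v′∈ , e′ ← ∈-image⁻ (graph h′) (subst (graph h v ∈_) e (∈-image⁺ (graph h) v∈))
    with refl , e″ ← graph-≡ {h = h′} {h} {v′} {v} e′ = v′∈ , sym e″

-- Near-perfect packings

module Packing (k t : ℕ) (𝓜 : List (Subset k)) where

  Own : Subset k → Set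
  Own T = ∣ T ∣ ≡ t × T L.∉ 𝓜

  ownShapes : List (Subset k)
  ownShapes = filter (λ T → ¬? (T ∈ˢ? 𝓜)) (subsets k t)

  -- The reserved sets must contain the images of 𝓜 and avoid the own sets.  Keeping them a small
  -- fixed proportion of all t-sets lets the images of 𝓜 overlap without wasting space.
  record State (N len rl : ℕ) : Set where
    field
      blk        : Fin len → Fin k → Fin N
      blk-inj    : ∀ i {x y} → blk i x ≡ blk i y → x ≡ y
      res        : Fin rl → Subset N
      res-inj    : ∀ {i j} → res i ≡ res j → i ≡ j
      res-size   : ∀ j → ∣ res j ∣ ≡ t
      reserved   : ∀ i {T} → ∣ T ∣ ≡ t → T L.∈ 𝓜 → ∃ λ j → res j ≡ image (blk i) T
      unreserved : ∀ i {T} → Own T → ∀ j → res j ≢ image (blk i) T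
      disjoint   : ∀ {i i′ T T′} → Own T → Own T′ → image (blk i) T ≡ image (blk i′) T′ → i ≡ i′
      meet       : ∀ {i i′} → i ≢ i′ → ∀ U → ∣ U ∣ ≡ suc t → ¬ (∀ {x} → x ∈ U → ∃ λ y → blk i x ≡ blk i′ y)

    image-size : ∀ i {T} → ∣ T ∣ ≡ t → ∣ image (blk i) T ∣ ≡ t
    image-size i e = trans (∣image∣ (blk i) (blk-inj i)) e

    resList : List (Subset N)
    resList = List.tabulate res

    ownList : List (Subset N)
    ownList = List.cartesianProductWith (λ i T → image (blk i) T) (allFin len) ownShapes

    free? : ∀ P → Dec (P L.∉ resList × P L.∉ ownList)
    free? P = ¬? (P ∈ˢ? resList) ×-dec ¬? (P ∈ˢ? ownList)

    freeList : List (Subset N)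
    freeList = filter free? (subsets N t)

    ∈-resList⁺ : ∀ j → res j L.∈ resList
    ∈-resList⁺ = L.∈-tabulate⁺

    ∈-resList⁻ : ∀ {P} → P L.∈ resList → ∃ λ j → res j ≡ P
    ∈-resList⁻ P∈ with j , e ← L.∈-tabulate⁻ P∈ = j , sym e

    ∈-ownList⁺ : ∀ i {T} → Own T → image (blk i) T L.∈ ownList
    ∈-ownList⁺ i {T} (e , T∉) = L.∈-cartesianProductWith⁺ (λ i T → image (blk i) T) (L.∈-allFin i)
      (L.∈-filter⁺ (λ T → ¬? (T ∈ˢ? 𝓜)) (∈-subsets⁺ T e) T∉)

    subsets-count : N C t ≤ length freeList + (rl + len * length ownShapes)
    subsets-count = begin
      N C t                                                          ≡⟨ length-subsets N t ⟨
      length (subsets N t)                                           ≤⟨ length-⊆ (subsets-unique N t) cover ⟩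
      length (freeList ++ (resList ++ ownList))                      ≡⟨ List.length-++ freeList ⟩
      length freeList + length (resList ++ ownList)                  ≡⟨ cong (length freeList +_) (List.length-++ resList) ⟩
      length freeList + (length resList + length ownList)
        ≡⟨ cong (length freeList +_) (cong₂ _+_ (List.length-tabulate res)
             (trans (length-cartesianProductWith (λ i T → image (blk i) T) (allFin len) ownShapes) (cong (_* length ownShapes) (length-allFin len)))) ⟩
      length freeList + (rl + len * length ownShapes) ∎
      where
      open ≤-Reasoning
      cover : ∀ {P} → P L.∈ subsets N t → P L.∈ freeList ++ (resList ++ ownList)
      cover {P} P∈ with P ∈ˢ? resList | P ∈ˢ? ownList
      ... | yes p | _     = L.∈-++⁺ʳ freeList (L.∈-++⁺ˡ p)
      ... | no _  | yes p = L.∈-++⁺ʳ freeList (L.∈-++⁺ʳ resList p)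
      ... | no ¬p | no ¬q = L.∈-++⁺ˡ (L.∈-filter⁺ free? P∈ (¬p , ¬q))

    -- The t-sets of the old packing that a new block may use for the shape `T`. Shapes in 𝓜 must
    -- fall on reserved sets and all others on free ones, which is what keeps the invariants of
    -- `State`.
    allowed : Subset k → List (Subset N)
    allowed T with T ∈ˢ? 𝓜
    ... | yes _ = resList
    ... | no _  = freeList

    ∈-allowed-res : ∀ {P T} → P L.∈ allowed T → T L.∈ 𝓜 → ∃ λ j → res j ≡ P
    ∈-allowed-res {T = T} P∈ T∈ with T ∈ˢ? 𝓜
    ... | yes _ = ∈-resList⁻ P∈
    ... | no T∉ = contradiction T∈ T∉

    ∈-allowed-free : ∀ {P T} → P L.∈ allowed T → T L.∉ 𝓜 → P L.∉ resList × P L.∉ ownList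
    ∈-allowed-free {T = T} P∈ T∉ with T ∈ˢ? 𝓜
    ... | yes T∈ = contradiction T∈ T∉
    ... | no _   = proj₂ (L.∈-filter⁻ free? {xs = subsets N t} P∈)

    allowed-unique : ∀ T → Unique (allowed T)
    allowed-unique T with T ∈ˢ? 𝓜
    ... | yes _ = Unique.tabulate⁺ res-inj
    ... | no _  = Unique.filter⁺ free? (subsets-unique N t)

    allowed-size : ∀ T {P} → P L.∈ allowed T → ∣ P ∣ ≡ t
    allowed-size T P∈ with T ∈ˢ? 𝓜
    ... | yes _ = let j , e = ∈-resList⁻ P∈ in trans (cong ∣_∣ (sym e)) (res-size j)
    ... | no _  = ∈-subsets⁻ N t (proj₁ (L.∈-filter⁻ free? {xs = subsets N t} P∈))

    allowed-many : ∀ D T → (T L.∈ 𝓜 → N C t ≤ D * rl) → N C t ≤ D * length freeList → N C t ≤ D * length (allowed T)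
    allowed-many D T h h′ with T ∈ˢ? 𝓜
    ... | yes T∈ = ≤-trans (h T∈) (≤-reflexive (cong (D *_) (sym (List.length-tabulate res))))
    ... | no _   = h′

  -- Amplifying a packing along a code

  module Blowup {N len rl q} (St : State N len rl) (Co : Code N t q) where
    open State St
    open Code Co

    -- (i , p) indexes both the copy of block i in section p and the crossing p above block i.
    Word : Set
    Word = Fin len × Fin (q ^ t)

    shadow : Word → Subset k → Subset N
    shadow (i , p) T = image (blk i) T

    home : Word → Subset k → Fin (q ^ t)
    home (i , p) T = proj p (image (blk i) T)

    -- Two shapes with the same home would give one section agreeing with the crossing on the union
    -- of two different t-sets, hence on `t + 1` points. Injectivity makes the permutations
    -- consulted for one crossing distinct, hence independent.
    home-injective : ∀ w {T T′} → ∣ T ∣ ≡ t → ∣ T′ ∣ ≡ t → home w T ≡ home w T′ → T ≡ T′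
    home-injective w@(i , p) {T} {T′} e e′ eq with T ≟ˢ T′
    ... | yes T≡ = T≡
    ... | no T≢  = contradiction (λ {v} v∈ → agree (x∈p∪q⁻ S S′ (proj₁ (proj₂ W) v∈))) (sec≢crs {home w T} {p} (proj₁ W) (proj₂ (proj₂ W)))
      where
      S  = shadow w T
      S′ = shadow w T′
      W : ∃ λ W → W ⊆ S ∪ S′ × ∣ W ∣ ≡ suc t
      W = shrink (S ∪ S′) (suc t) (≰⇒> λ le → T≢ (image-injective (blk i) (blk-inj i)
            (trans (⊆-∣∣-≡ (p⊆p∪q S′) (≤-trans le (≤-reflexive (sym (image-size i e)))))
              (sym (⊆-∣∣-≡ (q⊆p∪q S S′) (≤-trans le (≤-reflexive (sym (image-size i e′)))))))))
      agree : ∀ {v} → v ∈ S ⊎ v ∈ S′ → sec (home w T) v ≡ crs p v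
      agree (inj₁ v∈) = proj-spec p (image-size i e) v∈
      agree {v} (inj₂ v∈) = trans (cong (λ z → sec z v) eq) (proj-spec p (image-size i e′) v∈)

    module _ (Φ : Fin (q ^ t) → Permutation′ N) where

      -- The old packing sits in section p permuted by `Φ p`. Pulling the shadow back through that
      -- permutation lets it be compared with the packing in its original position.
      Good : Word → Set
      Good w = All (λ T → preimage (Φ (home w T)) (shadow w T) L.∈ allowed T) (subsets k t)

      section : Fin (q ^ t) → Fin N → Fin (N * q)
      section p v = graph (sec p) (Φ p ⟨$⟩ʳ v)

      section-injective : ∀ p {u v} → section p u ≡ section p v → u ≡ v
      section-injective p e = ⟨$⟩ʳ-injective (Φ p) (proj₁ (graph-≡ {h = sec p} {sec p} e))

      -- Sections that agree on `t` points are equal, so a transversal t-set determines the section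
      -- that it lies in and, sections being injective, its source there.
      image-section-≡ : ∀ {p p′ P P′} → ∣ P ∣ ≡ t → image (section p) P ≡ image (section p′) P′ → p ≡ p′ × P ≡ P′
      image-section-≡ {p} {p′} {P} {P′} eP e
        with S≡ , agree ← image-graph-≡ (trans (sym (image-∘ (graph (sec p)) (Φ p ⟨$⟩ʳ_) P)) (trans e (image-∘ (graph (sec p′)) (Φ p′ ⟨$⟩ʳ_) P′)))
        with refl ← sec-unique _ (trans (∣image∣ (Φ p ⟨$⟩ʳ_) (⟨$⟩ʳ-injective (Φ p))) eP) agree
        = refl , image-injective (section p) (section-injective p) e

      base : Word ⊎ Word → Fin k → Fin N
      base (inj₁ (i , p)) x = Φ p ⟨$⟩ʳ blk i x
      base (inj₂ (i , p)) x = blk i x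

      value : Word ⊎ Word → Fin N → Fin q
      value (inj₁ (i , p)) = sec p
      value (inj₂ (i , p)) = crs p

      block : Word ⊎ Word → Fin k → Fin (N * q)
      block c x = graph (value c) (base c x)

      base-injective : ∀ c {x y} → base c x ≡ base c y → x ≡ y
      base-injective (inj₁ (i , p)) e = blk-inj i (⟨$⟩ʳ-injective (Φ p) e)
      base-injective (inj₂ (i , p)) e = blk-inj i e

      Valid : Word ⊎ Word → Set
      Valid (inj₁ w) = Data.Unit.Base.⊤
      Valid (inj₂ w) = Good w

      -- image (block c) T lies in section number place c T, where it is the copy of origin c T.
      -- All disjointness questions about the new blocks are thereby pulled back to the old packing.
      place : Word ⊎ Word → Subset k → Fin (q ^ t)
      place (inj₁ (i , p)) T = p
      place (inj₂ w)       T = home w T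

      origin : Word ⊎ Word → Subset k → Subset N
      origin (inj₁ w) T = shadow w T
      origin (inj₂ w) T = preimage (Φ (home w T)) (shadow w T)

      image-block : ∀ c {T} → ∣ T ∣ ≡ t → image (block c) T ≡ image (section (place c T)) (origin c T)
      image-block (inj₁ (i , p)) {T} e = image-∘ (section p) (blk i) T
      image-block (inj₂ w@(i , p)) {T} e = begin
        image (graph (crs p) ∘ blk i) T                               ≡⟨ image-∘ (graph (crs p)) (blk i) T ⟩
        image (graph (crs p)) S                                       ≡⟨ image-cong-∈ (λ {v} v∈ → cong (combine v) (sym (proj-spec p (image-size i e) v∈))) ⟩
        image (graph (sec p′)) S                                      ≡⟨ cong (image (graph (sec p′))) (image-preimage (Φ p′) S) ⟨
        image (graph (sec p′)) (image (Φ p′ ⟨$⟩ʳ_) (preimage (Φ p′) S)) ≡⟨ image-∘ (graph (sec p′)) (Φ p′ ⟨$⟩ʳ_) _ ⟨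
        image (section p′) (preimage (Φ p′) S)                        ∎
        where
        open ≡-Reasoning
        S  = shadow w T
        p′ = home w T

      origin-allowed : ∀ {w T} → Good w → ∣ T ∣ ≡ t → origin (inj₂ w) T L.∈ allowed T
      origin-allowed {T = T} good e = All.lookup good (∈-subsets⁺ T e)

      origin-size : ∀ c {T} → Valid c → ∣ T ∣ ≡ t → ∣ origin c T ∣ ≡ t
      origin-size (inj₁ (i , p)) valid e = image-size i e
      origin-size (inj₂ w) {T} good e = allowed-size T (origin-allowed good e)

      origin-reserved : ∀ c {T} → Valid c → ∣ T ∣ ≡ t → T L.∈ 𝓜 → ∃ λ j → res j ≡ origin c T
      origin-reserved (inj₁ (i , p)) valid e T∈ = reserved i e T∈
      origin-reserved (inj₂ w) {T} good e T∈ = ∈-allowed-res (origin-allowed good e) T∈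

      origin-unreserved : ∀ c {T} → Valid c → Own T → ∀ j → res j ≢ origin c T
      origin-unreserved (inj₁ (i , p)) valid own j = unreserved i own j
      origin-unreserved (inj₂ w) {T} good (e , T∉) j eq =
        proj₁ (∈-allowed-free (origin-allowed good e) T∉) (subst (L._∈ resList) eq (∈-resList⁺ j))

      unowned : ∀ {w T} → Good w → Own T → ∀ i {T′} → Own T′ → image (blk i) T′ ≢ origin (inj₂ w) T
      unowned good (e , T∉) i own eq =
        proj₂ (∈-allowed-free (origin-allowed good e) T∉) (subst (L._∈ ownList) eq (∈-ownList⁺ i own))

      -- Equal images have the same place and the same origin. Two copies are then separated by the
      -- old packing; a copy and a crossing, because the crossing uses free sets. For two crossings
      -- the shadows coincide, so the old blocks do, and both polynomials agree with one section on
      -- `t` points, so `crs-unique` applies.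
      block-disjoint : ∀ c c′ {T T′} → Valid c → Valid c′ → Own T → Own T′ →
                       image (block c) T ≡ image (block c′) T′ → c ≡ c′
      block-disjoint c c′ {T} {T′} valid valid′ own own′ e
        with p≡ , P≡ ← image-section-≡ (origin-size c valid (proj₁ own))
                         (trans (sym (image-block c (proj₁ own))) (trans e (image-block c′ (proj₁ own′))))
        = cases c c′ valid valid′ p≡ P≡
        where
        cases : ∀ c c′ → Valid c → Valid c′ → place c T ≡ place c′ T′ → origin c T ≡ origin c′ T′ → c ≡ c′
        cases (inj₁ (i , p)) (inj₁ (i′ , p′)) _ _ refl P≡ = cong (λ i → inj₁ (i , p)) (disjoint own own′ P≡)
        cases (inj₁ (i , p)) (inj₂ w)         _ g p≡ P≡ = contradiction P≡ (unowned g own′ i own)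
        cases (inj₂ w)       (inj₁ (i , p))   g _ p≡ P≡ = contradiction (sym P≡) (unowned g own i own′)
        cases (inj₂ w@(i , p)) (inj₂ w′@(i′ , p′)) _ _ p≡ P≡
          with S≡ ← trans (sym (image-preimage (Φ (home w T)) (shadow w T)))
                      (trans (cong (image (Φ (home w T) ⟨$⟩ʳ_)) P≡)
                        (trans (cong (λ z → image (Φ z ⟨$⟩ʳ_) (preimage (Φ (home w′ T′)) (shadow w′ T′))) p≡)
                          (image-preimage (Φ (home w′ T′)) (shadow w′ T′))))
          with refl ← disjoint own own′ S≡
          = cong (λ p → inj₂ (i , p)) (crs-unique (shadow w T) (image-size i (proj₁ own)) λ {v} v∈ →
              trans (sym (proj-spec p (image-size i (proj₁ own)) v∈))
                (trans (cong (λ z → sec z v) p≡) (proj-spec p′ (image-size i (proj₁ own′)) (subst (v ∈_) S≡ v∈))))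

      -- On `t + 1` common points a section and a crossing cannot agree. Two sections, or two
      -- crossings, agreeing there are the same, and the question descends to two different old
      -- blocks.
      block-meet : ∀ c c′ → c ≢ c′ → ∀ U → ∣ U ∣ ≡ suc t → ¬ (∀ {x} → x ∈ U → ∃ λ y → block c x ≡ block c′ y)
      block-meet c c′ c≢ U eU h = cases c c′ c≢ common agree
        where
        V : Subset N
        V = image (base c) U
        eV : ∣ V ∣ ≡ suc t
        eV = trans (∣image∣ (base c) (base-injective c)) eU
        common : ∀ {x} → x ∈ U → ∃ λ y → base c x ≡ base c′ y
        common x∈ with y , e ← h x∈ = y , proj₁ (graph-≡ {h = value c} {value c′} e)
        agree : ∀ {v} → v ∈ V → value c v ≡ value c′ v
        agree v∈ with x , x∈ , refl ← ∈-image⁻ (base c) v∈ = proj₂ (graph-≡ {h = value c} {value c′} (proj₂ (h x∈)))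
        small = shrink V t (≤-trans (n≤1+n t) (≤-reflexive (sym eV)))
        cases : ∀ c c′ → c ≢ c′ → (∀ {x} → x ∈ U → ∃ λ y → base c x ≡ base c′ y) →
                (∀ {v} → v ∈ V → value c v ≡ value c′ v) → ⊥
        cases (inj₁ (i , p)) (inj₁ (i′ , p′)) c≢ com agr
          with refl ← sec-unique (proj₁ small) (proj₂ (proj₂ small)) (λ v∈ → agr (proj₁ (proj₂ small) v∈))
          = meet (λ { refl → c≢ refl }) U eU λ x∈ → let y , e = com x∈ in y , ⟨$⟩ʳ-injective (Φ p) e
        cases (inj₁ (i , p)) (inj₂ (i′ , p′)) c≢ com agr = sec≢crs V eV agr
        cases (inj₂ (i , p)) (inj₁ (i′ , p′)) c≢ com agr = sec≢crs V eV (λ v∈ → sym (agr v∈))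
        cases (inj₂ (i , p)) (inj₂ (i′ , p′)) c≢ com agr
          with refl ← crs-unique (proj₁ small) (proj₂ (proj₂ small)) (λ v∈ → agr (proj₁ (proj₂ small) v∈))
          = meet (λ { refl → c≢ refl }) U eU com

      module _ (xs : List Word) (uniq : Unique xs) (good : All Good xs) where

        word : Fin (len * q ^ t) ⊎ Fin (length xs) → Word ⊎ Word
        word (inj₁ a) = inj₁ (remQuot (q ^ t) a)
        word (inj₂ b) = inj₂ (List.lookup xs b)

        word-injective : ∀ a b → word a ≡ word b → a ≡ b
        word-injective (inj₁ a) (inj₁ b) e = cong inj₁ (trans (sym (Fin.combine-remQuot {len} (q ^ t) a))
          (trans (cong (uncurry combine) (Data.Sum.Properties.inj₁-injective e)) (Fin.combine-remQuot {len} (q ^ t) b)))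
        word-injective (inj₁ a) (inj₂ b) ()
        word-injective (inj₂ a) (inj₁ b) ()
        word-injective (inj₂ a) (inj₂ b) e = cong inj₂ (lookup-injective uniq (Data.Sum.Properties.inj₂-injective e))

        decode : Fin (len * q ^ t + length xs) → Word ⊎ Word
        decode i = word (Fin.splitAt (len * q ^ t) i)

        decode-injective : ∀ {i j} → decode i ≡ decode j → i ≡ j
        decode-injective {i} {j} e = trans (sym (Fin.join-splitAt (len * q ^ t) (length xs) i))
          (trans (cong (Fin.join (len * q ^ t) (length xs)) (word-injective (Fin.splitAt (len * q ^ t) i) (Fin.splitAt (len * q ^ t) j) e))
            (Fin.join-splitAt (len * q ^ t) (length xs) j))

        decode-valid : ∀ i → Valid (decode i)
        decode-valid i with Fin.splitAt (len * q ^ t) i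
        ... | inj₁ _ = tt
        ... | inj₂ j = All.lookup good (lookup-∈ xs j)

        abstract
          blowup : State (N * q) (len * q ^ t + length xs) (q ^ t * rl)
          blowup = record
            { blk        = λ i → block (decode i)
            ; blk-inj    = λ i e → base-injective (decode i) (proj₁ (graph-≡ {h = value (decode i)} {value (decode i)} e))
            ; res        = λ j → image (section (quotient rl j)) (res (remainder {q ^ t} rl j))
            ; res-inj    = λ {i} {j} e → let p≡ , P≡ = image-section-≡ (res-size (remainder {q ^ t} rl i)) e in
                trans (sym (Fin.combine-remQuot {q ^ t} rl i)) (trans (cong₂ combine p≡ (res-inj P≡)) (Fin.combine-remQuot {q ^ t} rl j))
            ; res-size   = λ j → trans (∣image∣ (section (quotient rl j)) (section-injective _)) (res-size (remainder {q ^ t} rl j))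
            ; reserved   = λ i {T} e T∈ → let j , eq = origin-reserved (decode i) (decode-valid i) e T∈ in
                combine (place (decode i) T) j ,
                trans (cong₂ (λ p j → image (section p) (res j)) (cong proj₁ (Fin.remQuot-combine {q ^ t} {rl} (place (decode i) T) j)) (cong proj₂ (Fin.remQuot-combine {q ^ t} {rl} (place (decode i) T) j)))
                  (trans (cong (image (section (place (decode i) T))) eq) (sym (image-block (decode i) e)))
            ; unreserved = λ i {T} own j e → origin-unreserved (decode i) (decode-valid i) own (remainder {q ^ t} rl j)
                (proj₂ (image-section-≡ (res-size (remainder {q ^ t} rl j)) (trans e (image-block (decode i) (proj₁ own)))))
            ; disjoint   = λ {i} {i′} own own′ e → decode-injective (block-disjoint (decode i) (decode i′) (decode-valid i) (decode-valid i′) own own′ e)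
            ; meet       = λ {i} {i′} i≢ → block-meet (decode i) (decode i′) (i≢ ∘ decode-injective)
            }

    -- No crossings are added: the density stays the same while the number of points is multiplied
    -- by `q`.
    plain : State (N * q) (len * q ^ t) (q ^ t * rl)
    plain = subst (λ z → State (N * q) z (q ^ t * rl)) (+-identityʳ _) (blowup (λ _ → idₚ) [] [] [])

    words : List Word
    words = cartesianProduct (allFin len) (allFin (q ^ t))

    words-unique : Unique words
    words-unique = Unique.cartesianProduct⁺ (Unique.allFin⁺ len) (Unique.allFin⁺ (q ^ t))

    length-words : length words ≡ len * q ^ t
    length-words = trans (length-cartesianProductWith _,_ (allFin len) (allFin (q ^ t))) (cong₂ _*_ (length-allFin len) (length-allFin (q ^ t)))

    good? : ∀ (Φ : Vec (Permutation′ N) (q ^ t)) w → Dec (Good (lookup Φ) w)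
    good? Φ w = All.all? (λ T → preimage (lookup Φ (home w T)) (shadow w T) ∈ˢ? allowed T) (subsets k t)

    module _ (D : ℕ) (h : ∀ {T} → T L.∈ 𝓜 → N C t ≤ D * rl) (h′ : N C t ≤ D * length freeList) where

      abstract
        many-good : ∃ λ Φ → length words ≤ D ^ length (subsets k t) * length (filter (good? Φ) words)
        many-good = averaging (perms N) {{subst NonZero (sym (length-perms N)) (N !≢0)}} D (q ^ t) idₚ words (subsets k t) (subsets-unique k t) home
          (λ w T∈ T′∈ → home-injective w (∈-subsets⁻ k t T∈) (∈-subsets⁻ k t T′∈))
          (λ w T σ → preimage σ (shadow w T) ∈ˢ? allowed T)
          (λ w T T∈ → perms-hit D (allowed-unique T) (allowed-size T) (allowed-many D T h h′) (shadow w T)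
             (image-size (proj₁ w) (∈-subsets⁻ k t T∈)))

      Φ : Vec (Permutation′ N) (q ^ t)
      Φ = proj₁ many-good

      crossings : List Word
      crossings = filter (good? Φ) words

      -- `words` indexes the copies and the candidate crossings alike, so when a share of at least
      -- D^(-C(k,t)) of the candidates is good, the number of blocks gains that proportion over the
      -- plain blow-up.
      boost : ∃ λ len′ → State (N * q) len′ (q ^ t * rl) × len * q ^ t * (D ^ (k C t) + 1) ≤ D ^ (k C t) * len′
      boost = len * q ^ t + length crossings ,
        blowup (lookup Φ) crossings (Unique.filter⁺ (good? Φ) words-unique) (All.all-filter (good? Φ) words) , (begin
          len * q ^ t * (D ^ (k C t) + 1)                        ≡⟨ *-distribˡ-+ (len * q ^ t) (D ^ (k C t)) 1 ⟩
          len * q ^ t * D ^ (k C t) + len * q ^ t * 1            ≡⟨ cong₂ _+_ (*-comm (len * q ^ t) (D ^ (k C t))) (trans (*-identityʳ (len * q ^ t)) (sym length-words)) ⟩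
          D ^ (k C t) * (len * q ^ t) + length words             ≤⟨ +-monoʳ-≤ (D ^ (k C t) * (len * q ^ t)) (≤-trans (proj₂ many-good)
                                                                      (≤-reflexive (cong (λ z → D ^ z * length crossings) (length-subsets k t)))) ⟩
          D ^ (k C t) * (len * q ^ t) + D ^ (k C t) * length crossings
                                                                 ≡⟨ *-distribˡ-+ (D ^ (k C t)) (len * q ^ t) (length crossings) ⟨
          D ^ (k C t) * (len * q ^ t + length crossings)         ∎)
        where open ≤-Reasoning

-- Binomial estimates

-- The product of n - x(i) over i < t: the falling factorial for x(i) = i, and the power (n - b)^t
-- for constant x. Both comparisons with n^t come from one estimate.
descending : (ℕ → ℕ) → ℕ → ℕ → ℕ
descending x n zero    = 1
descending x n (suc t) = descending x n t * (n ∸ x t)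

descending≤ : ∀ x n t → descending x n t ≤ n ^ t
descending≤ x n zero    = ≤-refl
descending≤ x n (suc t) = ≤-trans (*-mono-≤ (descending≤ x n t) (m∸n≤m n (x t))) (≤-reflexive (*-comm (n ^ t) n))

-- Bernoulli's inequality, the product of the 1 - x(i)/n being at least 1 - ty/n, multiplied by
-- n^(t+1).
descending≥ : ∀ x y n t → (∀ i → i < t → x i ≤ y) → n * n ^ t ≤ n * descending x n t + t * (y * n ^ t)
descending≥ x y n zero    h = ≤-reflexive (sym (+-identityʳ _))
descending≥ x y n (suc t) h = begin
  n * (n * n ^ t)                                          ≤⟨ *-monoʳ-≤ n (descending≥ x y n t (λ i i<t → h i (m≤n⇒m≤1+n i<t))) ⟩
  n * (n * P + t * (y * n ^ t))                            ≡⟨ alg₁ n P t y (n ^ t) ⟩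
  n * (P * n) + t * (y * (n * n ^ t))                      ≤⟨ +-monoˡ-≤ _ (*-monoʳ-≤ n (*-monoʳ-≤ P (m≤n+m∸n n (x t)))) ⟩
  n * (P * (x t + (n ∸ x t))) + t * (y * (n * n ^ t))      ≡⟨ alg₂ n P (x t) (n ∸ x t) _ ⟩
  n * (P * (n ∸ x t)) + (x t * (n * P) + t * (y * (n * n ^ t)))
    ≤⟨ +-monoʳ-≤ (n * (P * (n ∸ x t))) (+-monoˡ-≤ _ (*-mono-≤ (h t ≤-refl) (*-monoʳ-≤ n (descending≤ x n t)))) ⟩
  n * (P * (n ∸ x t)) + (y * (n * n ^ t) + t * (y * (n * n ^ t))) ∎
  where
  open ≤-Reasoning
  P = descending x n t
  alg₁ : ∀ n P t y w → n * (n * P + t * (y * w)) ≡ n * (P * n) + t * (y * (n * w))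
  alg₁ = ℕ-solve-∀
  alg₂ : ∀ n P x d r → n * (P * (x + d)) + r ≡ n * (P * d) + (x * (n * P) + r)
  alg₂ = ℕ-solve-∀

-- The shape in which 1 − y t / n ≥ E / (1 + E) is used, for n ≥ y t (1 + E).
descending-ratio : ∀ x y n t E .{{_ : NonZero n}} → (∀ i → i < t → x i ≤ y) → suc E * (t * y) ≤ n →
                   E * n ^ t ≤ suc E * descending x n t
descending-ratio x y n t E h large = +-cancelˡ-≤ (n ^ t) _ _ (*-cancelˡ-≤ n (begin
  n * (n ^ t + E * n ^ t)                                     ≡⟨ alg₁ n E (n ^ t) ⟩
  suc E * (n * n ^ t)                                         ≤⟨ *-monoʳ-≤ (suc E) (descending≥ x y n t h) ⟩
  suc E * (n * P + t * (y * n ^ t))                           ≡⟨ alg₂ E n P t y (n ^ t) ⟩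
  suc E * (t * y) * n ^ t + n * (suc E * P)                   ≤⟨ +-monoˡ-≤ _ (*-monoˡ-≤ (n ^ t) large) ⟩
  n * n ^ t + n * (suc E * P)                                 ≡⟨ *-distribˡ-+ n _ _ ⟨
  n * (n ^ t + suc E * P)                                     ∎))
  where
  open ≤-Reasoning
  P = descending x n t
  alg₁ : ∀ n E w → n * (w + E * w) ≡ (1 + E) * (n * w)
  alg₁ = ℕ-solve-∀
  alg₂ : ∀ E n P t y w → (1 + E) * (n * P + t * (y * w)) ≡ (1 + E) * (t * y) * w + n * ((1 + E) * P)
  alg₂ = ℕ-solve-∀

falling : ℕ → ℕ → ℕ
falling = descending (λ i → i)

falling-! : ∀ {t n} → t ≤ n → falling n t * (n ∸ t) ! ≡ n !
falling-! {zero}  {n} _   = +-identityʳ _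
falling-! {suc t} {n} t<n = begin
  falling n t * (n ∸ t) * (n ∸ suc t) !        ≡⟨ *-assoc (falling n t) _ _ ⟩
  falling n t * ((n ∸ t) * (n ∸ suc t) !)      ≡⟨ cong (λ z → falling n t * (z * (n ∸ suc t) !)) (∸-suc t<n) ⟩
  falling n t * (suc (n ∸ suc t) !)            ≡⟨ cong (λ z → falling n t * z !) (∸-suc t<n) ⟨
  falling n t * (n ∸ t) !                      ≡⟨ falling-! (<⇒≤ t<n) ⟩
  n !                                          ∎
  where
  open ≡-Reasoning
  ∸-suc : ∀ {t n} → t < n → n ∸ t ≡ suc (n ∸ suc t)
  ∸-suc {t} {suc n} (s≤s le) = +-∸-assoc 1 le

t!*nCt≡falling : ∀ {t n} → t ≤ n → t ! * (n C t) ≡ falling n t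
t!*nCt≡falling {t} {n} le = *-cancelʳ-≡ _ _ ((n ∸ t) !) {{(n ∸ t) !≢0}} (begin
  t ! * (n C t) * (n ∸ t) !        ≡⟨ alg (t !) (n C t) ((n ∸ t) !) ⟩
  (n C t) * (t ! * (n ∸ t) !)      ≡⟨ nCk*k!*[n∸k]!≡n! le ⟩
  n !                              ≡⟨ falling-! le ⟨
  falling n t * (n ∸ t) !          ∎)
  where
  open ≡-Reasoning
  alg : ∀ a b c → a * b * c ≡ b * (a * c)
  alg = ℕ-solve-∀

t!*nCt≤n^t : ∀ {t n} → t ≤ n → t ! * (n C t) ≤ n ^ t
t!*nCt≤n^t {t} {n} le = ≤-trans (≤-reflexive (t!*nCt≡falling le)) (descending≤ (λ i → i) n t)

nCt≤n^t : ∀ {t n} → t ≤ n → n C t ≤ n ^ t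
nCt≤n^t {t} {n} le = ≤-trans (m≤n*m (n C t) (t !) {{t !≢0}}) (t!*nCt≤n^t le)

nC[1+t]*[1+t] : ∀ {t n} → t < n → (n C suc t) * suc t ≡ (n C t) * (n ∸ t)
nC[1+t]*[1+t] {t} {n} t<n = *-cancelˡ-≡ _ _ (t !) {{t !≢0}} (begin
  t ! * ((n C suc t) * suc t)     ≡⟨ alg₁ (t !) (n C suc t) t ⟩
  suc t ! * (n C suc t)           ≡⟨ t!*nCt≡falling t<n ⟩
  falling n t * (n ∸ t)           ≡⟨ cong (_* (n ∸ t)) (t!*nCt≡falling (<⇒≤ t<n)) ⟨
  t ! * (n C t) * (n ∸ t)         ≡⟨ *-assoc (t !) _ _ ⟩
  t ! * ((n C t) * (n ∸ t))       ∎)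
  where
  open ≡-Reasoning
  alg₁ : ∀ f c t → f * (c * (1 + t)) ≡ (1 + t) * f * c
  alg₁ = ℕ-solve-∀

-- The next binomial coefficient is larger by the factor (n-t)/(t+1). This absorbs the edges that
-- have an own (t-1)-subset.
nCt-ratio : ∀ E {t n} → t < n → E * suc t ≤ n ∸ t → E * (n C t) ≤ n C suc t
nCt-ratio E {t} {n} t<n large = *-cancelʳ-≤ _ _ (suc t) (begin
  E * (n C t) * suc t          ≡⟨ alg E (n C t) t ⟩
  (n C t) * (E * suc t)        ≤⟨ *-monoʳ-≤ (n C t) large ⟩
  (n C t) * (n ∸ t)            ≡⟨ nC[1+t]*[1+t] t<n ⟨
  (n C suc t) * suc t          ∎)
  where
  open ≤-Reasoning
  alg : ∀ E c t → E * c * (1 + t) ≡ c * (E * (1 + t))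
  alg = ℕ-solve-∀

^-distribʳ-* : ∀ a b t → (a * b) ^ t ≡ a ^ t * b ^ t
^-distribʳ-* a b zero    = refl
^-distribʳ-* a b (suc t) = trans (cong (a * b *_) (^-distribʳ-* a b t)) (alg a b (a ^ t) (b ^ t))
  where
  alg : ∀ a b x y → a * b * (x * y) ≡ a * x * (b * y)
  alg = ℕ-solve-∀

-- Iterating the amplification

module Iteration (k t : ℕ) (t≤k : t ≤ k) (𝓜 : List (Subset k)) (𝓜-unique : Unique 𝓜)
                 (𝓜-size : All (λ T → ∣ T ∣ ≡ t) 𝓜) where
  open Packing k t 𝓜 public

  μ : ℕ
  μ = length 𝓜

  length-ownShapes : μ + length ownShapes ≡ k C t
  length-ownShapes = begin
    μ + length ownShapes                                                        ≡⟨ cong (_+ length ownShapes) (≤-antisym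
        (length-⊆ 𝓜-unique (λ T∈ → L.∈-filter⁺ (_∈ˢ? 𝓜) (∈-subsets⁺ _ (All.lookup 𝓜-size T∈)) T∈))
        (length-⊆ (Unique.filter⁺ (_∈ˢ? 𝓜) (subsets-unique k t)) (λ T∈ → proj₂ (L.∈-filter⁻ (_∈ˢ? 𝓜) {xs = subsets k t} T∈)))) ⟩
    length (filter (_∈ˢ? 𝓜) (subsets k t)) + length ownShapes                   ≡⟨ length-filter-¬ (_∈ˢ? 𝓜) (subsets k t) ⟩
    length (subsets k t)                                                        ≡⟨ length-subsets k t ⟩
    k C t                                                                       ∎
    where open ≡-Reasoning

  initial : ∀ {N} → k ≤ N → State N 1 μ
  initial {N} k≤N = record
    { blk        = λ _ → φ
    ; blk-inj    = λ _ → φ-inj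
    ; res        = λ j → image φ (List.lookup 𝓜 j)
    ; res-inj    = λ e → lookup-injective 𝓜-unique (image-injective φ φ-inj e)
    ; res-size   = λ j → trans (∣image∣ φ φ-inj) (All.lookup 𝓜-size (lookup-∈ 𝓜 j))
    ; reserved   = λ _ _ T∈ → let j , e = ∈-lookup T∈ in j , cong (image φ) e
    ; unreserved = λ { _ (_ , T∉) j e → T∉ (subst (L._∈ 𝓜) (image-injective φ φ-inj e) (lookup-∈ 𝓜 j)) }
    ; disjoint   = λ { {zero} {zero} _ _ _ → refl }
    ; meet       = λ { {zero} {zero} i≢ → contradiction refl i≢ }
    }
    where
    φ : Fin k → Fin N
    φ x = Fin.inject≤ x k≤N
    φ-inj : ∀ {x y} → φ x ≡ φ y → x ≡ y
    φ-inj = Fin.inject≤-injective k≤N k≤N _ _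

  -- The own sets of one fixed shape are already different in different blocks; this crude bound is
  -- what ends the iteration.
  len≤ : ∀ {N len rl T} → Own T → State N len rl → len ≤ N C t
  len≤ {N} {len} {T = T} own St = subst₂ _≤_ (length-allFin len) (length-subsets N t)
    (length-injection (λ i → image (blk i) T) (Unique.allFin⁺ len)
      (λ {i} _ → ∈-subsets⁺ _ (image-size i (proj₁ own))) (λ _ _ → disjoint own own))
    where open State St

  code-1+j*N! : ∀ N j .{{_ : NonZero j}} → Code N t (1 + j * N !)
  code-1+j*N! N j = code N t (1 + j * N !) (s≤s (>-nonZero⁻¹ _ {{m*n≢0 j (N !) {{it}} {{N !≢0}}}})) (coprime-1+j*N! N j)
    where
    it : {{x : NonZero j}} → NonZero j
    it {{x}} = x

  module _ (N₀ D : ℕ) (k≤N₀ : k ≤ N₀) (1≤N₀ : 1 ≤ N₀) (N₀^t≤D : N₀ ^ t ≤ D) where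

    G : ℕ
    G = D ^ (k C t)

    private
      instance
        N₀≢0 : NonZero N₀
        N₀≢0 = >-nonZero 1≤N₀
        N₀^t≢0 : NonZero (N₀ ^ t)
        N₀^t≢0 = m^n≢0 N₀ t
        G≢0 : NonZero G
        G≢0 = m^n≢0 D (k C t) {{>-nonZero (≤-trans (>-nonZero⁻¹ (N₀ ^ t)) N₀^t≤D)}}

    record Stage : Set where
      field
        {N len rl} : ℕ
        state      : State N len rl
        N₀≤N       : N₀ ≤ N
        -- Reserved sets are multiplied by the same factor as N^t, so their share keeps its initial
        -- value, which a large `N₀` makes small.
        rl-ratio   : rl * N₀ ^ t ≡ μ * N ^ t

    Saturated : Stage → Set
    Saturated S = D * length (State.freeList (Stage.state S)) < Stage.N S C t

    -- Each boost gains at least N ^ t / (G N₀ ^ t) blocks, a fixed multiple of N ^ t, so boosting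
    -- must stop: len ≤ N C t ≤ N ^ t.
    Dense : ℕ → Stage → Set
    Dense j S = (G + j) * Stage.N S ^ t ≤ G * (Stage.len S * N₀ ^ t)

    step : ∀ j (S : Stage) → Dense j S → ∃ Saturated ⊎ ∃ (Dense (suc j))
    step j S dense with Stage.N S C t ≤? D * length (State.freeList (Stage.state S))
    ... | no  ≰D = inj₁ (S , ≰⇒> ≰D)
    ... | yes le = inj₂ (S′ , dense′)
      where
      open Stage S
      q₁ : ℕ
      q₁ = 1 + 1 * N !
      enough : ∀ {T} → T L.∈ 𝓜 → N C t ≤ D * rl
      enough T∈ = begin
        N C t          ≤⟨ nCt≤n^t (≤-trans t≤k (≤-trans k≤N₀ N₀≤N)) ⟩
        N ^ t          ≤⟨ m≤n*m (N ^ t) μ {{>-nonZero (m≥1 T∈)}} ⟩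
        μ * N ^ t      ≡⟨ rl-ratio ⟨
        rl * N₀ ^ t    ≤⟨ *-monoʳ-≤ rl N₀^t≤D ⟩
        rl * D         ≡⟨ *-comm rl D ⟩
        D * rl         ∎
        where
        open ≤-Reasoning
        m≥1 : ∀ {xs : List (Subset k)} {T} → T L.∈ xs → 1 ≤ length xs
        m≥1 (here _)  = s≤s z≤n
        m≥1 (there _) = s≤s z≤n
      boosted = Blowup.boost state (code-1+j*N! N 1) D enough le
      len′ = proj₁ boosted
      S′ : Stage
      S′ = record
        { state    = proj₁ (proj₂ boosted)
        ; N₀≤N     = ≤-trans N₀≤N (m≤m*n N q₁)
        ; rl-ratio = begin
            q₁ ^ t * rl * N₀ ^ t        ≡⟨ *-assoc (q₁ ^ t) rl _ ⟩
            q₁ ^ t * (rl * N₀ ^ t)      ≡⟨ cong (q₁ ^ t *_) rl-ratio ⟩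
            q₁ ^ t * (μ * N ^ t)        ≡⟨ alg (q₁ ^ t) μ (N ^ t) ⟩
            μ * (N ^ t * q₁ ^ t)        ≡⟨ cong (μ *_) (^-distribʳ-* N q₁ t) ⟨
            μ * (N * q₁) ^ t            ∎
        }
        where
        open ≡-Reasoning
        alg : ∀ a b c → a * (b * c) ≡ b * (c * a)
        alg = ℕ-solve-∀
      -- Density never drops below that of the single initial block, so the relative gain 1/G of a
      -- boost is at least a fixed absolute one.
      never-sparser : N ^ t ≤ len * N₀ ^ t
      never-sparser = *-cancelˡ-≤ G (≤-trans (*-monoˡ-≤ (N ^ t) (m≤m+n G j)) dense)
      dense′ : Dense (suc j) S′
      dense′ = begin
        (G + suc j) * (N * q₁) ^ t                              ≡⟨ cong₂ _*_ (+-suc G j) (^-distribʳ-* N q₁ t) ⟩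
        suc (G + j) * (N ^ t * q₁ ^ t)                          ≡⟨ alg₁ (G + j) (N ^ t) (q₁ ^ t) ⟩
        (N ^ t + (G + j) * N ^ t) * q₁ ^ t                      ≤⟨ *-monoˡ-≤ (q₁ ^ t) (+-mono-≤ never-sparser dense) ⟩
        (len * N₀ ^ t + G * (len * N₀ ^ t)) * q₁ ^ t            ≡⟨ alg₂ len (N₀ ^ t) G (q₁ ^ t) ⟩
        (len * q₁ ^ t * (G + 1)) * N₀ ^ t                       ≤⟨ *-monoˡ-≤ (N₀ ^ t) (proj₂ (proj₂ boosted)) ⟩
        G * len′ * N₀ ^ t                                      ≡⟨ *-assoc G len′ _ ⟩
        G * (len′ * N₀ ^ t)                                    ∎
        where
        open ≤-Reasoning
        alg₁ : ∀ g n q → (1 + g) * (n * q) ≡ (n + g * n) * q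
        alg₁ = ℕ-solve-∀
        alg₂ : ∀ l n g q → (l * n + g * (l * n)) * q ≡ l * q * (g + 1) * n
        alg₂ = ℕ-solve-∀

    iterate : ∀ j → ∃ Saturated ⊎ ∃ (Dense j)
    iterate zero    = inj₂ (record { state = initial k≤N₀ ; N₀≤N = ≤-refl ; rl-ratio = refl } ,
      ≤-reflexive (cong₂ _*_ (+-identityʳ G) (sym (+-identityʳ _))))
    iterate (suc j) with iterate j
    ... | inj₁ done        = inj₁ done
    ... | inj₂ (S , dense) = step j S dense

    abstract
      saturated : ∀ {T} → Own T → ∃ Saturated
      -- After `G * N₀ ^ t` gains of N^t / (G N₀^t) each, the number of blocks would exceed N^t.
      saturated own with iterate (G * N₀ ^ t)
      ... | inj₁ done        = done
      ... | inj₂ (S , dense) = contradiction (begin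
        (G + G * N₀ ^ t) * N ^ t     ≤⟨ dense ⟩
        G * (len * N₀ ^ t)           ≤⟨ *-monoʳ-≤ G (*-monoˡ-≤ (N₀ ^ t) (≤-trans (len≤ own state) (nCt≤n^t (≤-trans t≤k (≤-trans k≤N₀ N₀≤N))))) ⟩
        G * (N ^ t * N₀ ^ t)         ≡⟨ alg G (N ^ t) (N₀ ^ t) ⟩
        G * N₀ ^ t * N ^ t           ∎)
        (<⇒≱ (*-monoˡ-< (N ^ t) {{m^n≢0 N t {{>-nonZero (≤-trans 1≤N₀ N₀≤N)}}}} (+-monoˡ-< (G * N₀ ^ t) (>-nonZero⁻¹ G))))
        where
        open Stage S
        open ≤-Reasoning
        alg : ∀ a b c → a * (b * c) ≡ a * c * b
        alg = ℕ-solve-∀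

  -- In a saturated stage every t-set is own, reserved or free, and the last two kinds are rare; so
  -- the own sets nearly exhaust N^t / t!.
  near-perfect : ∀ {T} → Own T → 1 ≤ t → ∀ E → ∃ λ N → ∃ λ len → ∃ λ rl → State N len rl × 1 ≤ N ×
                 E * N ^ t ≤ suc E * (t ! * (len * length ownShapes))
  near-perfect own 1≤t E = N , len , rl , state , 1≤N , *-cancelˡ-≤ 3 (+-cancelˡ-≤ (3 * W) _ _ (begin
      3 * W + 3 * (E * W)                                   ≡⟨ alg₁ W E ⟩
      W + E₃ * W                                            ≤⟨ +-monoʳ-≤ W (descending-ratio (λ i → i) t N t E₃ {{>-nonZero 1≤N}} (λ i → <⇒≤)
                                                                 (≤-trans (m≤n⇒m≤o+n k (m≤m+n _ _)) (<⇒≤ N₀≤N))) ⟩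
      W + suc E₃ * falling N t                              ≡⟨ cong (λ z → W + suc E₃ * z) (t!*nCt≡falling t≤N) ⟨
      W + suc E₃ * (t ! * (N C t))                          ≤⟨ +-monoʳ-≤ W (*-monoʳ-≤ (suc E₃) (*-monoʳ-≤ (t !) (State.subsets-count state))) ⟩
      W + suc E₃ * (t ! * (F + (rl + len * a)))             ≡⟨ alg₂ W E₃ (t !) F rl (len * a) ⟩
      W + suc E₃ * t ! * F + suc E₃ * t ! * rl + suc E₃ * (t ! * (len * a))
        ≤⟨ +-monoˡ-≤ _ (+-mono-≤ (+-monoʳ-≤ W free-small) rl-small) ⟩
      W + W + W + suc E₃ * (t ! * (len * a))                ≡⟨ alg₃ W E (t ! * (len * a)) ⟩
      3 * W + 3 * (suc E * (t ! * (len * a)))               ∎))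
    where
    open ≤-Reasoning
    a  = length ownShapes
    -- Chosen so that 1 + E₃ = 3(1 + E): three losses, from N^t to the falling factorial, from the
    -- free sets and from the reserved sets, cost at most a share 1/(1 + E₃) each.
    E₃ = 2 + 3 * E
    -- The summands provide, in turn, room for the first block, the threshold of `descending-ratio`,
    -- and a small share of reserved sets.
    N₀ = suc (k + (suc E₃ * (t * t) + suc E₃ * t ! * μ))
    -- The first summand keeps the reserved share at least 1/D when 𝓜 is not empty; the second makes
    -- a free share below 1/D negligible.
    D  = N₀ ^ t + suc E₃ * t !
    k≤N₀ : k ≤ N₀
    k≤N₀ = m≤n⇒m≤1+n (m≤m+n k _)
    final = saturated N₀ D k≤N₀ (s≤s z≤n) (m≤m+n _ _) own
    open Stage (proj₁ final)
    W = N ^ t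
    F = length (State.freeList state)
    1≤N : 1 ≤ N
    1≤N = ≤-trans (s≤s z≤n) N₀≤N
    t≤N : t ≤ N
    t≤N = ≤-trans t≤k (≤-trans k≤N₀ N₀≤N)
    free-small : suc E₃ * t ! * F ≤ W
    free-small = begin
      suc E₃ * t ! * F   ≤⟨ *-monoˡ-≤ F (m≤n+m (suc E₃ * t !) (N₀ ^ t)) ⟩
      D * F              ≤⟨ <⇒≤ (proj₂ final) ⟩
      N C t              ≤⟨ nCt≤n^t t≤N ⟩
      W                  ∎
    rl-small : suc E₃ * t ! * rl ≤ W
    rl-small = *-cancelˡ-≤ (N₀ ^ t) {{m^n≢0 N₀ t}} (begin
      N₀ ^ t * (suc E₃ * t ! * rl)     ≡⟨ alg (N₀ ^ t) (suc E₃ * t !) rl ⟩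
      suc E₃ * t ! * (rl * N₀ ^ t)     ≡⟨ cong (suc E₃ * t ! *_) rl-ratio ⟩
      suc E₃ * t ! * (μ * W)           ≡⟨ *-assoc (suc E₃ * t !) μ W ⟨
      suc E₃ * t ! * μ * W             ≤⟨ *-monoˡ-≤ W (m≤n⇒m≤1+n (m≤n⇒m≤o+n k (m≤n+m _ (suc E₃ * (t * t))))) ⟩
      N₀ * W                           ≤⟨ *-monoˡ-≤ W (≤-trans (≤-reflexive (sym (*-identityʳ N₀))) (^-monoʳ-≤ N₀ 1≤t)) ⟩
      N₀ ^ t * W                       ∎)
      where
      alg : ∀ a b c → a * (b * c) ≡ b * (c * a)
      alg = ℕ-solve-∀
    alg₁ : ∀ w e → 3 * w + 3 * (e * w) ≡ w + (2 + 3 * e) * w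
    alg₁ = ℕ-solve-∀
    alg₂ : ∀ w e f x y z → w + (1 + e) * (f * (x + (y + z))) ≡ w + (1 + e) * f * x + (1 + e) * f * y + (1 + e) * (f * z)
    alg₂ = ℕ-solve-∀
    alg₃ : ∀ w e x → w + w + w + (3 + 3 * e) * x ≡ 3 * w + 3 * ((1 + e) * x)
    alg₃ = ℕ-solve-∀

-- From one dense packing to every large n, and to hypergraphs

descending-const : ∀ b n t → descending (λ _ → b) n t ≡ (n ∸ b) ^ t
descending-const b n zero    = refl
descending-const b n (suc t) = trans (cong (_* (n ∸ b)) (descending-const b n t)) (*-comm _ (n ∸ b))

-- Two losses are merged into one. With 3E it works because (3E+1)² + (3E-1) = 9E(E+1); with 2E it
-- would just fail, as (2E+1)² = 4E(E+1) + 1.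
combine-ratios : ∀ E .{{_ : NonZero E}} {w x y z} → 3 * E * w ≤ suc (3 * E) * x → 3 * E * y ≤ suc (3 * E) * z →
                 E * (w * y) ≤ suc E * (x * z)
combine-ratios E@(suc e) {w} {x} {y} {z} p r = *-cancelˡ-≤ (9 * E) (begin
  9 * E * (E * (w * y))                            ≡⟨ alg₁ E w y ⟩
  (3 * E * w) * (3 * E * y)                        ≤⟨ *-mono-≤ p r ⟩
  (suc (3 * E) * x) * (suc (3 * E) * z)            ≤⟨ m≤m+n _ ((3 * e + 2) * (x * z)) ⟩
  (suc (3 * E) * x) * (suc (3 * E) * z) + (3 * e + 2) * (x * z) ≡⟨ alg₂ e x z ⟩
  9 * E * (suc E * (x * z))                        ∎)
  where
  open ≤-Reasoning
  alg₁ : ∀ E w y → 9 * E * (E * (w * y)) ≡ (3 * E * w) * (3 * E * y)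
  alg₁ = ℕ-solve-∀
  alg₂ : ∀ e x z → ((1 + 3 * (1 + e)) * x) * ((1 + 3 * (1 + e)) * z) + (3 * e + 2) * (x * z) ≡ 9 * (1 + e) * ((2 + e) * (x * z))
  alg₂ = ℕ-solve-∀

module Constructions (k t : ℕ) (t≤k : t ≤ k) (1≤t : 1 ≤ t) (𝓜 : List (Subset k)) (𝓜-unique : Unique 𝓜)
                     (𝓜-size : All (λ T → ∣ T ∣ ≡ t) 𝓜) where
  open Iteration k t t≤k 𝓜 𝓜-unique 𝓜-size public

  module Spread (N B E : ℕ) (1≤N : 1 ≤ N) (1≤B : 1 ≤ B) where
    open ≤-Reasoning
    instance
      N≢0 : NonZero N
      N≢0 = >-nonZero 1≤N
      B≢0 : NonZero B
      B≢0 = >-nonZero 1≤B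
    -- The first summand gives `B < u n`, hence `1 ≤ j n` and a modulus above 1; the second makes
    -- `Q n` large enough for `descending-ratio`.
    n₀ = N * suc B + N * (suc (3 * E) * (t * B))
    -- `r n` is the largest number congruent to 1 modulo `B` that is at most n / N, and `Q n` is the
    -- next one. So n lies between `N * r n` and `N * Q n`, whose t-th powers are asymptotically
    -- equal since `B` is fixed. For `B = N !` the number `r n` is a modulus with a code.
    u j r Q : ℕ → ℕ
    u n = n ℕ./ N
    j n = (u n ∸ 1) ℕ./ B
    r n = 1 + j n * B
    Q n = B + r n
    n<[1+u]N : ∀ n → n < suc (u n) * N
    n<[1+u]N n = subst (_< suc (u n) * N) (sym (m≡m%n+[m/n]*n n N)) (+-monoˡ-< (u n * N) (m%n<n n N))
    B<u : ∀ n → n₀ ≤ n → B < u n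
    B<u n le = ≤-pred (*-cancelʳ-< N (suc B) (suc (u n)) (≤-<-trans (≤-trans (≤-reflexive (*-comm (suc B) N)) (≤-trans (m≤m+n _ _) le)) (n<[1+u]N n)))
    u∸1 : ∀ n → n₀ ≤ n → suc (u n ∸ 1) ≡ u n
    u∸1 n le = m+[n∸m]≡n (≤-trans (s≤s z≤n) (B<u n le))
    u≤ : ∀ n → n₀ ≤ n → suc (u n) ≤ Q n
    u≤ n le = begin
      suc (u n)                                   ≡⟨ cong suc (u∸1 n le) ⟨
      suc (suc (u n ∸ 1))                         ≡⟨ cong (2 +_) (m≡m%n+[m/n]*n (u n ∸ 1) B) ⟩
      suc (suc ((u n ∸ 1) ℕ.% B) + j n * B)         ≤⟨ s≤s (+-monoˡ-≤ (j n * B) (m%n<n (u n ∸ 1) B)) ⟩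
      suc (B + j n * B)                           ≡⟨ +-suc B (j n * B) ⟨
      B + r n                                     ∎
    r≤u : ∀ n → n₀ ≤ n → r n ≤ u n
    r≤u n le = begin
      suc (j n * B)                               ≤⟨ s≤s (m≤n+m (j n * B) ((u n ∸ 1) ℕ.% B)) ⟩
      suc ((u n ∸ 1) ℕ.% B + j n * B)               ≡⟨ cong suc (m≡m%n+[m/n]*n (u n ∸ 1) B) ⟨
      suc (u n ∸ 1)                               ≡⟨ u∸1 n le ⟩
      u n                                         ∎
    1≤j : ∀ n → n₀ ≤ n → 1 ≤ j n
    1≤j n le with j n in eq
    ... | suc _ = s≤s z≤n
    ... | zero  = contradiction (u≤ n le) (<⇒≱ (≤-trans (≤-reflexive (trans (cong (λ z → suc (B + (1 + z * B))) eq) (cong suc (+-comm B 1)))) (s≤s (B<u n le))))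
    Nr≤n : ∀ n → n₀ ≤ n → N * r n ≤ n
    Nr≤n n le = begin
      N * r n                  ≤⟨ *-monoʳ-≤ N (r≤u n le) ⟩
      N * u n                  ≡⟨ *-comm N (u n) ⟩
      u n * N                  ≤⟨ m≤n+m (u n * N) (n ℕ.% N) ⟩
      n ℕ.% N + u n * N          ≡⟨ m≡m%n+[m/n]*n n N ⟨
      n                        ∎
    n≤NQ : ∀ n → n₀ ≤ n → n ≤ N * Q n
    n≤NQ n le = ≤-trans (<⇒≤ (n<[1+u]N n)) (≤-trans (*-monoˡ-≤ N (u≤ n le)) (≤-reflexive (*-comm (Q n) N)))
    Q-large : ∀ n → n₀ ≤ n → suc (3 * E) * (t * B) ≤ Q n
    Q-large n le = *-cancelˡ-≤ N (≤-trans (m≤n+m _ (N * suc B)) (≤-trans le (n≤NQ n le)))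
    Q-ratio : ∀ n → n₀ ≤ n → 3 * E * Q n ^ t ≤ suc (3 * E) * r n ^ t
    Q-ratio n le = ≤-trans (descending-ratio (λ _ → B) B (Q n) t (3 * E) {{>-nonZero (≤-trans (s≤s z≤n) (m≤n+m (r n) B))}} (λ _ _ → ≤-refl) (Q-large n le))
      (≤-reflexive (cong (suc (3 * E) *_) (trans (descending-const B (Q n) t) (cong (_^ t) (m+n∸m≡n B (r n))))))
    bound : .{{_ : NonZero E}} → ∀ len a → 3 * E * N ^ t ≤ suc (3 * E) * (t ! * (len * a)) →
            ∀ n → n₀ ≤ n → E * n ^ t ≤ suc E * (t ! * (len * r n ^ t * a))
    bound len a dense n le = begin
      E * n ^ t                                   ≤⟨ *-monoʳ-≤ E (^-monoˡ-≤ t (n≤NQ n le)) ⟩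
      E * (N * Q n) ^ t                           ≡⟨ cong (E *_) (^-distribʳ-* N (Q n) t) ⟩
      E * (N ^ t * Q n ^ t)                       ≤⟨ combine-ratios E dense (Q-ratio n le) ⟩
      suc E * (t ! * (len * a) * r n ^ t)         ≡⟨ cong (suc E *_) (alg (t !) len a (r n ^ t)) ⟩
      suc E * (t ! * (len * r n ^ t * a))         ∎
      where
      alg : ∀ f l a q → f * (l * a) * q ≡ f * (l * q * a)
      alg = ℕ-solve-∀

  module _ {T₀ : Subset k} (own₀ : Own T₀) where

    PackingsFor : ℕ → Set
    PackingsFor E = ∃ λ n₀ → ∀ n → n₀ ≤ n → ∃ λ N → ∃ λ len → ∃ λ rl →
                    State N len rl × N ≤ n × E * n ^ t ≤ suc E * (t ! * (len * length ownShapes))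

    abstract
      packings : ∀ E .{{_ : NonZero E}} → PackingsFor E
      packings E = spread (near-perfect own₀ 1≤t (3 * E))
        where
        spread : (∃ λ N → ∃ λ len → ∃ λ rl → State N len rl × 1 ≤ N × 3 * E * N ^ t ≤ suc (3 * E) * (t ! * (len * length ownShapes))) → PackingsFor E
        spread (N , len , rl , St , 1≤N , dense) = n₀ , λ n n₀≤n → N * r n , len * r n ^ t , r n ^ t * rl ,
            Blowup.plain St (code-1+j*N! N (j n) {{>-nonZero (1≤j n n₀≤n)}}) , Nr≤n n n₀≤n , bound len (length ownShapes) dense n n₀≤n
          where open Spread N (N !) E 1≤N (1≤n! N)

    module _ {N len rl} (St : State N len rl) where
      open State St

      abstract
        -- The set would also be the image of some shape `T′` in block `i′`. If `T′` is in 𝓜 the set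
        -- is reserved, which own sets are not; otherwise it is own for two blocks.
        own-not-covered : ∀ {i i′ T} → i ≢ i′ → Own T → ¬ (∀ {x} → x ∈ T → ∃ λ y → blk i x ≡ blk i′ y)
        own-not-covered {i} {i′} {T} i≢ own cov = by-case (T′ ∈ˢ? 𝓜)
          where
          back? : ∀ y → Dec (∃ λ x → x ∈ T × blk i x ≡ blk i′ y)
          back? y = Fin.any? (λ x → (x ∈? T) ×-dec (blk i x Fin.≟ blk i′ y))
          T′ : Subset k
          T′ = ⟪ back? ⟫
          same : image (blk i′) T′ ≡ image (blk i) T
          same = ⊆-antisym
            (image-⊆ (blk i′) (λ y∈ → let x , x∈ , e = ∈-⟪⟫⁻ back? y∈ in subst (_∈ image (blk i) T) e (∈-image⁺ (blk i) x∈)))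
            (image-⊆ (blk i) (λ {x} x∈ → let y , e = cov x∈ in subst (_∈ image (blk i′) T′) (sym e) (∈-image⁺ (blk i′) (∈-⟪⟫⁺ back? (x , x∈ , e)))))
          size : ∣ T′ ∣ ≡ t
          size = trans (sym (∣image∣ (blk i′) (blk-inj i′))) (trans (cong ∣_∣ same) (image-size i (proj₁ own)))
          by-case : Dec (T′ L.∈ 𝓜) → ⊥
          by-case (yes T′∈) with j , e ← reserved i′ size T′∈ = unreserved i own j (trans e same)
          by-case (no T′∉) = i≢ (disjoint own (size , T′∉) (sym same))

      abstract
        -- If `c` other edges covered every point of an edge at least `s` times, their traces could
        -- be cut down to cover exactly `s` times. By `meet` traces have at most `t` points, so some
        -- `l` of them have exactly `t` and form a disjoint covering sequence; by `own-not-covered`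
        -- those have shapes in 𝓜, which excludes such a sequence.
        frameproof : ∀ {n c s l q} → N ≤ n → t ≡ suc q → s * k ≡ l + q * c → NoDisjointSeq l (s + 1) (c ∸ s + 1) 𝓜 →
                     ∃ λ F → IsUniform n k F × Frameproof c s F × length F ≡ len
        frameproof {n} {c} {s} {l} {q} N≤n refl e no-seq =
          map edge (allFin len) , (Unique.map⁺ edge-injective (Unique.allFin⁺ len) , All.map⁺ (All.tabulate (λ {i} _ → edge-size i))) , proof ,
          trans (List.length-map edge (allFin len)) (length-allFin len)
          where
          φ : Fin len → Fin k → Fin n
          φ i x = Fin.inject≤ (blk i x) N≤n
          φ-blk : ∀ {i i′ x y} → φ i x ≡ φ i′ y → blk i x ≡ blk i′ y
          φ-blk = Fin.inject≤-injective N≤n N≤n _ _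
          edge : Fin len → Subset n
          edge i = image (φ i) ⊤
          edge-size : ∀ i → ∣ edge i ∣ ≡ k
          edge-size i = trans (∣image∣ (φ i) (blk-inj i ∘ φ-blk)) (∣⊤∣≡n k)
          edge-injective : ∀ {i i′} → edge i ≡ edge i′ → i ≡ i′
          edge-injective {i} {i′} eq with i Fin.≟ i′
          ... | yes i≡ = i≡
          ... | no i≢  = contradiction (λ {x} x∈ → let y , _ , e = ∈-image⁻ (φ i′) {⊤} (subst (φ i x ∈_) eq (∈-image⁺ (φ i) ∈⊤)) in y , φ-blk (sym e))
                           (own-not-covered i≢ own₀)
          proof : Frameproof c s (map edge (allFin len))
          proof A₀ A₀∈ A A∈ A₀≢ with Fin.any? (λ x → (x ∈? A₀) ×-dec (mult x A <? s))
          ... | yes found = found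
          ... | no ¬found with i₀ , _ , refl ← L.∈-map⁻ edge A₀∈ = ⊥-elim (no-seq (T ∘ g) shape∈𝓜 (proj₂ (proj₂ sub)))
            where
            idx : Fin c → Fin len
            idx j = proj₁ (L.∈-map⁻ edge (A∈ j))
            A≡ : ∀ j → A j ≡ edge (idx j)
            A≡ j = proj₂ (proj₂ (L.∈-map⁻ edge (A∈ j)))
            i₀≢ : ∀ j → i₀ ≢ idx j
            i₀≢ j eq = A₀≢ j (trans (cong edge eq) (sym (A≡ j)))
            trace? : ∀ j y → Dec (φ i₀ y ∈ A j)
            trace? j y = φ i₀ y ∈? A j
            trace : Fin c → Subset k
            trace j = ⟪ trace? j ⟫
            many : ∀ y → s ≤ ∣ col trace y ∣
            many y = ≤-trans (≮⇒≥ (λ lt → ¬found (φ i₀ y , ∈-image⁺ (φ i₀) ∈⊤ , lt)))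
              (≤-trans (≤-reflexive (∣⟪⟫∣ (λ j → φ i₀ y ∈? A j)))
                (p⊆q⇒∣p∣≤∣q∣ (λ {j} j∈ → ∈-col⁺ trace (∈-⟪⟫⁺ (trace? j) (∈-⟪⟫⁻ (λ j → φ i₀ y ∈? A j) j∈)))))
            pattern′ : ∃ λ (T : Fin c → Subset k) → (∀ j → T j ⊆ trace j) × (∀ x → ∣ col T x ∣ ≡ s)
            pattern′ = exact-subpattern trace many
            T : Fin c → Subset k
            T = proj₁ pattern′
            covered : ∀ j {x} → x ∈ T j → ∃ λ y → blk i₀ x ≡ blk (idx j) y
            covered j {x} x∈ with y , _ , e ← ∈-image⁻ (φ (idx j)) {⊤} (subst (φ i₀ x ∈_) (A≡ j) (∈-⟪⟫⁻ (trace? j) (proj₁ (proj₂ pattern′) j x∈)))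
              = y , φ-blk (sym e)
            small : ∀ j → ∣ T j ∣ ≤ suc q
            small j with ∣ T j ∣ ≤? suc q
            ... | yes le = le
            ... | no ≰t with U , U⊆ , eU ← shrink (T j) (suc t) (≰⇒> ≰t) = contradiction (λ {x} x∈ → covered j (U⊆ {x} x∈)) (meet (i₀≢ j) U eU)
            sub : ∃ λ (g : Fin l → Fin c) → (∀ i → ∣ T (g i) ∣ ≡ suc q) × DisjointCovering (s + 1) (c ∸ s + 1) (T ∘ g)
            sub = exact⇒subsequence T (proj₂ (proj₂ pattern′)) small e
            g : Fin l → Fin c
            g = proj₁ sub
            shape∈𝓜 : ∀ i → T (g i) L.∈ 𝓜
            shape∈𝓜 i = decidable-stable (T (g i) ∈ˢ? 𝓜) λ T∉ →
              own-not-covered (i₀≢ (g i)) (proj₁ (proj₂ sub) i , T∉) (covered (g i))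

-- The upper bound
module OwnSets {n : ℕ} (F : List (Subset n)) where

  OwnSet : Subset n → Subset n → Set
  OwnSet A S = S ⊆ A × All (λ B → B ≢ A → ¬ S ⊆ B) F

  ownSet? : ∀ A S → Dec (OwnSet A S)
  ownSet? A S = (S ⊆? A) ×-dec All.all? (λ B → ¬? (B ≟ˢ A) →-dec ¬? (S ⊆? B)) F

  ownSet-unique : ∀ {A B S} → A L.∈ F → OwnSet A S → OwnSet B S → A ≡ B
  ownSet-unique {A} {B} A∈ (S⊆A , _) (_ , only) with A ≟ˢ B
  ... | yes e = e
  ... | no ne = ⊥-elim (All.lookup only A∈ ne S⊆A)

  not-own : ∀ {A S} → S ⊆ A → ¬ OwnSet A S → ∃ λ B → B L.∈ F × A ≢ B × S ⊆ B
  not-own {A} {S} S⊆A ¬own with Any.any? (λ B → ¬? (A ≟ˢ B) ×-dec (S ⊆? B)) F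
  ... | yes p with B , B∈ , A≢B , S⊆B ← L.find p = B , B∈ , A≢B , S⊆B
  ... | no ¬p = ⊥-elim (¬own ((λ {x} → S⊆A {x}) , All.tabulate λ {B} B∈ B≢A S⊆B →
                  ¬p (L.lose B∈ ((λ e → B≢A (sym e)) , (λ {x} → S⊆B {x})))))

  #own : ℕ → Subset n → ℕ
  #own r A = length (filter (ownSet? A) (subsets n r))

  ∑-#own : Unique F → ∀ r → ∑ F (#own r) ≤ n C r
  ∑-#own uniq r = begin
    ∑ F (#own r)                                                      ≡⟨ ∑-cong F (λ A _ → length-filter (ownSet? A) (subsets n r)) ⟩
    ∑ F (λ A → ∑ (subsets n r) (λ S → 𝟙 (does (ownSet? A S))))        ≡⟨ ∑-swap F (subsets n r) _ ⟩
    ∑ (subsets n r) (λ S → ∑ F (λ A → 𝟙 (does (ownSet? A S))))        ≤⟨ ∑-max (subsets n r) _ 1 (λ S _ → ∑-𝟙-unique (λ A → ownSet? A S) uniq (λ A∈ _ → ownSet-unique A∈)) ⟩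
    length (subsets n r) * 1                                          ≡⟨ trans (*-identityʳ _) (length-subsets n r) ⟩
    n C r                                                             ∎
    where open ≤-Reasoning

  not-frameproof : ∀ {k l r s A} → A L.∈ F → (φ : Fin k → Fin n) → (∀ {i} → i ∈ A → ∃ λ x → φ x ≡ i) →
                   (X : Fin l → Subset k) (Y : Fin r → Subset k) →
                   (∀ i → ∃ λ B → B L.∈ F × A ≢ B × image φ (X i) ⊆ B) →
                   (∀ j → ∃ λ B → B L.∈ F × A ≢ B × image φ (Y j) ⊆ B) →
                   (∀ x → s ≤ ∣ col X x ∣ + ∣ col Y x ∣) → ¬ Frameproof (l + r) s F
  not-frameproof {k} {l} {r} {s} {A} A∈ φ φ-surj X Y covX covY enough fp =
    refute (fp A A∈ (proj₁ ∘ cover) (proj₁ ∘ proj₂ ∘ cover) (proj₁ ∘ proj₂ ∘ proj₂ ∘ cover))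
    where
    pick : Fin l ⊎ Fin r → Subset k
    pick (inj₁ i) = X i
    pick (inj₂ j) = Y j
    cover′ : ∀ z → ∃ λ B → B L.∈ F × A ≢ B × image φ (pick z) ⊆ B
    cover′ (inj₁ i) = covX i
    cover′ (inj₂ j) = covY j
    cover : ∀ j → ∃ λ B → B L.∈ F × A ≢ B × image φ (pick (Fin.splitAt l j)) ⊆ B
    cover j = cover′ (Fin.splitAt l j)
    module _ (x : Fin k) where
      hits : List (Fin (l + r))
      hits = map (Fin._↑ˡ r) (elements (col X x)) ++ map (l Fin.↑ʳ_) (elements (col Y x))
      hit? : ∀ j → Dec (φ x ∈ proj₁ (cover j))
      hit? j = φ x ∈? proj₁ (cover j)
      hits-unique : Unique hits
      hits-unique = Unique.++⁺ (Unique.map⁺ (Fin.↑ˡ-injective r _ _) (elements-unique (col X x)))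
        (Unique.map⁺ (Fin.↑ʳ-injective l _ _) (elements-unique (col Y x)))
        λ (p , p′) → case L.∈-map⁻ (Fin._↑ˡ r) p of λ { (i , _ , refl) → case L.∈-map⁻ (l Fin.↑ʳ_) p′ of λ { (j , _ , e) →
          case trans (sym (Fin.splitAt-↑ˡ l i r)) (trans (cong (Fin.splitAt l) e) (Fin.splitAt-↑ʳ l r j)) of λ () } }
      hit : ∀ {j} z → Fin.splitAt l j ≡ z → x ∈ pick z → φ x ∈ proj₁ (cover j)
      hit {j} z refl x∈ = proj₂ (proj₂ (proj₂ (cover j))) (∈-image⁺ φ x∈)
      hits-⊆ : ∀ {j} → j L.∈ hits → j L.∈ filter hit? (allFin (l + r))
      hits-⊆ j∈ with L.∈-++⁻ (map (Fin._↑ˡ r) (elements (col X x))) j∈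
      ... | inj₁ p with i , i∈ , refl ← L.∈-map⁻ (Fin._↑ˡ r) p
          = L.∈-filter⁺ hit? (L.∈-allFin _) (hit (inj₁ i) (Fin.splitAt-↑ˡ l i r) (∈-col⁻ X (∈-elements⁻ i∈)))
      ... | inj₂ p with j , j∈ , refl ← L.∈-map⁻ (l Fin.↑ʳ_) p
          = L.∈-filter⁺ hit? (L.∈-allFin _) (hit (inj₂ j) (Fin.splitAt-↑ʳ l r j) (∈-col⁻ Y (∈-elements⁻ j∈)))
      many : ∣ col X x ∣ + ∣ col Y x ∣ ≤ mult (φ x) (proj₁ ∘ cover)
      many = ≤-trans (≤-reflexive (sym (trans (List.length-++ (map (Fin._↑ˡ r) (elements (col X x))))
          (cong₂ _+_ (trans (List.length-map _ (elements (col X x))) (length-elements (col X x)))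
                     (trans (List.length-map _ (elements (col Y x))) (length-elements (col Y x)))))))
        (length-⊆ hits-unique hits-⊆)
    refute : ¬ (∃ λ i → i ∈ A × mult i (proj₁ ∘ cover) < s)
    refute (i , i∈ , few) with x , refl ← φ-surj i∈ = contradiction (≤-trans (enough x) (many x)) (<⇒≱ few)

  module _ {c s k l q m : ℕ} (uniq : Unique F) (size : All (λ A → ∣ A ∣ ≡ k) F) (fp : Frameproof c s F)
           (s≤c : s ≤ c) (l≤c : l ≤ c) (q≤k : q ≤ k) (e : s * k ≡ l + q * c)
           (max : ∀ H → IsUniform k (suc q) H → NoDisjointSeq l (s + 1) (c ∸ s + 1) H → length H ≤ m) where

    many-own : ∀ {A} → A L.∈ F → (∀ S → ∣ S ∣ ≡ q → ¬ OwnSet A S) → (k C suc q) ∸ m ≤ #own (suc q) A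
    many-own {A} A∈ none with φ , φ∈ , φ-inj , φ-surj ← enumerate A (All.lookup size A∈) = begin
      (k C suc q) ∸ m                                        ≤⟨ ∸-monoʳ-≤ (k C suc q) (max (filter (¬? ∘ own?) shapes)
                                                                  (Unique.filter⁺ (¬? ∘ own?) (subsets-unique k (suc q)) ,
                                                                   All.filter⁺ (¬? ∘ own?) (All.tabulate (∈-subsets⁻ k (suc q))))
                                                                  no-seq) ⟩
      (k C suc q) ∸ length (filter (¬? ∘ own?) shapes)       ≡⟨ cong (_∸ length (filter (¬? ∘ own?) shapes)) (trans (sym (length-subsets k (suc q))) (sym (length-filter-¬ own? shapes))) ⟩
      length (filter own? shapes) + length (filter (¬? ∘ own?) shapes) ∸ length (filter (¬? ∘ own?) shapes)
                                                             ≡⟨ m+n∸n≡m (length (filter own? shapes)) (length (filter (¬? ∘ own?) shapes)) ⟩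
      length (filter own? shapes)                            ≤⟨ length-injection (image φ) (Unique.filter⁺ own? (subsets-unique k (suc q)))
                                                                  (λ {T} T∈ → let T∈′ , own = L.∈-filter⁻ own? {xs = shapes} T∈ in
                                                                     L.∈-filter⁺ (ownSet? A) (∈-subsets⁺ (image φ T) (trans (∣image∣ φ φ-inj) (∈-subsets⁻ k (suc q) T∈′))) own)
                                                                  (λ _ _ → image-injective φ φ-inj) ⟩
      #own (suc q) A                                         ∎
      where
      open ≤-Reasoning
      shapes = subsets k (suc q)
      own? : ∀ T → Dec (OwnSet A (image φ T))
      own? T = ownSet? A (image φ T)
      inA : ∀ T → image φ T ⊆ A
      inA T = image-⊆ φ (λ {x} _ → φ∈ x)
      no-seq : NoDisjointSeq l (s + 1) (c ∸ s + 1) (filter (¬? ∘ own?) shapes)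
      no-seq X X∈ dc
        with Y , small , total ← complete s≤c l≤c e X (λ i → ∈-subsets⁻ k (suc q) (proj₁ (L.∈-filter⁻ (¬? ∘ own?) {xs = shapes} (X∈ i)))) dc
        = not-frameproof A∈ φ φ-surj X Y
            (λ i → not-own (inA (X i)) (proj₂ (L.∈-filter⁻ (¬? ∘ own?) {xs = shapes} (X∈ i))))
            -- The completing sets have size at most `q`, while `none` speaks of size exactly `q`;
            -- enlarging them can only increase the coverage.
            (λ j → let W , Y⊆W , eW = grow (Y j) q (small j) q≤k
                       B , B∈ , A≢B , W⊆B = not-own (inA W) (none (image φ W) (trans (∣image∣ φ φ-inj) eW))
                   in B , B∈ , A≢B , λ y∈ → W⊆B (image-⊆ φ (∈-image⁺ φ ∘ Y⊆W) y∈))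
            (λ x → ≤-reflexive (sym (total x)))
            (subst (λ c → Frameproof c s F) (sym (m+[n∸m]≡n l≤c)) fp)

    -- An edge with an own q-set pays with weight `a` on those sets; any other edge has at least `a`
    -- own sets of size `suc q`. Thus one inequality holds for all edges and can be summed over `F`.
    upper-bound : length F * ((k C suc q) ∸ m) ≤ ((k C suc q) ∸ m) * (n C q) + n C suc q
    upper-bound = begin
      length F * a                                         ≡⟨ ∑-const F a ⟨
      ∑ F (λ _ → a)                                        ≤⟨ ∑-mono F each ⟩
      ∑ F (λ A → a * #own q A + #own (suc q) A)            ≡⟨ ∑-+ F _ _ ⟩
      ∑ F (λ A → a * #own q A) + ∑ F (#own (suc q))        ≡⟨ cong (_+ ∑ F (#own (suc q))) (∑-*ˡ F a (#own q)) ⟩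
      a * ∑ F (#own q) + ∑ F (#own (suc q))                ≤⟨ +-mono-≤ (*-monoʳ-≤ a (∑-#own uniq q)) (∑-#own uniq (suc q)) ⟩
      a * (n C q) + n C suc q                              ∎
      where
      open ≤-Reasoning
      a = (k C suc q) ∸ m
      each : ∀ A → A L.∈ F → a ≤ a * #own q A + #own (suc q) A
      each A A∈ with #own q A in eq
      ... | suc w = ≤-trans (m≤m*n a (suc w)) (m≤m+n _ _)
      ... | zero  = ≤-trans (many-own A∈ λ S eS own → case trans (sym eq) (nonzero (L.∈-filter⁺ (ownSet? A) (∈-subsets⁺ S eS) own)) of λ ())
                            (m≤n+m _ (a * 0))
        where
        nonzero : ∀ {xs : List (Subset n)} {S} → S L.∈ xs → length xs ≡ suc (Data.Nat.pred (length xs))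
        nonzero (here _)  = refl
        nonzero (there _) = refl

-- The limit

frac≤+ : ∀ n₁ d₁ n₂ d₂ n₃ d₃ → n₁ * (suc d₂ * suc d₃) ≤ (n₂ * suc d₃ + n₃ * suc d₂) * suc d₁ →
         (ℤ.+ n₁ ℚ./ suc d₁) ℚ.≤ (ℤ.+ n₂ ℚ./ suc d₂) ℚ.+ (ℤ.+ n₃ ℚ./ suc d₃)
frac≤+ n₁ d₁ n₂ d₂ n₃ d₃ le = ℚ.toℚᵘ-cancel-≤ (begin
  ℚ.toℚᵘ (ℤ.+ n₁ ℚ./ suc d₁)                                                 ≃⟨ ℚ.toℚᵘ-fromℚᵘ (mkℚᵘ (ℤ.+ n₁) d₁) ⟩
  mkℚᵘ (ℤ.+ n₁) d₁                                                           ≤⟨ ℚᵘ.*≤* (subst₂ ℤ._≤_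
      (ℤ.pos-* n₁ (suc d₂ * suc d₃))
      (trans (ℤ.pos-* (n₂ * suc d₃ + n₃ * suc d₂) (suc d₁)) (cong (ℤ._* ℤ.+ suc d₁) (trans (ℤ.pos-+ (n₂ * suc d₃) (n₃ * suc d₂)) (cong₂ ℤ._+_ (ℤ.pos-* n₂ (suc d₃)) (ℤ.pos-* n₃ (suc d₂))))))
      (ℤ.+≤+ le)) ⟩
  mkℚᵘ (ℤ.+ n₂) d₂ ℚᵘ.+ mkℚᵘ (ℤ.+ n₃) d₃                                     ≃⟨ ℚᵘ.+-cong (ℚ.toℚᵘ-fromℚᵘ (mkℚᵘ (ℤ.+ n₂) d₂)) (ℚ.toℚᵘ-fromℚᵘ (mkℚᵘ (ℤ.+ n₃) d₃)) ⟨
  ℚ.toℚᵘ (ℤ.+ n₂ ℚ./ suc d₂) ℚᵘ.+ ℚ.toℚᵘ (ℤ.+ n₃ ℚ./ suc d₃)                 ≃⟨ ℚ.toℚᵘ-homo-+ (ℤ.+ n₂ ℚ./ suc d₂) (ℤ.+ n₃ ℚ./ suc d₃) ⟨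
  ℚ.toℚᵘ ((ℤ.+ n₂ ℚ./ suc d₂) ℚ.+ (ℤ.+ n₃ ℚ./ suc d₃))                       ∎)
  where open ℚᵘ.≤-Reasoning

≤+⇒-≤ : ∀ {p r δ} → p ℚ.≤ r ℚ.+ δ → p ℚ.- r ℚ.≤ δ
≤+⇒-≤ {p} {r} {δ} le = begin
  p ℚ.- r                      ≤⟨ ℚ.+-monoˡ-≤ (ℚ.- r) le ⟩
  (r ℚ.+ δ) ℚ.- r              ≡⟨ cong (ℚ._- r) (ℚ.+-comm r δ) ⟩
  (δ ℚ.+ r) ℚ.- r              ≡⟨ ℚ.+-assoc δ r (ℚ.- r) ⟩
  δ ℚ.+ (r ℚ.- r)              ≡⟨ cong (δ ℚ.+_) (ℚ.+-inverseʳ r) ⟩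
  δ ℚ.+ ℚ.0ℚ                   ≡⟨ ℚ.+-identityʳ δ ⟩
  δ                            ∎
  where open ℚ.≤-Reasoning

∣-∣≤ : ∀ {p r δ} → p ℚ.≤ r ℚ.+ δ → r ℚ.≤ p ℚ.+ δ → ℚ.∣ p ℚ.- r ∣ ℚ.≤ δ
∣-∣≤ {p} {r} {δ} le ge with ℚ.∣p∣≡p∨∣p∣≡-p (p ℚ.- r)
... | inj₁ e = subst (ℚ._≤ δ) (sym e) (≤+⇒-≤ le)
... | inj₂ e = subst (ℚ._≤ δ) (sym (trans e (trans (ℚ.neg-distrib-+ p (ℚ.- r)) (trans (cong (ℚ.- p ℚ.+_) (ℚ-neg-involutive r)) (ℚ.+-comm (ℚ.- p) r))))) (≤+⇒-≤ ge)

archimedean : ∀ ε → ℚ.0ℚ ℚ.< ε → ∃ λ d → (ℤ.+ 1 ℚ./ suc d) ℚ.< ε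
archimedean ε@(mkℚ (ℤ.+ suc a) b _) _ = suc b , ℚ.toℚᵘ-cancel-< (ℚᵘ.<-respˡ-≃ (ℚᵘ.≃-sym (ℚ.toℚᵘ-fromℚᵘ (mkℚᵘ (ℤ.+ 1) (suc b))))
  (ℚᵘ.*<* (subst₂ ℤ._<_ (ℤ.pos-* 1 (suc b)) (ℤ.pos-* (suc a) (suc (suc b)))
    (ℤ.+<+ (≤-trans (≤-reflexive (cong (2 +_) (+-identityʳ b))) (m≤n*m (suc (suc b)) (suc a)))))))
archimedean (mkℚ (ℤ.+ 0) b _) (ℚ.*<* (ℤ.+<+ ()))
archimedean (mkℚ ℤ.-[1+ a ] b _) (ℚ.*<* ())

-- The hypotheses place f(e+1)/b between (d+1)/(d+2) and (d+2)/(d+1), hence within 1/(d+1) of 1;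
-- division by e+1 does not increase the error.
ratio-close : ∀ f b e d → 1 ≤ b → suc d * b ≤ suc (suc d) * (f * suc e) → suc d * (f * suc e) ≤ suc (suc d) * b →
              ℚ.∣ (f ÷ b) ℚ.- (ℤ.+ 1 ℚ./ suc e) ∣ ℚ.≤ ℤ.+ 1 ℚ./ suc d
ratio-close f (suc b′) e d _ lower upper = ∣-∣≤
  (frac≤+ f b′ 1 e 1 d (begin
    f * (suc e * suc d)                      ≡⟨ alg₁ f (suc e) (suc d) ⟩
    suc d * (f * suc e)                      ≤⟨ upper ⟩
    b + suc d * b                            ≤⟨ +-monoˡ-≤ (suc d * b) (m≤n*m b (suc e)) ⟩
    suc e * b + suc d * b                    ≡⟨ alg₂ (suc e) (suc d) b ⟩
    (1 * suc d + 1 * suc e) * b              ∎))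
  (frac≤+ 1 e f b′ 1 d (begin
    1 * (b * suc d)                          ≡⟨ alg₃ b (suc d) ⟩
    suc d * b                                ≤⟨ slack (≤-total (f * suc e) b) ⟩
    b + suc d * (f * suc e)                  ≤⟨ +-monoˡ-≤ (suc d * (f * suc e)) (m≤n*m b (suc e)) ⟩
    suc e * b + suc d * (f * suc e)          ≡⟨ alg₄ (suc e) (suc d) b f ⟩
    (f * suc d + 1 * b) * suc e              ∎))
  where
  open ≤-Reasoning
  b = suc b′
  slack : f * suc e ≤ b ⊎ b ≤ f * suc e → suc d * b ≤ b + suc d * (f * suc e)
  slack (inj₁ le) = ≤-trans lower (+-monoˡ-≤ (suc d * (f * suc e)) le)
  slack (inj₂ ge) = ≤-trans (*-monoʳ-≤ (suc d) ge) (m≤n+m _ b)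
  alg₁ : ∀ f a E → f * (a * E) ≡ E * (f * a)
  alg₁ = ℕ-solve-∀
  alg₂ : ∀ a E b → a * b + E * b ≡ (1 * E + 1 * a) * b
  alg₂ = ℕ-solve-∀
  alg₃ : ∀ b E → 1 * (b * E) ≡ E * b
  alg₃ = ℕ-solve-∀
  alg₄ : ∀ a E b f → a * b + E * (f * a) ≡ (f * E + 1 * b) * a
  alg₄ = ℕ-solve-∀

-- With the residue taken in 1, ..., c instead of 0, ..., c-1, the quotient is one less than the
-- ceiling even when `c` divides `s * k`.
⌈⌉-unique : ∀ {c s k t l q} → 1 ≤ l → l ≤ c → s * k ≡ l + q * c → s * k ≤ c * t → c * t < s * k + c → t ≡ suc q
⌈⌉-unique {c} {s} {k} {t} {l} {q} 1≤l l≤c e lo hi = ≤-antisym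
  (≤-pred (*-cancelˡ-< c t (suc (suc q)) (begin-strict
    c * t                <⟨ hi ⟩
    s * k + c            ≡⟨ cong (_+ c) e ⟩
    l + q * c + c        ≤⟨ +-monoˡ-≤ c (+-monoˡ-≤ (q * c) l≤c) ⟩
    c + q * c + c        ≡⟨ alg c q ⟩
    c * suc (suc q)      ∎)))
  (*-cancelˡ-< c q t (begin-strict
    c * q                ≡⟨ *-comm c q ⟩
    q * c                <⟨ +-monoˡ-≤ (q * c) 1≤l ⟩
    l + q * c            ≡⟨ e ⟨
    s * k                ≤⟨ lo ⟩
    c * t                ∎))
  where
  open ≤-Reasoning
  alg : ∀ c q → c + q * c + c ≡ c * (2 + q)
  alg = ℕ-solve-∀

nCt≥1 : ∀ {n t} → t ≤ n → 1 ≤ n C t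
nCt≥1 {n} {t} t≤n with S , _ , e ← shrink {n} ⊤ t (subst (t ≤_) (sym (∣⊤∣≡n n)) t≤n) =
  subst (1 ≤_) (length-subsets n t) (nonempty (∈-subsets⁺ S e))
  where
  nonempty : ∀ {A : Set} {xs : List A} {x} → x L.∈ xs → 1 ≤ length xs
  nonempty (here _)  = s≤s z≤n
  nonempty (there _) = s≤s z≤n

-- Otherwise the extremal family would consist of all t-subsets and contain the sequence from
-- `disjointCovering-exists`.
m<kCt : ∀ {c s k l q m} → s ≤ c → s * k ≡ l + q * c → s * k ≤ c * suc q →
        IsMatchingNumber k (suc q) l (s + 1) (c ∸ s + 1) m → m < k C suc q
m<kCt {c} {s} {k} {l} {q} {m} s≤c e le ((𝓜 , (uniq , size) , no-seq , refl) , _) with m <? k C suc q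
... | yes lt = lt
... | no ≮ with A , large , dc ← disjointCovering-exists s≤c e le
  = ⊥-elim (no-seq A (λ i → full-⊆ _≟ˢ_ uniq (subsets-unique k (suc q)) (λ T∈ → ∈-subsets⁺ _ (All.lookup size T∈))
      (≤-trans (≤-reflexive (length-subsets k (suc q))) (≮⇒≥ ≮)) (∈-subsets⁺ (A i) (large i))) dc)

module _ {c s k l q m e : ℕ} (s≤c : s ≤ c) (l≤c : l ≤ c) (t≤k : suc q ≤ k) (eq : s * k ≡ l + q * c)
         (f : ℕ → ℕ) (f-max : ∀ n → IsFrameproofMax c s n k (f n))
         (m-max : IsMatchingNumber k (suc q) l (s + 1) (c ∸ s + 1) m) (a≡ : (k C suc q) ∸ m ≡ suc e) (d : ℕ) where

  eventually-upper : ∃ λ n₀ → ∀ n → n₀ ≤ n → suc d * (f n * suc e) ≤ suc (suc d) * (n C suc q)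
  -- Beyond this threshold (d+1)(e+1) C(n,q) is at most C(n,q+1), so the error term costs a single
  -- C(n,q+1).
  eventually-upper = suc q + suc d * suc e * suc q , bound
    where
    bound : ∀ n → suc q + suc d * suc e * suc q ≤ n → suc d * (f n * suc e) ≤ suc (suc d) * (n C suc q)
    bound n large with proj₁ (f-max n)
    ... | F , (uniq , size) , fp , length≡ = begin
      suc d * (f n * suc e)                                   ≡⟨ cong₂ (λ x y → suc d * (x * y)) length≡ a≡ ⟨
      suc d * (length F * a)                                  ≤⟨ *-monoʳ-≤ (suc d) (OwnSets.upper-bound F uniq size fp s≤c l≤c (<⇒≤ t≤k) eq (proj₂ m-max)) ⟩
      suc d * (a * (n C q) + n C suc q)                       ≡⟨ cong (λ z → suc d * (z * (n C q) + n C suc q)) a≡ ⟩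
      suc d * (suc e * (n C q) + n C suc q)                   ≡⟨ alg (suc d) (suc e) (n C q) (n C suc q) ⟩
      suc d * suc e * (n C q) + suc d * (n C suc q)           ≤⟨ +-monoˡ-≤ _ (nCt-ratio (suc d * suc e) (≤-trans (m≤m+n (suc q) _) large)
                                                                   (m+n≤o⇒m≤o∸n (suc d * suc e * suc q) (≤-trans (≤-reflexive (+-comm _ q)) (≤-trans (n≤1+n _) large)))) ⟩
      suc (suc d) * (n C suc q)                               ∎
      where
      open ≤-Reasoning
      a = (k C suc q) ∸ m
      alg : ∀ d e x y → d * (e * x + y) ≡ d * e * x + d * y
      alg = ℕ-solve-∀

  eventually-lower : ∃ λ n₀ → ∀ n → n₀ ≤ n → suc d * (n C suc q) ≤ suc (suc d) * (f n * suc e)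
  eventually-lower with proj₁ m-max
  ... | 𝓜 , (uniq , size) , no-seq , refl = suc q + proj₁ eventual , bound
    where
    open Constructions k (suc q) t≤k (s≤s z≤n) 𝓜 uniq size
    length-own : length ownShapes ≡ suc e
    length-own = trans (sym (trans (cong (_∸ length 𝓜) (sym length-ownShapes)) (m+n∸m≡n (length 𝓜) (length ownShapes)))) a≡
    first : ∀ (xs : List (Subset k)) → length xs ≡ suc e → ∃ λ x → x L.∈ xs
    first (x ∷ xs) _ = x , here refl
    T₀ : Subset k
    T₀ = proj₁ (first ownShapes length-own)
    own₀ : Own T₀
    own₀ = let T∈ , T∉ = L.∈-filter⁻ (λ T → ¬? (T ∈ˢ? 𝓜)) {xs = subsets k (suc q)} (proj₂ (first ownShapes length-own)) in ∈-subsets⁻ k (suc q) T∈ , T∉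
    eventual : PackingsFor own₀ (suc d)
    eventual = packings own₀ (suc d)
    bound : ∀ n → suc q + proj₁ eventual ≤ n → suc d * (n C suc q) ≤ suc (suc d) * (f n * suc e)
    bound n large
      with N , len , rl , St , N≤n , dense ← proj₂ eventual n (≤-trans (m≤n+m _ (suc q)) large)
      with F , uniform , fp , length≡ ← frameproof own₀ St {c = c} {s} {l} {q} N≤n refl eq no-seq
      = *-cancelˡ-≤ (suc q !) {{suc q !≢0}} (begin
        suc q ! * (suc d * (n C suc q))                ≡⟨ alg (suc q !) (suc d) (n C suc q) ⟩
        suc d * (suc q ! * (n C suc q))                ≤⟨ *-monoʳ-≤ (suc d) (t!*nCt≤n^t (≤-trans (m≤m+n (suc q) _) large)) ⟩
        suc d * n ^ suc q                              ≤⟨ dense ⟩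
        suc (suc d) * (suc q ! * (len * length ownShapes))
          ≡⟨ cong (λ z → suc (suc d) * (suc q ! * (len * z))) length-own ⟩
        suc (suc d) * (suc q ! * (len * suc e))        ≤⟨ *-monoʳ-≤ (suc (suc d)) (*-monoʳ-≤ (suc q !) (*-monoˡ-≤ (suc e) (subst (_≤ f n) length≡ (proj₂ (f-max n) F uniform fp)))) ⟩
        suc (suc d) * (suc q ! * (f n * suc e))        ≡⟨ alg (suc (suc d)) (suc q !) (f n * suc e) ⟩
        suc q ! * (suc (suc d) * (f n * suc e))        ∎)
      where
      open ≤-Reasoning
      alg : ∀ a b c → a * (b * c) ≡ b * (a * c)
      alg = ℕ-solve-∀

open import Data.Integer using (+_)
open import Data.Rational using (_/_)

theorem1p1 : (c s k t lam : ℕ) →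
    2 ≤ c → 2 ≤ k → 1 ≤ s → s ≤ c ∸ 1 →
    s * k ≤ c * t → c * t < s * k + c →
    1 ≤ lam → lam ≤ c → (∃ λ q → s * k ≡ lam + q * c) →
    (f : ℕ → ℕ) → (∀ n → IsFrameproofMax c s n k (f n)) →
    (m : ℕ) → IsMatchingNumber k t lam (s + 1) (c ∸ s + 1) m →
    ∃ λ e → (k C t) ∸ m ≡ suc e ×
    Converges (λ n → f n ÷ (n C t)) ((+ 1) / suc e)
theorem1p1 c s k t lam 2≤c 2≤k 1≤s s≤c-1 lo hi 1≤lam lam≤c (q , eq) f f-max m m-max
  with refl ← ⌈⌉-unique {c} {s} {k} {t} {lam} {q} 1≤lam lam≤c eq lo hi = e , a≡ , converges
  where
  s≤c : s ≤ c
  s≤c = ≤-trans s≤c-1 (m∸n≤m c 1)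
  t≤k : suc q ≤ k
  -- From ct < sk + c and s ≤ c follows ct < c(k+1).
  t≤k = ≤-pred (*-cancelˡ-< c (suc q) (suc k) (<-≤-trans hi
    (≤-trans (+-monoˡ-≤ c (*-monoˡ-≤ k s≤c)) (≤-reflexive (trans (+-comm (c * k) c) (sym (*-suc c k)))))))
  e : ℕ
  e = (k C suc q) ∸ suc m
  a≡ : (k C suc q) ∸ m ≡ suc e
  a≡ = sym (trans (sym (+-∸-assoc 1 (m<kCt s≤c eq lo m-max))) refl)
  converges : Converges (λ n → f n ÷ (n C suc q)) ((+ 1) / suc e)
  converges ε 0<ε with d , δ<ε ← archimedean ε 0<ε =
    suc q + (proj₁ lower + proj₁ upper) , λ n large →
      ℚ.≤-<-trans (ratio-close (f n) (n C suc q) e d (nCt≥1 {n} {suc q} (≤-trans (m≤m+n (suc q) _) large))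
        (proj₂ lower n (≤-trans (≤-trans (m≤m+n _ _) (m≤n+m _ (suc q))) large))
        (proj₂ upper n (≤-trans (≤-trans (m≤n+m _ (proj₁ lower)) (m≤n+m _ (suc q))) large))) δ<ε
    where
    lower = eventually-lower s≤c lam≤c t≤k eq f f-max m-max a≡ d
    upper = eventually-upper s≤c lam≤c t≤k eq f f-max m-max a≡ d
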